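{- The problem Saving $k$-Vertices parameterized by the distance to disjoint unions of stars (the size of the given modulator $X$ to that class) does not admit a polynomial kernel, unless $\mathrm{NP}\subseteq \mathrm{coNP/poly}$.
   Context: All graphs are undirected, connected (for input graphs $G$), finite and simple. $G\setminus X$ denotes the graph obtained from $G$ by deleting the vertices of $X$. Firefighting process on $(G,s)$: at time $0$ a fire starts at $s$. At each subsequent time step $i=1,2,\ldots$, the firefighter permanently defends one vertex that is not burning, and then the fire spreads from every burning vertex to all its undefended neighbors. The process stops when the fire can no longer spread. A vertex is saved if it is not burned at the end (defended vertices count as saved). Saving $k$-Vertices parameterized by distance to disjoint unions of stars: the input is a graph $G$, a vertex $s\in V(G)$, a set $X\subseteq V(G)$ such that $G\setminus X$ is a disjoint union of stars, and an integer $k$; the parameter is $|X|$; the question is whether there is a strategy of the firefighter that saves at least $k$ vertices when the fire starts at $s$. A kernelization algorithm for a parameterized problem $Q$ is a polynomial-time algorithm that maps an instance $(x,p)$ of $Q$ to an equivalent instance $(x',p')$ of $Q$ with $|x'|\le h(p)$ for some computable function $h$ and $p'\le p$; the kernel is polynomial if $h$ is a polynomial. -}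

module Defs where

open import Data.Bool.Base using (Bool; true; false; T)
open import Data.Bool.Properties using (T?)
open import Data.Fin.Base using (Fin)
open import Data.Fin.Properties using (any?)
open import Data.Fin.Subset as Subset using (Subset; _∈_; _∉_; ∣_∣; ⁅_⁆; _∪_)
open import Data.Fin.Subset.Properties using (_∈?_)
open import Data.List.Base using (List; []; _∷_; [_]; _++_; length; map; replicate)
open import Data.Maybe.Base as Maybe using (Maybe; just; nothing)
open import Data.Nat.Base using (ℕ; zero; suc; _+_; _*_; _≤_)
open import Data.Nat.Binary.Base as ℕᵇ using (ℕᵇ; 2[1+_]; 1+[2_])
open import Data.Product.Base using (Σ-syntax; ∃-syntax; _×_; _,_)
open import Data.Sum.Base using (_⊎_)
open import Data.Vec.Base as Vec using (Vec; _∷_)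
open import Function.Bundles using (_⇔_)
open import Level using (Level; 0ℓ; _⊔_) renaming (suc to lsuc)
open import Relation.Binary.Construct.Closure.ReflexiveTransitive
  using () renaming (Star to ReflTransClosure)
open import Relation.Binary.PropositionalEquality using (_≡_; _≢_)
open import Relation.Nullary.Decidable using (does; ¬?; _×-dec_; _⊎-dec_)
open import Relation.Unary using (Pred; ∁)

------------------------------------------------------------------------
-- Words and polynomials

Word : Set
Word = List Bool

-- Coefficients in ℕ, constant term first.
Polynomial : Set
Polynomial = List ℕ

eval : Polynomial → ℕ → ℕ
eval []      n = 0
eval (a ∷ p) n = a + n * eval p n

-- Every bit of the first word is preceded by true; false ends that word.
pair : Word × Word → Word
pair ([]    , y) = false ∷ y
pair (b ∷ x , y) = true ∷ b ∷ pair (x , y)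

------------------------------------------------------------------------
-- Deterministic multi-tape Turing machines with two-way infinite tapes

data Symbol (g : ℕ) : Set where
  blank : Symbol g
  bit   : Bool → Symbol g
  aux   : Fin g → Symbol g

data Move : Set where
  left stay right : Move

-- `before` lists the cells left of the head, nearest first; all cells
-- not listed are blank.
record Tape (g : ℕ) : Set where
  constructor tape
  field
    before  : List (Symbol g)
    current : Symbol g
    after   : List (Symbol g)

move : ∀ {g} → Move → Tape g → Tape g
move left  (tape []       c as)       = tape [] blank (c ∷ as)
move left  (tape (b ∷ bs) c as)       = tape bs b (c ∷ as)
move stay  t                          = t
move right (tape bs       c [])       = tape (c ∷ bs) blank []
move right (tape bs       c (a ∷ as)) = tape (c ∷ bs) a as

act : ∀ {g} → Symbol g × Move → Tape g → Tape g
act (w , m) (tape bs _ as) = move m (tape bs w as)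

-- The machine has 1 + workTapes tapes; δ returns nothing when it halts.
record TuringMachine : Set where
  field
    workTapes  : ℕ
    auxSymbols : ℕ
    states     : ℕ
    start      : Fin states
    δ : Fin states → Vec (Symbol auxSymbols) (suc workTapes) →
        Maybe (Fin states × Vec (Symbol auxSymbols × Move) (suc workTapes))

emptyTape : ∀ {g} → Tape g
emptyTape = tape [] blank []

inputTape : ∀ {g} → Word → Tape g
inputTape []      = emptyTape
inputTape (b ∷ x) = tape [] (bit b) (map bit x)

leadingBits : ∀ {g} → List (Symbol g) → Word
leadingBits (bit b ∷ ss) = b ∷ leadingBits ss
leadingBits _            = []

-- The output is the maximal block of bits starting at the head.
outputOf : ∀ {g} → Tape g → Word
outputOf (tape _ c as) = leadingBits (c ∷ as)

module Execution (M : TuringMachine) where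
  open TuringMachine M

  Configuration : Set
  Configuration = Fin states × Vec (Tape auxSymbols) (suc workTapes)

  initial : Word → Configuration
  initial x = start , inputTape x ∷ Vec.replicate workTapes emptyTape

  step : Configuration → Maybe Configuration
  step (q , ts) =
    Maybe.map (λ (q′ , as) → q′ , Vec.zipWith act as ts)
              (δ q (Vec.map Tape.current ts))

  -- The halting configuration, if it is reached in at most t steps.
  run : ℕ → Configuration → Maybe Configuration
  run t c with step c
  run t       c | nothing = just c
  run zero    c | just _  = nothing
  run (suc t) c | just c′ = run t c′

  output : Configuration → Word
  output (_ , t ∷ _) = outputOf t

  OutputsWithin : ℕ → Word → Word → Set
  OutputsWithin t x y = Maybe.map output (run t (initial x)) ≡ just y

PolyTime : {A B : Set} → (A → Word) → (B → Word) → (A → B) → Set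
PolyTime encA encB f =
  Σ[ M ∈ TuringMachine ] Σ[ p ∈ Polynomial ]
    ∀ a → Execution.OutputsWithin M
            (eval p (length (encA a))) (encA a) (encB (f a))

------------------------------------------------------------------------
-- Complexity classes

Language : Set₁
Language = Pred Word 0ℓ

Class : (ℓ : Level) → Set (lsuc 0ℓ ⊔ lsuc ℓ)
Class ℓ = Pred Language ℓ

NP : Class 0ℓ
NP L =
  Σ[ V ∈ (Word × Word → Bool) ] PolyTime pair [_] V ×
  (Σ[ p ∈ Polynomial ] ∀ x →
     L x ⇔ (∃[ w ] length w ≤ eval p (length x) × T (V (x , w))))

coNP : Class 0ℓ
coNP L = NP (∁ L)

-- Karp–Lipton advice: polynomially long, depending only on the input length.
_/poly : ∀ {ℓ} → Class ℓ → Class (lsuc 0ℓ ⊔ ℓ)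
(C /poly) L =
  Σ[ L′ ∈ Language ] C L′ ×
  (Σ[ advice ∈ (ℕ → Word) ]
    (Σ[ p ∈ Polynomial ] ∀ n → length (advice n) ≤ eval p n) ×
    (∀ x → L x ⇔ L′ (pair (x , advice (length x)))))

------------------------------------------------------------------------
-- Parameterized problems and kernels

record ParameterizedProblem : Set₁ where
  field
    Instance  : Set
    encode    : Instance → Word
    parameter : Instance → ℕ
    Yes       : Instance → Set

HasPolynomialKernel : ParameterizedProblem → Set
HasPolynomialKernel Q =
  Σ[ kernel ∈ (Instance → Instance) ]
    PolyTime encode encode kernel ×
    (∀ I → Yes I ⇔ Yes (kernel I)) ×
    (Σ[ h ∈ Polynomial ] ∀ I →
       length (encode (kernel I)) ≤ eval h (parameter I)) ×
    (∀ I → parameter (kernel I) ≤ parameter I)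
  where open ParameterizedProblem Q

------------------------------------------------------------------------
-- Graphs

record Graph (n : ℕ) : Set where
  field
    adjacent    : Fin n → Fin n → Bool
    symmetric   : ∀ u v → adjacent u v ≡ adjacent v u
    irreflexive : ∀ v → adjacent v v ≡ false

  Adj : Fin n → Fin n → Set
  Adj u v = T (adjacent u v)

open Graph using (adjacent; Adj)

Connected : ∀ {n} → Graph n → Set
Connected G = ∀ u v → ReflTransClosure (Adj G) u v

-- Adjacency in G ∖ X, whose vertices are those outside X.
AdjOutside : ∀ {n} → Graph n → Subset n → Fin n → Fin n → Set
AdjOutside G X u v = u ∉ X × v ∉ X × Adj G u v

-- The subgraph of G induced by P is a star K₁,ₘ with m ≥ 0.
IsStar : ∀ {n} → Graph n → Pred (Fin n) 0ℓ → Set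
IsStar G P =
  ∃[ c ] P c × (∀ u v → P u → P v →
                  Adj G u v ⇔ (u ≢ v × (u ≡ c ⊎ v ≡ c)))

-- G ∖ X is a disjoint union of stars: each of its components is a star.
StarsOutside : ∀ {n} → Graph n → Subset n → Set
StarsOutside G X =
  ∀ u → u ∉ X → IsStar G (λ v → ReflTransClosure (AdjOutside G X) u v)

------------------------------------------------------------------------
-- Firefighting

module Firefighting {n : ℕ} (G : Graph n) where

  -- The burning vertices after the fire B spreads once, D being defended.
  spread : Subset n → Subset n → Subset n
  spread D B = Vec.tabulate λ v → does
    ((v ∈? B) ⊎-dec
     (¬? (v ∈? D) ×-dec any? λ u → (u ∈? B) ×-dec T? (adjacent G u v)))

  -- Play D B F: from defended set D and burning set B, the firefighter can
  -- act so that the process stops with exactly the vertices of F burned.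
  data Play (D B : Subset n) : Subset n → Set where
    stop   : spread D B ≡ B → Play D B B
    defend : ∀ {F} → spread D B ≢ B → ∀ v → v ∉ B →
             Play (D ∪ ⁅ v ⁆) (spread (D ∪ ⁅ v ⁆) B) F → Play D B F

  CanSave : Fin n → ℕ → Set
  CanSave s k = ∃[ F ] Play Subset.⊥ ⁅ s ⁆ F × k ≤ ∣ Subset.∁ F ∣

------------------------------------------------------------------------
-- Saving k-Vertices parameterized by distance to disjoint unions of stars

record FirefighterInstance : Set where
  field
    n         : ℕ
    G         : Graph n
    connected : Connected G
    s         : Fin n
    X         : Subset n
    stars     : StarsOutside G X
    k         : ℕ

-- Bijective base-2 digits, least significant first.
binary : ℕᵇ → Word
binary ℕᵇ.zero  = []
binary 2[1+ m ] = true  ∷ binary m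
binary 1+[2 m ] = false ∷ binary m

-- n in unary, the adjacency matrix, the indicator vectors of {s} and X
-- (each of a length fixed by n), and then k in binary.
encodeFirefighter : FirefighterInstance → Word
encodeFirefighter I =
  replicate n true ++ false ∷
  Vec.toList (Vec.concat (Vec.tabulate λ u → Vec.tabulate (adjacent G u))) ++
  Vec.toList ⁅ s ⁆ ++
  Vec.toList X ++
  binary (ℕᵇ.fromℕ k)
  where open FirefighterInstance I

SavingKVertices : ParameterizedProblem
SavingKVertices = record
  { Instance  = FirefighterInstance
  ; encode    = encodeFirefighter
  ; parameter = λ I → ∣ FirefighterInstance.X I ∣
  ; Yes       = λ I → let open FirefighterInstance I in
                      Firefighting.CanSave G s k
  }

-- Composing 1 + t inputs of length n of a problem L in NP into one instance that is a yes-instance iff some input is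
-- in L, and then applying the kernel, gives at most t bits, because the modulator of the instance has a size that is
-- polynomial in n and almost independent of t. As in the theorem of Fortnow and Santhanam, it follows that polynomially many
-- kernels of no-instances suffice as advice: x ∉ L iff some tuple that contains x is composed to an instance whose kernel
-- is among them, and the tuple is a witness for that.
--
-- As the advice depends on n, only the size of the composed instance matters: the advice also contains a straight-line
-- program that writes it down and runs the kernel on it, and the verifier is an interpreter for such programs.
--
-- The runs of the verifier of L are the solutions of a system of local constraints on the cells of a tableau. The
-- firefighter chooses the values of its variables, and of variables that select an input, while the fire passes
-- through the modulator; the vertices outside the modulator form an independent set and count the satisfied constraints.

module Submission where

open import Defs
open import Data.Bool.Base using (Bool; true; false; T; not; _∨_; _∧_)
open import Data.Empty using (⊥-elim; ⊥)
open import Data.Maybe.Base using (Maybe; just; nothing)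
open import Data.Maybe.Properties using (just-injective)
open import Data.Nat.Tactic.RingSolver using (solve-∀)
open import Data.Product.Base using (Σ-syntax; _×_; _,_; ∃-syntax; uncurry; proj₁; proj₂)
open import Data.Unit.Base using (⊤; tt)
open import Function.Base using (_∘_; id; case_of_)
open import Function.Bundles using (_⇔_; mk⇔; Equivalence)
open import Relation.Binary.PropositionalEquality hiding ([_])
open import Relation.Nullary using (¬_; Dec; yes; no; does; contradiction)
open import Relation.Nullary.Decidable using (_→-dec_; ¬?; _×-dec_; _⊎-dec_; toWitness; fromWitness; isYes)

-- Two obstacles shape the construction. One is circular: `t` must be at least `h` of the modulator
-- size, but the modulator holds the candidates for the variables that name an input, so it grows
-- with the number of inputs. Names with a constant number `d` of one-hot digits in base `b` cost
-- `d * b` variables for `b ^ d` inputs, so the inputs win once `d` is large compared with the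
-- degree of the bound. The other is a slack of one: when the fire reaches the candidates the
-- firefighter gains one more vertex, so scores are known only up to 1. Sets for constraints and
-- bits therefore occur twice and pairs of candidates `R` times; then one vertex cannot hide a
-- violation. Input words enter the graph only as adjacency bits between candidates and vertices
-- outside the modulator, while layout, modulator and threshold depend on `n` alone. Hence one
-- program serves all tuples, and all encodings share one length and one running time. Membership in
-- a language of NP is settled by exhaustive search, which keeps the argument constructive.

-- Polynomials over the natural numbers and polynomially bounded functions

module PolynomialBounds where
  open import Data.List.Base using ([]; _∷_; length)
  open import Data.Nat.Base
  open import Data.Nat.Properties

  evalMono : ∀ p {m n} → m ≤ n → eval p m ≤ eval p n
  evalMono []      m≤n = z≤n
  evalMono (a ∷ p) m≤n = +-monoʳ-≤ a (*-mono-≤ m≤n (evalMono p m≤n))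

  -- An upper bound is enough for lengths and running times, and such bounds compose because natural
  -- coefficients make `eval` monotone.
  PolyBounded : (ℕ → ℕ) → Set
  PolyBounded f = Σ[ p ∈ Polynomial ] ∀ n → f n ≤ eval p n

  infixl 6 _+ᵖ_
  infixl 7 _*ᵖ_

  _+ᵖ_ : Polynomial → Polynomial → Polynomial
  []      +ᵖ q       = q
  (a ∷ p) +ᵖ []      = a ∷ p
  (a ∷ p) +ᵖ (b ∷ q) = (a + b) ∷ (p +ᵖ q)

  eval-+ᵖ : ∀ p q n → eval (p +ᵖ q) n ≡ eval p n + eval q n
  eval-+ᵖ []      q       n = refl
  eval-+ᵖ (a ∷ p) []      n = sym (+-identityʳ _)
  eval-+ᵖ (a ∷ p) (b ∷ q) n rewrite eval-+ᵖ p q n = lemma a b n (eval p n) (eval q n)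
    where
    lemma : ∀ a b n x y → a + b + n * (x + y) ≡ a + n * x + (b + n * y)
    lemma = solve-∀

  _·ᵖ_ : ℕ → Polynomial → Polynomial
  a ·ᵖ []      = []
  a ·ᵖ (b ∷ q) = (a * b) ∷ (a ·ᵖ q)

  eval-·ᵖ : ∀ a q n → eval (a ·ᵖ q) n ≡ a * eval q n
  eval-·ᵖ a []      n = sym (*-zeroʳ a)
  eval-·ᵖ a (b ∷ q) n rewrite eval-·ᵖ a q n = lemma a b n (eval q n)
    where
    lemma : ∀ a b n x → a * b + n * (a * x) ≡ a * (b + n * x)
    lemma = solve-∀

  _*ᵖ_ : Polynomial → Polynomial → Polynomial
  []      *ᵖ q = []
  (a ∷ p) *ᵖ q = (a ·ᵖ q) +ᵖ (0 ∷ (p *ᵖ q))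

  eval-*ᵖ : ∀ p q n → eval (p *ᵖ q) n ≡ eval p n * eval q n
  eval-*ᵖ []      q n = refl
  eval-*ᵖ (a ∷ p) q n
    rewrite eval-+ᵖ (a ·ᵖ q) (0 ∷ (p *ᵖ q)) n | eval-·ᵖ a q n | eval-*ᵖ p q n
    = lemma a n (eval p n) (eval q n)
    where
    lemma : ∀ a n x y → a * y + (0 + n * (x * y)) ≡ (a + n * x) * y
    lemma = solve-∀

  _∘ᵖ_ : Polynomial → Polynomial → Polynomial
  []      ∘ᵖ q = []
  (a ∷ p) ∘ᵖ q = (a ∷ []) +ᵖ (q *ᵖ (p ∘ᵖ q))

  eval-∘ᵖ : ∀ p q n → eval (p ∘ᵖ q) n ≡ eval p (eval q n)
  eval-∘ᵖ []      q n = refl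
  eval-∘ᵖ (a ∷ p) q n
    rewrite eval-+ᵖ (a ∷ []) (q *ᵖ (p ∘ᵖ q)) n | eval-*ᵖ q (p ∘ᵖ q) n | eval-∘ᵖ p q n | *-zeroʳ n | +-identityʳ a
    = refl

  pb-≤ : ∀ {f g} → (∀ n → f n ≤ g n) → PolyBounded g → PolyBounded f
  pb-≤ f≤g (p , g≤p) = p , λ n → ≤-trans (f≤g n) (g≤p n)

  pb-const : ∀ c → PolyBounded (λ _ → c)
  pb-const c = (c ∷ []) , λ n → m≤m+n c _

  pb-id : PolyBounded (λ n → n)
  pb-id = (0 ∷ 1 ∷ []) , λ n → ≤-reflexive (lemma n)
    where
    lemma : ∀ n → n ≡ n * (1 + n * 0)
    lemma = solve-∀

  pb-+ : ∀ {f g} → PolyBounded f → PolyBounded g → PolyBounded (λ n → f n + g n)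
  pb-+ (p , f≤p) (q , g≤q) = p +ᵖ q , λ n → ≤-trans (+-mono-≤ (f≤p n) (g≤q n)) (≤-reflexive (sym (eval-+ᵖ p q n)))

  pb-* : ∀ {f g} → PolyBounded f → PolyBounded g → PolyBounded (λ n → f n * g n)
  pb-* (p , f≤p) (q , g≤q) = p *ᵖ q , λ n → ≤-trans (*-mono-≤ (f≤p n) (g≤q n)) (≤-reflexive (sym (eval-*ᵖ p q n)))

  pb-suc : ∀ {f} → PolyBounded f → PolyBounded (λ n → suc (f n))
  pb-suc = pb-+ (pb-const 1)

  pb-eval : ∀ p {g} → PolyBounded g → PolyBounded (λ n → eval p (g n))
  pb-eval p (q , g≤q) = p ∘ᵖ q , λ n → ≤-trans (evalMono p (g≤q n)) (≤-reflexive (sym (eval-∘ᵖ p q n)))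

  pb-^ : ∀ {f} → PolyBounded f → ∀ d → PolyBounded (λ n → f n ^ d)
  pb-^ pf zero    = pb-const 1
  pb-^ pf (suc d) = pb-* pf (pb-^ pf d)

  coefficientSum : Polynomial → ℕ
  coefficientSum []      = 0
  coefficientSum (a ∷ p) = a + coefficientSum p

  1≤^ : ∀ {z} e → 1 ≤ z → 1 ≤ z ^ e
  1≤^ zero    1≤z = ≤-refl
  1≤^ (suc e) 1≤z = *-mono-≤ 1≤z (1≤^ e 1≤z)

  -- For `z ≥ 1` every power is at most the highest. The exponent `length p` lies above the degree,
  -- which avoids a subtraction; the number of digits in `Size` comes from it.
  eval≤monomial : ∀ p {z} → 1 ≤ z → eval p z ≤ coefficientSum p * z ^ length p
  eval≤monomial []      1≤z = z≤n
  eval≤monomial (a ∷ p) {z} 1≤z = begin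
    a + z * eval p z                                     ≤⟨ +-mono-≤ (m≤m*n a (z ^ suc (length p)) {{>-nonZero (1≤^ (suc (length p)) 1≤z)}}) (*-monoʳ-≤ z (eval≤monomial p 1≤z)) ⟩
    a * z ^ suc (length p) + z * (coefficientSum p * z ^ length p) ≡⟨ lemma a z (coefficientSum p) (z ^ length p) ⟩
    (a + coefficientSum p) * (z * z ^ length p)          ∎
    where
    open ≤-Reasoning
    lemma : ∀ a z c y → a * (z * y) + z * (c * y) ≡ (a + c) * (z * y)
    lemma = solve-∀

-- Finite sums over lists and double counting

module Sums where
  open import Data.List.Base using (List; []; _∷_; [_]; _++_; length; map; concatMap; replicate)
  open import Data.List.Properties using (length-++)
  open import Data.List.Membership.Propositional using (_∈_)
  open import Data.List.Relation.Unary.Any using (here; there)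
  open import Data.Nat.Base
  open import Data.Nat.Properties

  private variable
    A B : Set

  ∑ : List A → (A → ℕ) → ℕ
  ∑ []       f = 0
  ∑ (x ∷ xs) f = f x + ∑ xs f

  ind : Bool → ℕ
  ind true  = 1
  ind false = 0

  ind≤1 : ∀ b → ind b ≤ 1
  ind≤1 true  = ≤-refl
  ind≤1 false = z≤n

  ind-mono : ∀ {a b} → (T a → T b) → ind a ≤ ind b
  ind-mono {false}         f = z≤n
  ind-mono {true}  {true}  f = ≤-refl
  ind-mono {true}  {false} f = ⊥-elim (f _)

  T⇒1≤ind : ∀ {b} → T b → 1 ≤ ind b
  T⇒1≤ind {true} _ = ≤-refl

  ¬T⇒ind≡0 : ∀ {b} → ¬ T b → ind b ≡ 0
  ¬T⇒ind≡0 {true}  ¬t = ⊥-elim (¬t _)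
  ¬T⇒ind≡0 {false} ¬t = refl

  ∑-++ : ∀ (xs ys : List A) f → ∑ (xs ++ ys) f ≡ ∑ xs f + ∑ ys f
  ∑-++ []       ys f = refl
  ∑-++ (x ∷ xs) ys f = trans (cong (f x +_) (∑-++ xs ys f)) (sym (+-assoc (f x) _ _))

  ∑-concatMap : ∀ (g : A → List B) xs f → ∑ (concatMap g xs) f ≡ ∑ xs (λ x → ∑ (g x) f)
  ∑-concatMap g []       f = refl
  ∑-concatMap g (x ∷ xs) f = trans (∑-++ (g x) _ f) (cong (∑ (g x) f +_) (∑-concatMap g xs f))

  ∑-map : ∀ (g : A → B) xs f → ∑ (map g xs) f ≡ ∑ xs (f ∘ g)
  ∑-map g []       f = refl
  ∑-map g (x ∷ xs) f = cong (f (g x) +_) (∑-map g xs f)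

  ∑-replicate : ∀ r (x : A) f → ∑ (replicate r x) f ≡ r * f x
  ∑-replicate zero    x f = refl
  ∑-replicate (suc r) x f = cong (f x +_) (∑-replicate r x f)

  ∑-mono : ∀ (xs : List A) {f g} → (∀ x → f x ≤ g x) → ∑ xs f ≤ ∑ xs g
  ∑-mono []       h = z≤n
  ∑-mono (x ∷ xs) h = +-mono-≤ (h x) (∑-mono xs h)

  ∑-cong : ∀ (xs : List A) {f g} → (∀ x → f x ≡ g x) → ∑ xs f ≡ ∑ xs g
  ∑-cong []       h = refl
  ∑-cong (x ∷ xs) h = cong₂ _+_ (h x) (∑-cong xs h)

  -- Used in contraposition: a sum that attains the sum of upper bounds for its terms attains each
  -- single bound.
  ∑-mono< : ∀ (xs : List A) {f g} → (∀ x → f x ≤ g x) → ∀ {x} → x ∈ xs → f x < g x → ∑ xs f < ∑ xs g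
  ∑-mono< (x ∷ xs) h (here refl) lt = +-mono-<-≤ lt (∑-mono xs h)
  ∑-mono< (x ∷ xs) h (there i)   lt = +-mono-≤-< (h x) (∑-mono< xs h i lt)

  ∑-const : ∀ (xs : List A) c → ∑ xs (λ _ → c) ≡ length xs * c
  ∑-const []       c = refl
  ∑-const (x ∷ xs) c = cong (c +_) (∑-const xs c)

  ∑-+ : ∀ (xs : List A) f g → ∑ xs (λ x → f x + g x) ≡ ∑ xs f + ∑ xs g
  ∑-+ []       f g = refl
  ∑-+ (x ∷ xs) f g rewrite ∑-+ xs f g = lemma (f x) (g x) (∑ xs f) (∑ xs g)
    where
    lemma : ∀ a b c d → a + b + (c + d) ≡ a + c + (b + d)
    lemma = solve-∀

  ∑-* : ∀ (xs : List A) c f → ∑ xs (λ x → c * f x) ≡ c * ∑ xs f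
  ∑-* []       c f = sym (*-zeroʳ c)
  ∑-* (x ∷ xs) c f = trans (cong (c * f x +_) (∑-* xs c f)) (sym (*-distribˡ-+ c (f x) _))

  ∑-swap : ∀ (xs : List A) (ys : List B) (f : A → B → ℕ) → ∑ xs (λ x → ∑ ys (f x)) ≡ ∑ ys (λ y → ∑ xs (λ x → f x y))
  ∑-swap []       ys f = sym (trans (∑-const ys 0) (*-zeroʳ (length ys)))
  ∑-swap (x ∷ xs) ys f = trans (cong (∑ ys (f x) +_) (∑-swap xs ys f)) (sym (∑-+ ys (f x) _))

  ∑-∈ : ∀ {xs : List A} {x} f → x ∈ xs → f x ≤ ∑ xs f
  ∑-∈ {xs = x ∷ xs} f (here refl) = m≤m+n (f x) _
  ∑-∈ {xs = y ∷ xs} f (there i)   = ≤-trans (∑-∈ f i) (m≤n+m _ (f y))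

  ∑-witness : ∀ (xs : List A) (b : A → Bool) → 1 ≤ ∑ xs (ind ∘ b) → Σ[ x ∈ A ] (x ∈ xs × T (b x))
  ∑-witness (x ∷ xs) b h with b x in eq
  ... | true  = x , here refl , subst T (sym eq) _
  ... | false with ∑-witness xs b h
  ...   | y , i , t = y , there i , t

  length≡∑ : ∀ (xs : List A) → length xs ≡ ∑ xs (λ _ → 1)
  length≡∑ []       = refl
  length≡∑ (x ∷ xs) = cong suc (length≡∑ xs)

  length-concatMap : ∀ (g : A → List B) xs → length (concatMap g xs) ≡ ∑ xs (length ∘ g)
  length-concatMap g []       = refl
  length-concatMap g (x ∷ xs) = trans (length-++ (g x)) (cong (length (g x) +_) (length-concatMap g xs))

  length-concatMap-≤ : ∀ (g : A → List B) xs {c} → (∀ x → length (g x) ≤ c) → length (concatMap g xs) ≤ length xs * c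
  length-concatMap-≤ g xs {c} h = begin
    length (concatMap g xs) ≡⟨ length-concatMap g xs ⟩
    ∑ xs (length ∘ g)       ≤⟨ ∑-mono xs h ⟩
    ∑ xs (λ _ → c)          ≡⟨ ∑-const xs c ⟩
    length xs * c           ∎
    where open ≤-Reasoning

-- The layered graph and the hyperedges that the firefighter keeps

module FirefighterReduction where
  open Sums
  open import Data.Bool.Properties as Bool using (T?; T-∨; ∨-comm)
  open import Data.Fin.Base using (Fin; zero; suc; toℕ; fromℕ<; _↑ˡ_; _↑ʳ_; splitAt; combine; remQuot)
  open import Data.Fin.Properties using (all?; any?; splitAt-↑ˡ; splitAt-↑ʳ; splitAt⁻¹-↑ˡ; splitAt⁻¹-↑ʳ; remQuot-combine; combine-remQuot; toℕ<n; toℕ-fromℕ<; fromℕ<-toℕ; ↑ʳ-injective; suc-injective)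
  open import Data.Fin.Subset as Subset using (Subset; _∈_; _∉_; _⊆_; ∣_∣; ⁅_⁆; _∪_; ∁; _-_; _⊂_)
  open import Data.Fin.Subset.Properties using (_∈?_; ⊆-antisym; p⊂q⇒∣p∣<∣q∣; p⊆q⇒∣p∣≤∣q∣; ∣p∣≤n; ∣⊥∣≡0; ∣⊤∣≡n; ∣⁅x⁆∣≡1; x∈p∪q⁺; x∈⁅x⁆; x∈⁅y⁆⇒x≡y; p⊆p∪q; q⊆p∪q; x∈∁p⇒x∉p; x∉p⇒x∈∁p; x∈p∧x≢y⇒x∈p-y; x∈p⇒∣p-x∣<∣p∣; ∉⊥; ∈⊤)
  open import Data.List.Base using (List; []; _∷_; length; lookup)
  open import Data.Nat.Base hiding (_⊔_; ∣_-_∣)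
  open import Data.Nat.Properties hiding (suc-injective)
  open import Data.Sum.Base as Sum using (_⊎_; inj₁; inj₂; [_,_]′)
  import Data.Vec.Base as Vec
  open import Data.Vec.Base using (Vec; []; _∷_)
  import Data.Vec.Properties as Vec
  open import Relation.Binary.Construct.Closure.ReflexiveTransitive as Star using (ε; _◅_; _◅◅_)

  ∈⇒T : ∀ {n} {p : Subset n} {i} → i ∈ p → T (Vec.lookup p i)
  ∈⇒T i∈p = subst T (sym (Vec.[]=⇒lookup i∈p)) _

  T⇒∈ : ∀ {n} {p : Subset n} {i} → T (Vec.lookup p i) → i ∈ p
  T⇒∈ {p = p} {i} t with Vec.lookup p i in eq
  ... | true = Vec.lookup⇒[]= i p eq

  ∈-tabulate⁺ : ∀ {n} {f : Fin n → Bool} {i} → T (f i) → i ∈ Vec.tabulate f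
  ∈-tabulate⁺ {f = f} {i} t = T⇒∈ (subst T (sym (Vec.lookup∘tabulate f i)) t)

  ∈-tabulate⁻ : ∀ {n} {f : Fin n → Bool} {i} → i ∈ Vec.tabulate f → T (f i)
  ∈-tabulate⁻ {f = f} {i} i∈ = subst T (Vec.lookup∘tabulate f i) (∈⇒T i∈)

  card-∷ : ∀ {n} b (p : Subset n) → ∣ b ∷ p ∣ ≡ ind b + ∣ p ∣
  card-∷ true  p = refl
  card-∷ false p = refl

  card-++ : ∀ {m n} (p : Subset m) (q : Subset n) → ∣ p Vec.++ q ∣ ≡ ∣ p ∣ + ∣ q ∣
  card-++ []          q = refl
  card-++ (true  ∷ p) q = cong suc (card-++ p q)
  card-++ (false ∷ p) q = card-++ p q

  card-∪-≤ : ∀ {n} (p q : Subset n) → ∣ p ∪ q ∣ ≤ ∣ p ∣ + ∣ q ∣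
  card-∪-≤ []          []          = z≤n
  card-∪-≤ (true  ∷ p) (true  ∷ q) = s≤s (≤-trans (card-∪-≤ p q) (+-monoʳ-≤ ∣ p ∣ (n≤1+n ∣ q ∣)))
  card-∪-≤ (true  ∷ p) (false ∷ q) = s≤s (card-∪-≤ p q)
  card-∪-≤ (false ∷ p) (true  ∷ q) = ≤-trans (s≤s (card-∪-≤ p q)) (≤-reflexive (sym (+-suc ∣ p ∣ ∣ q ∣)))
  card-∪-≤ (false ∷ p) (false ∷ q) = card-∪-≤ p q

  card-lookup : ∀ {A : Set} (xs : List A) (f : A → Bool) → ∣ Vec.tabulate (λ i → f (lookup xs i)) ∣ ≡ ∑ xs (ind ∘ f)
  card-lookup []       f = refl
  card-lookup (x ∷ xs) f = trans (card-∷ (f x) (Vec.tabulate (λ i → f (lookup xs i)))) (cong (ind (f x) +_) (card-lookup xs f))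

  -- Induction on the domain: when `g zero` lies in `p` it is removed from `p`, and by injectivity
  -- the other preimages stay inside the smaller set.
  card-∘ : ∀ {m n} (p : Subset n) (g : Fin m → Fin n) → (∀ {i j} → g i ≡ g j → i ≡ j) →
           ∣ Vec.tabulate (Vec.lookup p ∘ g) ∣ ≤ ∣ p ∣
  card-∘ {zero}  p g inj = z≤n
  card-∘ {suc m} {n} p g inj with Vec.lookup p (g zero) in eq
  ... | false = card-∘ p (g ∘ suc) (suc-injective ∘ inj)
  ... | true  = begin-strict
    ∣ Vec.tabulate (Vec.lookup p ∘ g ∘ suc) ∣           ≤⟨ p⊆q⇒∣p∣≤∣q∣ (λ {i} i∈ → ∈-tabulate⁺ (∈⇒T (x∈p∧x≢y⇒x∈p-y {p = p} (T⇒∈ (∈-tabulate⁻ {f = Vec.lookup p ∘ g ∘ suc} i∈)) (λ eq → case inj {suc i} {zero} eq of λ ())))) ⟩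
    ∣ Vec.tabulate (Vec.lookup (p - g zero) ∘ g ∘ suc) ∣ ≤⟨ card-∘ (p - g zero) (g ∘ suc) (suc-injective ∘ inj) ⟩
    ∣ p - g zero ∣                                      <⟨ x∈p⇒∣p-x∣<∣p∣ (Vec.lookup⇒[]= (g zero) p eq) ⟩
    ∣ p ∣                                               ∎
    where open ≤-Reasoning

  card-injection : ∀ {m n} (p : Subset n) (g : Fin m → Fin n) → (∀ {i j} → g i ≡ g j → i ≡ j) →
                   (∀ i → g i ∈ p) → m ≤ ∣ p ∣
  card-injection {m} p g inj g∈p = begin
    m                                   ≡⟨ sym (∣⊤∣≡n m) ⟩
    ∣ Subset.⊤ {m} ∣                    ≤⟨ p⊆q⇒∣p∣≤∣q∣ {p = Subset.⊤ {m}} {q = Vec.tabulate (Vec.lookup p ∘ g)} (λ {i} _ → ∈-tabulate⁺ (∈⇒T (g∈p i))) ⟩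
    ∣ Vec.tabulate (Vec.lookup p ∘ g) ∣ ≤⟨ card-∘ p g inj ⟩
    ∣ p ∣                               ∎
    where open ≤-Reasoning

  ⊆∧≢⇒⊂ : ∀ {n} {p q : Subset n} → p ⊆ q → q ≢ p → p ⊂ q
  ⊆∧≢⇒⊂ {p = p} {q} p⊆q q≢p with any? (λ x → (x ∈? q) ×-dec ¬? (x ∈? p))
  ... | yes (x , x∈q , x∉p) = p⊆q , x , x∈q , x∉p
  ... | no ¬x = contradiction (⊆-antisym (λ {x} x∈q → case x ∈? p of λ { (yes x∈p) → x∈p ; (no x∉p) → contradiction (x , x∈q , x∉p) ¬x }) p⊆q) q≢p

  module Spread {n : ℕ} (G : Graph n) where
    open Firefighting G public
    open Graph G

    Spreads : Subset n → Subset n → Fin n → Set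
    Spreads D B v = v ∈ B ⊎ (v ∉ D × ∃[ u ] u ∈ B × Adj u v)

    -- Repeats the decision term of `spread` literally, so that membership in `spread D B` unfolds
    -- to it by computation.
    spreads? : ∀ D B v → Dec (Spreads D B v)
    spreads? D B v = (v ∈? B) ⊎-dec (¬? (v ∈? D) ×-dec any? λ u → (u ∈? B) ×-dec T? (adjacent u v))

    spread⁺ : ∀ D B {v} → Spreads D B v → v ∈ spread D B
    spread⁺ D B {v} p = ∈-tabulate⁺ (T-does (spreads? D B v))
      where
      T-does : ∀ (d : Dec (Spreads D B v)) → T (does d)
      T-does (yes _) = _
      T-does (no ¬p) = ¬p p

    spread⁺ˡ : ∀ D B {v} → v ∈ B → v ∈ spread D B
    spread⁺ˡ D B v∈B = spread⁺ D B (inj₁ v∈B)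

    spread⁺ʳ : ∀ D B {v u} → v ∉ D → u ∈ B → Adj u v → v ∈ spread D B
    spread⁺ʳ D B v∉D u∈B uv = spread⁺ D B (inj₂ (v∉D , _ , u∈B , uv))

    spread⁻ : ∀ D B {v} → v ∈ spread D B → Spreads D B v
    spread⁻ D B {v} v∈ = does-T (spreads? D B v) (∈-tabulate⁻ v∈)
      where
      does-T : ∀ (d : Dec (Spreads D B v)) → T (does d) → Spreads D B v
      does-T (yes p) _ = p

  -- A bit that is symbolic in the input words `y`. Evaluating all sources with `bitOf` gives the
  -- graph for one tuple of inputs; compiling them gives the program that writes down its encoding.
  data Source : Set where
    const   : Bool → Source
    literal : ℕ → Bool → Source

  bitOf : (ℕ → Bool) → Source → Bool
  bitOf y (const b)         = b
  bitOf y (literal a true)  = y a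
  bitOf y (literal a false) = not (y a)

  satisfied : ∀ {u} → (ℕ → Bool) → (Fin u → Bool) → (Fin u → Source) → Bool
  satisfied y S e = isYes (all? λ a → T? (bitOf y (e a)) →-dec T? (S a))

  satisfied⁺ : ∀ {u} y (S : Fin u → Bool) e → (∀ a → T (bitOf y (e a)) → T (S a)) → T (satisfied y S e)
  satisfied⁺ y S e h = fromWitness {a? = all? λ a → T? (bitOf y (e a)) →-dec T? (S a)} h

  satisfied⁻ : ∀ {u} y (S : Fin u → Bool) e → T (satisfied y S e) → ∀ a → T (bitOf y (e a)) → T (S a)
  satisfied⁻ y S e t = toWitness {a? = all? λ a → T? (bitOf y (e a)) →-dec T? (S a)} t

  -- The objective of a densest subhypergraph problem: the number of hyperedges that lie inside `S`.
  score : ∀ {u} → (ℕ → Bool) → (Fin u → Bool) → List (Fin u → Source) → ℕ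
  score y S es = ∑ es (ind ∘ satisfied y S)

  consecutive : ℕ → ℕ → Bool
  consecutive i j = (suc i ≡ᵇ j) ∨ (suc j ≡ᵇ i)

  consecutive-suc : ∀ i → T (consecutive i (suc i))
  consecutive-suc i = Equivalence.from T-∨ (inj₁ (≡⇒≡ᵇ (suc i) (suc i) refl))

  consecutive-pred : ∀ i → T (consecutive (suc i) i)
  consecutive-pred i = subst T (∨-comm (suc i ≡ᵇ suc i) (suc (suc i) ≡ᵇ i)) (consecutive-suc i)

  consecutive-irrefl : ∀ i → consecutive i i ≡ false
  consecutive-irrefl zero    = refl
  consecutive-irrefl (suc i) = consecutive-irrefl i

  consecutive-≤ : ∀ i j → T (consecutive i j) → j ≤ suc i
  consecutive-≤ i j t with Equivalence.to (T-∨ {suc i ≡ᵇ j}) t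
  ... | inj₁ h = ≤-reflexive (sym (≡ᵇ⇒≡ (suc i) j h))
  ... | inj₂ h = ≤-trans (n≤1+n j) (≤-trans (≤-reflexive (≡ᵇ⇒≡ (suc j) i h)) (n≤1+n i))

  -- The source is at level 0, levels 1 … N′ are too wide to be blocked in N = 1 + N′ rounds, and the
  -- candidates form level N. So the firefighter has N rounds to choose the candidates he keeps, and a vertex
  -- representing a set of candidates is saved exactly when all of them are kept (up to one further vertex,
  -- defended when the fire reaches the candidates).
  module Reduction (N′ u : ℕ) (es : List (Fin u → Source)) where

    N width core m V : ℕ
    N     = suc N′
    width = suc N
    core  = suc (N′ * width + u)
    m     = length es
    V     = core + m

    data Vertex : Set where
      source : Vertex
      layer  : Fin N′ → Fin width → Vertex
      cand   : Fin u → Vertex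
      edge   : Fin m → Vertex

    decodeCore : Fin core → Vertex
    decodeCore zero    = source
    decodeCore (suc r) = [ (λ p → uncurry layer (remQuot width p)) , cand ]′ (splitAt (N′ * width) r)

    decode : Fin V → Vertex
    decode v = [ decodeCore , edge ]′ (splitAt core v)

    layerC : Fin N′ → Fin width → Fin core
    layerC i j = suc (combine i j ↑ˡ u)

    candC : Fin u → Fin core
    candC a = suc ((N′ * width) ↑ʳ a)

    encode : Vertex → Fin V
    encode source      = zero
    encode (layer i j) = layerC i j ↑ˡ m
    encode (cand a)    = candC a ↑ˡ m
    encode (edge e)    = core ↑ʳ e

    decode-core : ∀ i → decode (i ↑ˡ m) ≡ decodeCore i
    decode-core i rewrite splitAt-↑ˡ core i m = refl

    decode-encode : ∀ v → decode (encode v) ≡ v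
    decode-encode source      = refl
    decode-encode (layer i j) rewrite decode-core (layerC i j) | splitAt-↑ˡ (N′ * width) (combine i j) u = cong (uncurry layer) (remQuot-combine {k = width} i j)
    decode-encode (cand a)    rewrite decode-core (candC a) | splitAt-↑ʳ (N′ * width) u a = refl
    decode-encode (edge e)    rewrite splitAt-↑ʳ core m e = refl

    encode-decode : ∀ v → encode (decode v) ≡ v
    encode-decode v with splitAt core v in eq
    ... | inj₂ e       = splitAt⁻¹-↑ʳ eq
    ... | inj₁ zero    = splitAt⁻¹-↑ˡ {i = v} eq
    ... | inj₁ (suc r) with splitAt (N′ * width) r in eq′
    ...   | inj₁ p = trans (cong (_↑ˡ m) (cong suc (trans (cong (_↑ˡ u) (combine-remQuot {N′} width p)) (splitAt⁻¹-↑ˡ eq′)))) (splitAt⁻¹-↑ˡ {i = v} eq)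
    ...   | inj₂ a = trans (cong (_↑ˡ m) (cong suc (splitAt⁻¹-↑ʳ eq′))) (splitAt⁻¹-↑ˡ {i = v} eq)

    encode-injective : ∀ {v w} → encode v ≡ encode w → v ≡ w
    encode-injective {v} {w} eq = trans (sym (decode-encode v)) (trans (cong decode eq) (decode-encode w))

    level : Vertex → ℕ
    level source      = 0
    level (layer i j) = suc (toℕ i)
    level (cand a)    = N
    level (edge e)    = suc N

    adjacency : Vertex → Vertex → Source
    adjacency (edge e) (cand a) = lookup es e a
    adjacency (cand a) (edge e) = lookup es e a
    adjacency (edge e) _        = const false
    adjacency _        (edge e) = const false
    adjacency v        w        = const (consecutive (level v) (level w))

    -- An eliminator: a property of all adjacency bits has to be checked only for constants and for
    -- hyperedge membership. It later bounds the addresses of literals.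
    adjacency-All : ∀ {Q : Source → Set} → (∀ b → Q (const b)) → (∀ e a → Q (lookup es e a)) → ∀ v w → Q (adjacency v w)
    adjacency-All c l (edge e)    (cand a)    = l e a
    adjacency-All c l (cand a)    (edge e)    = l e a
    adjacency-All c l (edge e)    source      = c _
    adjacency-All c l (edge e)    (layer _ _) = c _
    adjacency-All c l (edge e)    (edge _)    = c _
    adjacency-All c l source      (edge _)    = c _
    adjacency-All c l (layer _ _) (edge _)    = c _
    adjacency-All c l source      source      = c _
    adjacency-All c l source      (layer _ _) = c _
    adjacency-All c l source      (cand _)    = c _
    adjacency-All c l (layer _ _) source      = c _
    adjacency-All c l (layer _ _) (layer _ _) = c _
    adjacency-All c l (layer _ _) (cand _)    = c _
    adjacency-All c l (cand _)    source      = c _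
    adjacency-All c l (cand _)    (layer _ _) = c _
    adjacency-All c l (cand _)    (cand _)    = c _

    adjacencySource : Fin V → Fin V → Source
    adjacencySource v w = adjacency (decode v) (decode w)

    X : Subset V
    X = Subset.⊤ {core} Vec.++ Subset.⊥ {m}

    ∣X∣ : ∣ X ∣ ≡ core
    ∣X∣ = trans (card-++ (Subset.⊤ {core}) (Subset.⊥ {m})) (trans (cong₂ _+_ (∣⊤∣≡n core) (∣⊥∣≡0 m)) (+-identityʳ core))

    core∈ : ∀ {p : Subset core} {q : Subset m} {i} → i ∈ p → i ↑ˡ m ∈ p Vec.++ q
    core∈ {p} {q} {i} i∈p = T⇒∈ (subst T (sym (Vec.lookup-++ˡ p q i)) (∈⇒T i∈p))

    edge∈ : ∀ {p : Subset core} {q : Subset m} {i} → i ∈ q → core ↑ʳ i ∈ p Vec.++ q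
    edge∈ {p} {q} {i} i∈q = T⇒∈ (subst T (sym (Vec.lookup-++ʳ p q i)) (∈⇒T i∈q))

    outside : ∀ v → v ∉ X → ∃[ e ] decode v ≡ edge e
    outside v v∉X with splitAt core v in eq
    ... | inj₂ e = e , refl
    ... | inj₁ i = contradiction (subst (_∈ X) (splitAt⁻¹-↑ˡ {i = v} eq) (core∈ {q = Subset.⊥} {i = i} ∈⊤)) v∉X

    -- Both extra parameters serve connectedness: `c₀` is the hub to which every vertex gets a path,
    -- and `nonempty` attaches every edge vertex to some candidate.
    module On (y : ℕ → Bool)
              (c₀ : Fin u)
              (nonempty : ∀ e → ∃[ a ] T (bitOf y (lookup es e a))) where

      Adjᵛ : Vertex → Vertex → Set
      Adjᵛ v w = T (bitOf y (adjacency v w))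

      adjacency-sym : ∀ v w → bitOf y (adjacency v w) ≡ bitOf y (adjacency w v)
      adjacency-sym source      source      = refl
      adjacency-sym source      (layer i j) = ∨-comm (1 ≡ᵇ suc (toℕ i)) false
      adjacency-sym source      (cand a)    = ∨-comm (1 ≡ᵇ N) false
      adjacency-sym source      (edge e)    = refl
      adjacency-sym (layer i j) source      = ∨-comm false (1 ≡ᵇ suc (toℕ i))
      adjacency-sym (layer i j) (layer k l) = ∨-comm (suc (suc (toℕ i)) ≡ᵇ suc (toℕ k)) _
      adjacency-sym (layer i j) (cand a)    = ∨-comm (suc (suc (toℕ i)) ≡ᵇ N) _
      adjacency-sym (layer i j) (edge e)    = refl
      adjacency-sym (cand a)    source      = ∨-comm false (1 ≡ᵇ N)
      adjacency-sym (cand a)    (layer k l) = ∨-comm (suc N ≡ᵇ suc (toℕ k)) _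
      adjacency-sym (cand a)    (cand b)    = refl
      adjacency-sym (cand a)    (edge e)    = refl
      adjacency-sym (edge e)    source      = refl
      adjacency-sym (edge e)    (layer k l) = refl
      adjacency-sym (edge e)    (cand b)    = refl
      adjacency-sym (edge e)    (edge f)    = refl

      adjacency-irrefl : ∀ v → bitOf y (adjacency v v) ≡ false
      adjacency-irrefl source      = refl
      adjacency-irrefl (layer i j) = consecutive-irrefl (suc (toℕ i))
      adjacency-irrefl (cand a)    = consecutive-irrefl N
      adjacency-irrefl (edge e)    = refl

      adjacent-level : ∀ v w → Adjᵛ v w → level w ≤ suc (level v)
      adjacent-level (edge e)    source      ()
      adjacent-level (edge e)    (layer _ _) ()
      adjacent-level (edge e)    (edge _)    ()
      adjacent-level source      (edge e)    ()
      adjacent-level (layer _ _) (edge e)    ()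
      adjacent-level (edge e)    (cand a)    _ = ≤-trans (n≤1+n N) (n≤1+n (suc N))
      adjacent-level (cand a)    (edge e)    _ = ≤-refl
      adjacent-level source      source      t = consecutive-≤ 0 0 t
      adjacent-level source      (layer k l) t = consecutive-≤ 0 (suc (toℕ k)) t
      adjacent-level source      (cand b)    t = consecutive-≤ 0 N t
      adjacent-level (layer i j) source      t = consecutive-≤ (suc (toℕ i)) 0 t
      adjacent-level (layer i j) (layer k l) t = consecutive-≤ (suc (toℕ i)) (suc (toℕ k)) t
      adjacent-level (layer i j) (cand b)    t = consecutive-≤ (suc (toℕ i)) N t
      adjacent-level (cand a)    source      t = consecutive-≤ N 0 t
      adjacent-level (cand a)    (layer k l) t = consecutive-≤ N (suc (toℕ k)) t
      adjacent-level (cand a)    (cand b)    t = consecutive-≤ N N t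

      G : Graph V
      G = record
        { adjacent    = λ v w → bitOf y (adjacencySource v w)
        ; symmetric   = λ v w → adjacency-sym (decode v) (decode w)
        ; irreflexive = λ v → adjacency-irrefl (decode v)
        }

      open Spread G
      open Graph G using (Adj)

      adj : ∀ v w → Adjᵛ v w → Adj (encode v) (encode w)
      adj v w = subst T (cong₂ (λ v w → bitOf y (adjacency v w)) (sym (decode-encode v)) (sym (decode-encode w)))

      Reaches : Vertex → Set
      Reaches v = Star.Star (Graph.Adj G) (encode v) (encode (cand c₀))

      via : ∀ v w → Adjᵛ v w → Reaches w → Reaches v
      via v w vw p = adj v w vw ◅ p

      layer-path : ∀ r i j → toℕ i + suc r ≡ N′ → Reaches (layer i j)
      layer-path zero    i j eq = via (layer i j) (cand c₀) (subst (λ k → T (consecutive (suc (toℕ i)) (suc k))) (trans (+-comm 1 (toℕ i)) eq) (consecutive-suc (suc (toℕ i)))) ε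
      layer-path (suc r) i j eq = via (layer i j) (layer i′ zero) step (layer-path r i′ zero (trans (cong (_+ suc r) i′≡) (trans (sym (+-suc (toℕ i) (suc r))) eq)))
        where
        i′<N′ : suc (toℕ i) < N′
        i′<N′ = ≤-trans (≤-reflexive (+-comm 2 (toℕ i))) (≤-trans (+-monoʳ-≤ (toℕ i) (s≤s (s≤s z≤n))) (≤-reflexive eq))
        i′ : Fin N′
        i′ = fromℕ< i′<N′
        i′≡ : toℕ i′ ≡ suc (toℕ i)
        i′≡ = toℕ-fromℕ< i′<N′
        step : T (consecutive (suc (toℕ i)) (suc (toℕ i′)))
        step rewrite i′≡ = consecutive-suc (suc (toℕ i))

      layer-reaches : ∀ i j → Reaches (layer i j)
      layer-reaches i j = layer-path (N′ ∸ suc (toℕ i)) i j (trans (+-suc (toℕ i) _) (m+[n∸m]≡n (toℕ<n i)))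

      below : ∀ a → ∃[ b ] Adjᵛ (cand a) b × Reaches b
      below a = go N′ refl
        where
        go : ∀ k → N′ ≡ k → ∃[ b ] Adjᵛ (cand a) b × Reaches b
        go zero    eq = source , subst (λ k → T (consecutive (suc k) 0)) (sym eq) _ , via source (cand c₀) (subst (λ k → T (consecutive 0 (suc k))) (sym eq) _) ε
        go (suc k) eq = layer i zero , subst (λ l → T (consecutive N (suc l))) (sym i≡) (subst (λ l → T (consecutive N l)) eq (consecutive-pred N′)) , layer-reaches i zero
          where
          k<N′ : k < N′
          k<N′ = ≤-reflexive (sym eq)
          i : Fin N′
          i = fromℕ< k<N′
          i≡ : toℕ i ≡ k
          i≡ = toℕ-fromℕ< k<N′

      cand-reaches : ∀ a → Reaches (cand a)
      cand-reaches a = let b , ab , p = below a in via (cand a) b ab p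

      source-reaches : Reaches source
      source-reaches = go N′ refl
        where
        go : ∀ k → N′ ≡ k → Reaches source
        go zero    eq = via source (cand c₀) (subst (λ k → T (consecutive 0 (suc k))) (sym eq) _) ε
        go (suc k) eq = via source (layer i zero) (subst (λ l → T (consecutive 0 (suc l))) (sym i≡) _) (layer-reaches i zero)
          where
          0<N′ : 0 < N′
          0<N′ = subst (0 <_) (sym eq) z<s
          i : Fin N′
          i = fromℕ< 0<N′
          i≡ : toℕ i ≡ 0
          i≡ = toℕ-fromℕ< 0<N′

      reaches : ∀ v → Reaches v
      reaches source      = source-reaches
      reaches (layer i j) = layer-reaches i j
      reaches (cand a)    = cand-reaches a
      reaches (edge e)    = let a , t = nonempty e in via (edge e) (cand a) t (cand-reaches a)

      reach : ∀ v → Star.Star (Graph.Adj G) v (encode (cand c₀))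
      reach v = subst (λ w → Star.Star (Graph.Adj G) w (encode (cand c₀))) (encode-decode v) (reaches (decode v))

      connected : Connected G
      connected v w = reach v ◅◅ Star.reverse (λ {i} {j} → subst T (Graph.symmetric G i j)) (reach w)

      -- There are no edges at all outside `X`, so each component is a single vertex, a star without
      -- leaves.
      stars : StarsOutside G X
      stars v v∉X = v , ε , λ a b va vb →
        mk⇔ (λ ab → ⊥-elim (¬adj a b (only va) (only vb) ab)) (λ (a≢b , _) → contradiction (trans (sym (only va)) (only vb)) a≢b)
        where
        no-edges : ∀ a b → ¬ AdjOutside G X a b
        no-edges a b (a∉X , b∉X , ab) with outside a a∉X | outside b b∉X
        ... | e , eqa | f , eqb = subst T (cong₂ (λ v w → bitOf y (adjacency v w)) eqa eqb) ab
        only : ∀ {a} → Star.Star (AdjOutside G X) v a → v ≡ a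
        only ε = refl
        only (h ◅ _) = ⊥-elim (no-edges _ _ h)
        ¬adj : ∀ a b → v ≡ a → v ≡ b → ¬ Adj a b
        ¬adj a .a refl refl ab = subst T (Graph.irreflexive G a) ab

      s : Fin V
      s = encode source

      -- The strategy defends the candidates listed by `c` one after the other. The fire needs `N`
      -- rounds to climb to level `N`, which is just enough to defend all of `S` in time.
      module Defending (c : Fin N → Fin u) (c-injective : ∀ {i j} → c i ≡ c j → i ≡ j)
                       (S : Fin u → Bool) (c∈S : ∀ i → T (S (c i))) (S⊆c : ∀ a → T (S a) → ∃[ i ] c i ≡ a) where

        safe? : Vertex → Bool
        safe? (cand a) = S a
        safe? (edge e) = satisfied y S (lookup es e)
        safe? _        = false

        Safe : Vertex → Set
        Safe v = T (safe? v)

        safe-neighbour : ∀ e w → T (satisfied y S (lookup es e)) → Adjᵛ w (edge e) → Safe w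
        safe-neighbour e (cand a)    t ae = satisfied⁻ y S (lookup es e) t a ae

        -- From time `N` on all of `S` is defended, but while the fire can still spread the rules
        -- ask for a further non-burning vertex in each round; defending the first candidate again
        -- is a legal idle move.
        target : ℕ → Fin N
        target τ with τ <? N
        ... | yes τ<N = fromℕ< τ<N
        ... | no _    = zero

        target-toℕ : ∀ i → target (toℕ i) ≡ i
        target-toℕ i with toℕ i <? N
        ... | yes i<N = fromℕ<-toℕ i i<N
        ... | no i≮N  = contradiction (toℕ<n i) i≮N

        record Invariant (τ : ℕ) (D B : Subset V) : Set where
          field
            front  : ∀ v → encode v ∈ B → level v ≤ τ
            chosen : ∀ i → toℕ i < τ → encode (cand (c i)) ∈ D
            safe   : ∀ v → encode v ∈ B → ¬ Safe v

        spread⁻ᵛ : ∀ D B v → encode v ∈ spread D B → encode v ∈ B ⊎ (encode v ∉ D × ∃[ w ] encode w ∈ B × Adjᵛ w v)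
        spread⁻ᵛ D B v v∈ with spread⁻ D B v∈
        ... | inj₁ v∈B = inj₁ v∈B
        ... | inj₂ (v∉D , w , w∈B , wv) = inj₂ (v∉D , decode w , subst (_∈ B) (sym (encode-decode w)) w∈B
                                            , subst (λ x → T (bitOf y (adjacency (decode w) x))) (decode-encode v) wv)

        invariant-step : ∀ {τ D B} → Invariant τ D B → let D′ = D ∪ ⁅ encode (cand (c (target τ))) ⁆ in Invariant (suc τ) D′ (spread D′ B)
        invariant-step {τ} {D} {B} I = record { front = front′ ; chosen = chosen′ ; safe = safe′ }
          where
          open Invariant I
          d = encode (cand (c (target τ)))
          D′ = D ∪ ⁅ d ⁆
          front′ : ∀ v → encode v ∈ spread D′ B → level v ≤ suc τ
          front′ v v∈ with spread⁻ᵛ D′ B v v∈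
          ... | inj₁ v∈B = ≤-trans (front v v∈B) (n≤1+n τ)
          ... | inj₂ (_ , w , w∈B , wv) = ≤-trans (adjacent-level w v wv) (s≤s (front w w∈B))
          chosen′ : ∀ i → toℕ i < suc τ → encode (cand (c i)) ∈ D′
          chosen′ i (s≤s i≤τ) with m≤n⇒m<n∨m≡n i≤τ
          ... | inj₁ i<τ = p⊆p∪q ⁅ d ⁆ (chosen i i<τ)
          ... | inj₂ refl = q⊆p∪q D ⁅ d ⁆ (subst (λ j → encode (cand (c i)) ∈ ⁅ encode (cand (c j)) ⁆) (sym (target-toℕ i)) (x∈⁅x⁆ (encode (cand (c i)))))
          safe′ : ∀ v → encode v ∈ spread D′ B → ¬ Safe v
          safe′ v v∈ sv with spread⁻ᵛ D′ B v v∈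
          ... | inj₁ v∈B = safe v v∈B sv
          safe′ (edge e) v∈ sv | inj₂ (_ , w , w∈B , wv) = safe w w∈B (safe-neighbour e w sv wv)
          safe′ (cand a) v∈ sv | inj₂ (a∉D′ , w , w∈B , wv) with S⊆c a sv
          ... | i , refl with toℕ i <? suc τ
          ...   | yes i<1+τ = a∉D′ (chosen′ i i<1+τ)
          -- A candidate not yet defended has an index above `τ`, so `τ + 1 < N` and the front is
          -- still below level `N`.
          ...   | no  i≮1+τ = <⇒≱ (toℕ<n i) (≤-trans (front′ (cand (c i)) v∈) (≮⇒≥ i≮1+τ))

        -- Each round that does not end the process burns a new vertex, so `fuel` only has to bound
        -- the number of unburnt vertices. If the fire could spread before the defence but not after
        -- it, one `defend` is followed by `stop`.
        play : ∀ fuel τ D B → Invariant τ D B → V ≤ fuel + ∣ B ∣ → ∃[ F ] Play D B F × (∀ v → encode v ∈ F → ¬ Safe v)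
        play fuel τ D B I V≤ with Vec.≡-dec Bool._≟_ (spread D B) B
        ... | yes stable = B , stop stable , Invariant.safe I
        ... | no unstable = continue fuel V≤ (Vec.≡-dec Bool._≟_ B′ B)
          where
          d = encode (cand (c (target τ)))
          D′ = D ∪ ⁅ d ⁆
          B′ = spread D′ B
          I′ = invariant-step I
          d∉B : d ∉ B
          d∉B d∈B = Invariant.safe I (cand (c (target τ))) d∈B (c∈S (target τ))
          continue : ∀ fuel → V ≤ fuel + ∣ B ∣ → Dec (B′ ≡ B) → ∃[ F ] Play D B F × (∀ v → encode v ∈ F → ¬ Safe v)
          continue _ _ (yes eq) = B′ , defend unstable d d∉B (stop (cong (spread D′) eq)) , Invariant.safe I′
          continue zero V≤ (no ne) = contradiction (<-≤-trans (p⊂q⇒∣p∣<∣q∣ (⊆∧≢⇒⊂ {p = B} {B′} (spread⁺ˡ D′ B) ne)) (∣p∣≤n B′)) (≤⇒≯ V≤)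
          continue (suc fuel) V≤ (no ne) =
            let F , p , f = play fuel (suc τ) D′ B′ I′ (≤-trans V≤ (≤-trans (≤-reflexive (sym (+-suc fuel ∣ B ∣))) (+-monoʳ-≤ fuel (p⊂q⇒∣p∣<∣q∣ (⊆∧≢⇒⊂ {p = B} {B′} (spread⁺ˡ D′ B) ne)))))
            in F , defend unstable d d∉B p , f

        initially : Invariant 0 Subset.⊥ ⁅ s ⁆
        initially = record
          { front  = λ v v∈ → ≤-reflexive (cong level (is-source v v∈))
          ; chosen = λ _ ()
          ; safe   = λ v v∈ sv → subst Safe (is-source v v∈) sv
          }
          where
          is-source : ∀ v → encode v ∈ ⁅ s ⁆ → v ≡ source
          is-source v v∈ = encode-injective {v} {source} (x∈⁅y⁆⇒x≡y s v∈)

        safeSet : Subset V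
        safeSet = Vec.tabulate (safe? ∘ decodeCore) Vec.++ Vec.tabulate (safe? ∘ edge)

        decodeCore-cand : ∀ a → decodeCore (candC a) ≡ cand a
        decodeCore-cand a rewrite splitAt-↑ʳ (N′ * width) u a = refl

        ∈-safeSet : ∀ {v} → v ∈ safeSet → Safe (decode v)
        ∈-safeSet {v} v∈ with ∈⇒T v∈
        ... | t rewrite Vec.lookup-splitAt core (Vec.tabulate (safe? ∘ decodeCore)) (Vec.tabulate (safe? ∘ edge)) v
          with splitAt core v
        ...   | inj₁ i = subst T (Vec.lookup∘tabulate (safe? ∘ decodeCore) i) t
        ...   | inj₂ e = subst T (Vec.lookup∘tabulate (safe? ∘ edge) e) t

        ∣safeSet∣ : N + score y S es ≤ ∣ safeSet ∣
        ∣safeSet∣ = begin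
          N + score y S es
            ≤⟨ +-mono-≤ (card-injection (Vec.tabulate (safe? ∘ decodeCore)) (candC ∘ c)
                          (λ {i} {j} eq → c-injective (↑ʳ-injective (N′ * width) (c i) (c j) (suc-injective eq)))
                          (λ i → ∈-tabulate⁺ {f = safe? ∘ decodeCore} (subst Safe (sym (decodeCore-cand (c i))) (c∈S i))))
                        (≤-reflexive (sym (card-lookup es (satisfied y S)))) ⟩
          ∣ Vec.tabulate (safe? ∘ decodeCore) ∣ + ∣ Vec.tabulate (safe? ∘ edge) ∣
            ≡⟨ sym (card-++ (Vec.tabulate (safe? ∘ decodeCore)) (Vec.tabulate (safe? ∘ edge))) ⟩
          ∣ safeSet ∣ ∎
          where open ≤-Reasoning

        can-save : ∀ κ → κ ≤ score y S es → CanSave s (N + κ)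
        can-save κ κ≤ with play V 0 Subset.⊥ ⁅ s ⁆ initially (m≤m+n V _)
        ... | F , p , unsafe = F , p , ≤-trans (≤-trans (+-monoʳ-≤ N κ≤) ∣safeSet∣)
              (p⊆q⇒∣p∣≤∣q∣ (λ {v} v∈ → x∉p⇒x∈∁p λ v∈F → unsafe (decode v) (subst (_∈ F) (sym (encode-decode v)) v∈F) (∈-safeSet v∈)))

      IsCore : Vertex → Set
      IsCore (edge _) = ⊥
      IsCore _        = ⊤

      core-adjacent : ∀ v w → IsCore v → IsCore w → T (consecutive (level v) (level w)) → Adjᵛ v w
      core-adjacent source      source      _ _ t = t
      core-adjacent source      (layer _ _) _ _ t = t
      core-adjacent source      (cand _)    _ _ t = t
      core-adjacent (layer _ _) source      _ _ t = t
      core-adjacent (layer _ _) (layer _ _) _ _ t = t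
      core-adjacent (layer _ _) (cand _)    _ _ t = t
      core-adjacent (cand _)    source      _ _ t = t
      core-adjacent (cand _)    (layer _ _) _ _ t = t
      core-adjacent (cand _)    (cand _)    _ _ t = t

      core-level : ∀ v → IsCore v → level v ≤ N
      core-level source      _ = z≤n
      core-level (layer i j) _ = s≤s (≤-trans (n≤1+n (toℕ i)) (toℕ<n i))
      core-level (cand a)    _ = ≤-refl

      level-0 : ∀ v → level v ≡ 0 → v ≡ source
      level-0 source _ = refl

      play-⊆ : ∀ {D B F} → Play D B F → B ⊆ F
      play-⊆ (stop _) v∈ = v∈
      play-⊆ {D} {B} (defend _ v _ p) v∈ = play-⊆ p (spread⁺ˡ (D ∪ ⁅ v ⁆) B v∈)

      -- A stopped play is prolonged by idle rounds, so that rounds can be counted up to any time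
      -- regardless of when the process ends.
      next-round : ∀ {D B F} → Play D B F → ∃[ D′ ] D ⊆ D′ × ∣ D′ ∣ ≤ suc ∣ D ∣ × Play D′ (spread D′ B) F
      next-round {D} {B} (stop eq) = D , id , n≤1+n ∣ D ∣ , subst (λ B′ → Play D B′ B) (sym eq) (stop eq)
      next-round {D} {B} (defend _ v _ p) = D ∪ ⁅ v ⁆ , p⊆p∪q ⁅ v ⁆
        , ≤-trans (card-∪-≤ D ⁅ v ⁆) (≤-reflexive (trans (cong (∣ D ∣ +_) (∣⁅x⁆∣≡1 v)) (+-comm ∣ D ∣ 1))) , p

      -- Pigeonhole: a layer has `N + 1` vertices.
      undefended : ∀ (D : Subset V) i → ∣ D ∣ ≤ N → ∃[ j ] encode (layer i j) ∉ D
      undefended D i ∣D∣≤N with any? (λ j → ¬? (encode (layer i j) ∈? D))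
      ... | yes found = found
      ... | no none = contradiction ∣D∣≤N (<⇒≱ (card-injection D (λ j → encode (layer i j)) layer-injective
                        (λ j → case encode (layer i j) ∈? D of λ { (yes ∈D) → ∈D ; (no ∉D) → contradiction (j , ∉D) none })))
        where
        layer-injective : ∀ {j k} → encode (layer i j) ≡ encode (layer i k) → j ≡ k
        layer-injective {j} {k} eq with encode-injective {layer i j} {layer i k} eq
        ... | refl = refl

      record Burning (τ : ℕ) (F D B : Subset V) : Set where
        field
          continued : Play D B F
          ∣D∣≤      : ∣ D ∣ ≤ τ
          -- At time 0 the source is the only vertex of the front level and must itself pass on the
          -- fire; at later times `undefended` provides such a vertex.
          s∉D       : τ ≡ 0 → s ∉ D
          burnt     : ∀ v → IsCore v → level v ≤ τ → encode v ∉ D → encode v ∈ B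

      burning-step : ∀ {τ F D B} → τ < N → Burning τ F D B → ∃[ D′ ] ∃[ B′ ] Burning (suc τ) F D′ B′
      burning-step {τ} {F} {D} {B} τ<N I with next-round (Burning.continued I)
      ... | D′ , D⊆D′ , ∣D′∣≤ , p = D′ , spread D′ B , record
            { continued = p
            ; ∣D∣≤      = ≤-trans ∣D′∣≤ (s≤s ∣D∣≤)
            ; s∉D       = λ ()
            ; burnt     = burnt′
            }
        where
        open Burning I
        front : ∀ τ → τ < N → (∣ D ∣ ≤ τ) → (τ ≡ 0 → s ∉ D) → ∃[ w ] IsCore w × level w ≡ τ × encode w ∉ D
        front zero    _         _ s∉D = source , _ , refl , s∉D refl
        front (suc τ) (s≤s τ<N′) ∣D∣≤ _ with undefended D (fromℕ< τ<N′) (≤-trans ∣D∣≤ (≤-trans τ<N′ (n≤1+n N′)))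
        ... | j , ∉D = layer (fromℕ< τ<N′) j , _ , cong suc (toℕ-fromℕ< τ<N′) , ∉D
        burnt′ : ∀ v → IsCore v → level v ≤ suc τ → encode v ∉ D′ → encode v ∈ spread D′ B
        burnt′ v cv lv v∉D′ with m≤n⇒m<n∨m≡n lv
        ... | inj₁ (s≤s lv≤τ) = spread⁺ˡ D′ B (burnt v cv lv≤τ (v∉D′ ∘ D⊆D′))
        ... | inj₂ lv≡ with front τ τ<N ∣D∣≤ s∉D
        ...   | w , cw , lw , w∉D = spread⁺ʳ D′ B v∉D′ (burnt w cw (≤-reflexive lw) w∉D)
                (adj w v (core-adjacent w v cw cv (subst₂ (λ i j → T (consecutive i j)) (sym lw) (sym lv≡) (consecutive-suc τ))))

      burning : ∀ {F} → Play Subset.⊥ ⁅ s ⁆ F → ∀ τ → τ ≤ N → ∃[ D ] ∃[ B ] Burning τ F D B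
      burning p zero    _   = Subset.⊥ , ⁅ s ⁆ , record
        { continued = p
        ; ∣D∣≤      = ≤-reflexive (∣⊥∣≡0 V)
        ; s∉D       = λ _ → ∉⊥
        ; burnt     = λ v _ lv _ → subst (λ v → encode v ∈ ⁅ s ⁆) (sym (level-0 v (n≤0⇒n≡0 lv))) (x∈⁅x⁆ s)
        }
      burning p (suc τ) τ<N = let D , B , I = burning p τ (≤-trans (n≤1+n τ) τ<N) in burning-step τ<N I

      -- At time `N` every core vertex outside `D` burns, and `D` has at most `N` vertices. One
      -- round later all edge vertices with a lost candidate burn unless defended, and the
      -- firefighter has placed one more vertex: this is the `suc`.
      saved-score : ∀ κ → CanSave s (N + κ) → Σ[ S ∈ (Fin u → Bool) ] ∣ Vec.tabulate S ∣ ≤ N × κ ≤ suc (score y S es)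
      saved-score κ (F , p , k≤) with burning p N ≤-refl
      ... | D , B , I with next-round (Burning.continued I)
      ...   | D′ , D⊆D′ , ∣D′∣≤ , p′ = S , ∣S∣≤N , +-cancelˡ-≤ N κ (suc (score y S es)) bound
        where
        open Burning I
        S : Fin u → Bool
        S a = Vec.lookup D (encode (cand a))
        ∣S∣≤N : ∣ Vec.tabulate S ∣ ≤ N
        ∣S∣≤N = ≤-trans (card-∘ D (λ a → encode (cand a)) (λ {a} {b} eq → cand-injective (encode-injective {cand a} {cand b} eq))) ∣D∣≤
          where
          cand-injective : ∀ {a b} → cand a ≡ cand b → a ≡ b
          cand-injective refl = refl
        kept : Subset V
        kept = Subset.⊥ {core} Vec.++ Vec.tabulate (λ e → satisfied y S (lookup es e))
        kept-or-defended : ∀ v → encode v ∉ F → encode v ∈ D′ ∪ kept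
        kept-or-defended v v∉F with encode v ∈? D′
        kept-or-defended v          v∉F | yes v∈D′ = x∈p∪q⁺ (inj₁ v∈D′)
        kept-or-defended source     v∉F | no v∉D′ = contradiction (play-⊆ p′ (spread⁺ˡ D′ B (burnt source _ (core-level source _) (v∉D′ ∘ D⊆D′)))) v∉F
        kept-or-defended (layer i j) v∉F | no v∉D′ = contradiction (play-⊆ p′ (spread⁺ˡ D′ B (burnt (layer i j) _ (core-level (layer i j) _) (v∉D′ ∘ D⊆D′)))) v∉F
        kept-or-defended (cand a)   v∉F | no v∉D′ = contradiction (play-⊆ p′ (spread⁺ˡ D′ B (burnt (cand a) _ ≤-refl (v∉D′ ∘ D⊆D′)))) v∉F
        kept-or-defended (edge e)   v∉F | no v∉D′ = x∈p∪q⁺ {p = D′} (inj₂ (edge∈ {p = Subset.⊥} (∈-tabulate⁺ (satisfied⁺ y S (lookup es e) keep))))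
          where
          keep : ∀ a → T (bitOf y (lookup es e a)) → T (S a)
          keep a ea with encode (cand a) ∈? D
          ... | yes a∈D = ∈⇒T a∈D
          ... | no a∉D = contradiction (play-⊆ p′ (spread⁺ʳ D′ B v∉D′ (burnt (cand a) _ ≤-refl a∉D) (adj (cand a) (edge e) ea))) v∉F
        bound : N + κ ≤ N + suc (score y S es)
        bound = begin
          N + κ                      ≤⟨ k≤ ⟩
          ∣ ∁ F ∣                    ≤⟨ p⊆q⇒∣p∣≤∣q∣ (λ {v} v∈ → subst (_∈ D′ ∪ kept) (encode-decode v) (kept-or-defended (decode v) (subst (_∉ F) (sym (encode-decode v)) (x∈∁p⇒x∉p v∈)))) ⟩
          ∣ D′ ∪ kept ∣              ≤⟨ card-∪-≤ D′ kept ⟩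
          ∣ D′ ∣ + ∣ kept ∣          ≤⟨ +-mono-≤ (≤-trans ∣D′∣≤ (s≤s ∣D∣≤)) (≤-reflexive (trans (card-++ (Subset.⊥ {core}) _) (cong₂ _+_ (∣⊥∣≡0 core) (card-lookup es (satisfied y S))))) ⟩
          suc N + score y S es       ≡⟨ sym (+-suc N _) ⟩
          N + suc (score y S es)     ∎
          where open ≤-Reasoning

-- From constraint satisfaction to a choice of candidates

module AssignmentReduction where
  open Sums
  open FirefighterReduction
  open import Data.Bool.Properties using (T?)
  open import Data.Fin.Base using (Fin; zero; suc; _↑ˡ_; _↑ʳ_; splitAt; combine; remQuot)
  open import Data.Fin.Properties as Fin using (any?; splitAt-↑ˡ; splitAt-↑ʳ; remQuot-combine; combine-remQuot)
  open import Data.Fin.Subset using (∣_∣)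
  open import Data.List.Base as List using (List; []; _∷_; length; lookup; _++_; map; concatMap; allFin; replicate)
  open import Data.List.Properties using (length-++; length-map; length-replicate; length-tabulate; map-tabulate)
  open import Data.List.Membership.Propositional using (_∈_)
  open import Data.List.Membership.Propositional.Properties using (∈-allFin; ∈-lookup)
  open import Data.List.Relation.Unary.All as All using (All; []; _∷_)
  import Data.List.Relation.Unary.All.Properties as All
  open import Data.Nat.Base hiding (_⊔_; ∣_-_∣)
  open import Data.Nat.Properties
  open import Data.Sum.Base as Sum using (_⊎_; inj₁; inj₂; [_,_]′)
  import Data.Vec.Base as Vec
  open import Data.Vec.Base using (Vec; []; _∷_)
  import Data.Vec.Properties as Vec

  ∑-allFin-suc : ∀ n (f : Fin (suc n) → ℕ) → ∑ (allFin (suc n)) f ≡ f zero + ∑ (allFin n) (f ∘ suc)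
  ∑-allFin-suc n f = cong (f zero +_) (trans (cong (λ xs → ∑ xs f) (sym (map-tabulate id suc))) (∑-map suc (allFin n) f))

  ∑-allFin-+ : ∀ m n (f : Fin (m + n) → ℕ) →
               ∑ (allFin (m + n)) f ≡ ∑ (allFin m) (f ∘ (_↑ˡ n)) + ∑ (allFin n) (f ∘ (m ↑ʳ_))
  ∑-allFin-+ zero    n f = refl
  ∑-allFin-+ (suc m) n f = begin
    ∑ (allFin (suc (m + n))) f ≡⟨ ∑-allFin-suc (m + n) f ⟩
    f zero + ∑ (allFin (m + n)) (f ∘ suc) ≡⟨ cong (f zero +_) (∑-allFin-+ m n (f ∘ suc)) ⟩
    f zero + (∑ (allFin m) (f ∘ suc ∘ (_↑ˡ n)) + ∑ (allFin n) (f ∘ (suc m ↑ʳ_))) ≡⟨ sym (+-assoc (f zero) _ _) ⟩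
    f zero + ∑ (allFin m) (f ∘ suc ∘ (_↑ˡ n)) + ∑ (allFin n) (f ∘ (suc m ↑ʳ_)) ≡⟨ cong (_+ ∑ (allFin n) (f ∘ (suc m ↑ʳ_))) (sym (∑-allFin-suc m (f ∘ (_↑ˡ n)))) ⟩
    ∑ (allFin (suc m)) (f ∘ (_↑ˡ n)) + ∑ (allFin n) (f ∘ (suc m ↑ʳ_)) ∎
    where open ≡-Reasoning

  ∑-allFin-* : ∀ m n (f : Fin (m * n) → ℕ) →
               ∑ (allFin (m * n)) f ≡ ∑ (allFin m) (λ i → ∑ (allFin n) (λ j → f (combine i j)))
  ∑-allFin-* zero    n f = refl
  ∑-allFin-* (suc m) n f = begin
    ∑ (allFin (n + m * n)) f ≡⟨ ∑-allFin-+ n (m * n) f ⟩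
    ∑ (allFin n) (f ∘ (_↑ˡ (m * n))) + ∑ (allFin (m * n)) (f ∘ (n ↑ʳ_)) ≡⟨ cong (∑ (allFin n) (f ∘ (_↑ˡ (m * n))) +_) (∑-allFin-* m n (f ∘ (n ↑ʳ_))) ⟩
    ∑ (allFin n) (f ∘ (_↑ˡ (m * n))) + ∑ (allFin m) (λ i → ∑ (allFin n) (λ j → f (n ↑ʳ combine i j))) ≡⟨ sym (∑-allFin-suc m (λ i → ∑ (allFin n) (λ j → f (combine i j)))) ⟩
    ∑ (allFin (suc m)) (λ i → ∑ (allFin n) (λ j → f (combine i j))) ∎
    where open ≡-Reasoning

  ∑-allFin-const : ∀ n c → ∑ (allFin n) (λ _ → c) ≡ n * c
  ∑-allFin-const n c = trans (∑-const (allFin n) c) (cong (_* c) (length-tabulate {n = n} id))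

  card≡∑ : ∀ n (S : Fin n → Bool) → ∣ Vec.tabulate S ∣ ≡ ∑ (allFin n) (ind ∘ S)
  card≡∑ zero    S = refl
  card≡∑ (suc n) S = trans (card-∷ (S zero) (Vec.tabulate (S ∘ suc))) (trans (cong (ind (S zero) +_) (card≡∑ n (S ∘ suc))) (sym (∑-allFin-suc n (ind ∘ S))))

  ∑-single : ∀ n (x : Fin n) → ∑ (allFin n) (λ z → ind (isYes (z Fin.≟ x))) ≡ 1
  ∑-single (suc n) zero    = trans (∑-allFin-suc n (λ z → ind (isYes (z Fin.≟ zero)))) (cong suc (trans (∑-allFin-const n 0) (*-zeroʳ n)))
  ∑-single (suc n) (suc x) = trans (∑-allFin-suc n (λ z → ind (isYes (z Fin.≟ suc x)))) (trans (∑-cong (allFin n) (λ z → cong ind (same z))) (∑-single n x))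
    where
    same : ∀ z → isYes (suc z Fin.≟ suc x) ≡ isYes (z Fin.≟ x)
    same z with z Fin.≟ x
    ... | yes _ = refl
    ... | no _  = refl

  ∑-unique : ∀ n (b : Fin n → Bool) → (∀ x z → T (b x) → T (b z) → x ≡ z) → ∑ (allFin n) (ind ∘ b) ≤ 1
  ∑-unique n b unique with any? (λ x → T? (b x))
  ... | yes (x , bx) = ≤-trans (∑-mono (allFin n) (λ z → ind-mono (λ bz → fromWitness (unique z x bz bx)))) (≤-reflexive (∑-single n x))
  ... | no none = ≤-trans (≤-reflexive (trans (∑-cong (allFin n) (λ z → ¬T⇒ind≡0 (λ bz → none (z , bz)))) (trans (∑-allFin-const n 0) (*-zeroʳ n)))) z≤n

  vectors : ∀ D a → List (Vec (Fin D) a)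
  vectors D zero    = [] ∷ []
  vectors D (suc a) = concatMap (λ d → map (d ∷_) (vectors D a)) (allFin D)

  _≟ᵛ_ : ∀ {D a} (v w : Vec (Fin D) a) → Dec (v ≡ w)
  _≟ᵛ_ = Vec.≡-dec Fin._≟_

  -- Every tuple is enumerated exactly once, so the tuple taken by an assignment counts once for
  -- each constraint.
  ∑-vectors : ∀ D a (w : Vec (Fin D) a) → ∑ (vectors D a) (λ v → ind (isYes (v ≟ᵛ w))) ≡ 1
  ∑-vectors D zero    []      = refl
  ∑-vectors D (suc a) (x ∷ w) = begin
    ∑ (vectors D (suc a)) (λ v → ind (isYes (v ≟ᵛ (x ∷ w))))                              ≡⟨ ∑-concatMap (λ d → map (d ∷_) (vectors D a)) (allFin D) _ ⟩
    ∑ (allFin D) (λ d → ∑ (map (d ∷_) (vectors D a)) (λ v → ind (isYes (v ≟ᵛ (x ∷ w)))))  ≡⟨ ∑-cong (allFin D) (λ d → trans (∑-map (d ∷_) (vectors D a) _) (block d)) ⟩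
    ∑ (allFin D) (λ d → ind (isYes (d Fin.≟ x)))                                          ≡⟨ ∑-single D x ⟩
    1 ∎
    where
    open ≡-Reasoning
    term : ∀ d v → ind (isYes ((d ∷ v) ≟ᵛ (x ∷ w))) ≡ ind (isYes (d Fin.≟ x)) * ind (isYes (v ≟ᵛ w))
    term d v with d Fin.≟ x | v ≟ᵛ w
    ... | yes refl | yes refl = refl
    ... | yes refl | no _     = refl
    ... | no _     | _        = refl
    block : ∀ d → ∑ (vectors D a) (λ v → ind (isYes ((d ∷ v) ≟ᵛ (x ∷ w)))) ≡ ind (isYes (d Fin.≟ x))
    block d = trans (∑-cong (vectors D a) (term d))
             (trans (∑-* (vectors D a) (ind (isYes (d Fin.≟ x))) _)
             (trans (cong (ind (isYes (d Fin.≟ x)) *_) (∑-vectors D a w)) (*-identityʳ _)))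

  length-vectors : ∀ D a → length (vectors D a) ≡ D ^ a
  length-vectors D zero    = refl
  length-vectors D (suc a) = trans (length-concatMap (λ d → map (d ∷_) (vectors D a)) (allFin D))
    (trans (∑-cong (allFin D) (λ d → trans (length-map (d ∷_) (vectors D a)) (length-vectors D a))) (∑-allFin-const D (D ^ a)))

  square-cancel : ∀ {m n} → m * m ≤ n * n → m ≤ n
  square-cancel {m} {n} h with m ≤? n
  ... | yes m≤n = m≤n
  ... | no m≰n = contradiction h (<⇒≱ (*-mono-< (≰⇒> m≰n) (≰⇒> m≰n)))

  -- The weight `r` exceeds `1 + 2 * l`, the most that the lower-order part together with the slack
  -- of one can contribute, so not even one unit of the leading part may be missing.
  leading-≤ : ∀ r l x p q g → r ≡ 2 + 2 * l → r * x + g ≤ suc (r * p + 2 * q) → q ≤ l → x ≤ p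
  leading-≤ r l x p q g r≡ bound q≤l with x ≤? p
  ... | yes x≤p = x≤p
  ... | no x≰p = contradiction (+-cancelˡ-≤ (r * p) r (suc (2 * l)) (begin
    r * p + r             ≡⟨ lemma r p ⟩
    r * suc p             ≤⟨ *-monoʳ-≤ r (≰⇒> x≰p) ⟩
    r * x                 ≤⟨ m≤m+n _ g ⟩
    r * x + g             ≤⟨ bound ⟩
    suc (r * p + 2 * q)   ≤⟨ s≤s (+-monoʳ-≤ (r * p) (*-monoʳ-≤ 2 q≤l)) ⟩
    suc (r * p + 2 * l)   ≡⟨ sym (+-suc (r * p) _) ⟩
    r * p + suc (2 * l)   ∎)) (<⇒≱ (≤-reflexive (sym r≡)))
    where
    open ≤-Reasoning
    lemma : ∀ r p → r * p + r ≡ r * suc p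
    lemma = solve-∀

  -- A missing unit costs 2, more than the slack of one. This is the origin of the factor 2.
  remainder-≤ : ∀ r x p q g → p ≤ x → r * x + 2 * g ≤ suc (r * p + 2 * q) → g ≤ q
  remainder-≤ r x p q g p≤x bound with g ≤? q
  ... | yes g≤q = g≤q
  ... | no g≰q = contradiction (+-cancelˡ-≤ (r * p) (2 * g) (suc (2 * q)) (begin
    r * p + 2 * g         ≤⟨ +-monoˡ-≤ (2 * g) (*-monoʳ-≤ r p≤x) ⟩
    r * x + 2 * g         ≤⟨ bound ⟩
    suc (r * p + 2 * q)   ≡⟨ sym (+-suc (r * p) _) ⟩
    r * p + suc (2 * q)   ∎)) (<⇒≱ (≤-trans (≤-reflexive (lemma q)) (*-monoʳ-≤ 2 (≰⇒> g≰q))))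
    where
    open ≤-Reasoning
    lemma : ∀ q → suc (suc (2 * q)) ≡ 2 * suc q
    lemma = solve-∀

  -- The arity is fixed so that a relation can be expanded into its allowed tuples: there are at
  -- most `D ^ a` of them, a constant for a fixed machine.
  Constraint : ℕ → ℕ → ℕ → Set
  Constraint N D a = Vec (Fin N) a × (Vec (Fin D) a → Bool)

  Satisfies : ∀ {N D a} → (Fin N → Fin D) → Constraint N D a → Set
  Satisfies α (vs , R) = T (R (Vec.map α vs))

  -- Candidates are the pairs of a variable and a value. Compatible pairs of candidates, with a large
  -- multiplicity, force the N kept candidates to form an assignment; a constraint contributes one set for every
  -- tuple it allows, of which an assignment keeps at most one. The variables beyond the first 1 + M
  -- hold the code of the selected input i; the set for i and j is kept if i is selected and the j-th bit
  -- of that input is the value of the variable yv j.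
  module Composition
    (M I D a : ℕ) (D≥2 : 2 ≤ D)
    (constraints : List (Constraint (suc M) D (suc a)))
    (n t : ℕ) (yv : Fin n → Fin (suc M))
    (value : Bool → Fin D) (value-distinct : value true ≢ value false)
    (code : Fin (suc t) → Fin I → Bool)
    (code-injective : ∀ i j → (∀ k → code i k ≡ code j k) → i ≡ j)
    (address : Fin (suc t) → Fin n → ℕ) where

    N′ N u C : ℕ
    N′ = M + I
    N  = suc N′
    u  = N * D
    C  = length constraints

    var : Fin u → Fin N
    var ℓ = proj₁ (remQuot {N} D ℓ)

    val : Fin u → Fin D
    val ℓ = proj₂ (remQuot {N} D ℓ)

    var-combine : ∀ i d → var (combine i d) ≡ i
    var-combine i d = cong proj₁ (remQuot-combine {k = D} i d)

    val-combine : ∀ i d → val (combine i d) ≡ d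
    val-combine i d = cong proj₂ (remQuot-combine {k = D} i d)

    cellVar : Fin (suc M) → Fin N
    cellVar = _↑ˡ I

    indexVar : Fin I → Fin N
    indexVar = suc M ↑ʳ_

    Hyperedge : Set
    Hyperedge = Fin u → Source

    -- The substitute for a forbidden set. It has `u = N * D > N` candidates and so is never kept,
    -- but it is nonempty, so its vertex stays connected to the graph.
    everything : Hyperedge
    everything _ = const true

    Compatible : Fin u → Fin u → Set
    Compatible ℓ₁ ℓ₂ = var ℓ₁ ≡ var ℓ₂ → ℓ₁ ≡ ℓ₂

    compatible? : ∀ ℓ₁ ℓ₂ → Dec (Compatible ℓ₁ ℓ₂)
    compatible? ℓ₁ ℓ₂ = (var ℓ₁ Fin.≟ var ℓ₂) →-dec (ℓ₁ Fin.≟ ℓ₂)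

    literalPair : Fin u → Fin u → Hyperedge
    literalPair ℓ₁ ℓ₂ ℓ = const (isYes (ℓ Fin.≟ ℓ₁) ∨ isYes (ℓ Fin.≟ ℓ₂))

    -- Used for ordered pairs including the diagonal, so that `N` pairwise compatible candidates
    -- keep `N * N` of them and the count is compared with a square.
    pairEdge : Fin u → Fin u → Hyperedge
    pairEdge ℓ₁ ℓ₂ with compatible? ℓ₁ ℓ₂
    ... | yes _ = literalPair ℓ₁ ℓ₂
    ... | no _  = everything

    sameLiteral? : ∀ vs (v : Vec (Fin D) (suc a)) ℓ → Dec (∃[ k ] cellVar (Vec.lookup vs k) ≡ var ℓ × Vec.lookup v k ≡ val ℓ)
    sameLiteral? vs v ℓ = any? λ k → (cellVar (Vec.lookup vs k) Fin.≟ var ℓ) ×-dec (Vec.lookup v k Fin.≟ val ℓ)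

    -- Scopes may repeat a variable, as padded ones do. A tuple that gives it two values asks for
    -- two candidates of one variable, and no assignment keeps both.
    literals : Vec (Fin (suc M)) (suc a) → Vec (Fin D) (suc a) → Hyperedge
    literals vs v ℓ = const (isYes (sameLiteral? vs v ℓ))

    cubeEdge : Constraint (suc M) D (suc a) → Vec (Fin D) (suc a) → Hyperedge
    cubeEdge (vs , R) v with R v
    ... | true  = literals vs v
    ... | false = everything

    -- Which value of `yv j` belongs to the set depends on a bit of the input. The candidate for the
    -- value of true gets the positive literal of that bit and the one for the value of false the
    -- negated literal, so exactly one of them is a member.
    selectSource : Fin (suc t) → Fin n → Fin (suc M) ⊎ Fin I → Fin D → Source
    selectSource i j (inj₂ k) d = const (isYes (d Fin.≟ value (code i k)))
    selectSource i j (inj₁ v) d with v Fin.≟ yv j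
    ... | no _  = const false
    ... | yes _ with d Fin.≟ value true
    ...   | yes _ = literal (address i j) true
    ...   | no _ with d Fin.≟ value false
    ...     | yes _ = literal (address i j) false
    ...     | no _  = const false

    selectEdge : Fin (suc t) → Fin n → Hyperedge
    selectEdge i j ℓ = selectSource i j (splitAt (suc M) (var ℓ)) (val ℓ)

    selectEdge-combine : ∀ i j x d → selectEdge i j (combine x d) ≡ selectSource i j (splitAt (suc M) x) d
    selectEdge-combine i j x d = cong₂ (λ x d → selectSource i j (splitAt (suc M) x) d) (var-combine x d) (val-combine x d)

    cubeEdges selectEdges : List Hyperedge
    cubeEdges   = concatMap (λ c → map (cubeEdge c) (vectors D (suc a))) constraints
    selectEdges = concatMap (λ i → map (selectEdge i) (allFin n)) (allFin (suc t))

    -- Exceeds the number of all other edges.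
    R : ℕ
    R = 2 + 2 * (length cubeEdges + length selectEdges)

    pairEdges edges : List Hyperedge
    pairEdges = concatMap (λ ℓ₁ → concatMap (λ ℓ₂ → replicate R (pairEdge ℓ₁ ℓ₂)) (allFin u)) (allFin u)
    -- Two copies of the lower-order sets: losing one set then costs two vertices, which the one
    -- further vertex of the firefighter cannot make up for.
    edges     = pairEdges ++ (cubeEdges ++ selectEdges) ++ (cubeEdges ++ selectEdges)

    selectSource-All : ∀ {Q : Source → Set} → (∀ b → Q (const b)) → (∀ i j b → Q (literal (address i j) b)) →
                       ∀ i j x d → Q (selectSource i j x d)
    selectSource-All c l i j (inj₂ k) d = c _
    selectSource-All c l i j (inj₁ x) d with x Fin.≟ yv j
    ... | no _ = c _
    ... | yes _ with d Fin.≟ value true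
    ...   | yes _ = l i j true
    ...   | no _ with d Fin.≟ value false
    ...     | yes _ = l i j false
    ...     | no _  = c _

    edges-All : ∀ {Q : Source → Set} → (∀ b → Q (const b)) → (∀ i j b → Q (literal (address i j) b)) →
                All (λ e → ∀ ℓ → Q (e ℓ)) edges
    edges-All {Q} c l = All.++⁺ pairs (All.++⁺ (All.++⁺ cubes selects) (All.++⁺ cubes selects))
      where
      Everywhere : Hyperedge → Set
      Everywhere e = ∀ ℓ → Q (e ℓ)
      pairAll : ∀ ℓ₁ ℓ₂ → Everywhere (pairEdge ℓ₁ ℓ₂)
      pairAll ℓ₁ ℓ₂ ℓ with compatible? ℓ₁ ℓ₂
      ... | yes _ = c _
      ... | no _  = c _
      cubeAll : ∀ k w → Everywhere (cubeEdge k w)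
      cubeAll (vs , P) w ℓ with P w
      ... | true  = c _
      ... | false = c _
      pairs : All Everywhere pairEdges
      pairs = All.concat⁺ (All.map⁺ (All.universal (λ ℓ₁ → All.concat⁺ (All.map⁺ (All.universal (λ ℓ₂ → All.replicate⁺ R (pairAll ℓ₁ ℓ₂)) (allFin u)))) (allFin u)))
      cubes : All Everywhere cubeEdges
      cubes = All.concat⁺ (All.map⁺ (All.universal (λ k → All.map⁺ (All.universal (cubeAll k) (vectors D (suc a)))) constraints))
      selects : All Everywhere selectEdges
      selects = All.concat⁺ (All.map⁺ (All.universal (λ i → All.map⁺ (All.universal (λ j ℓ → selectSource-All {Q} c l i j (splitAt (suc M) (var ℓ)) (val ℓ)) (allFin n))) (allFin (suc t))))

    adjacencySource-All : ∀ {Q : Source → Set} → (∀ b → Q (const b)) → (∀ i j b → Q (literal (address i j) b)) →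
                          ∀ x z → Q (Reduction.adjacencySource N′ u edges x z)
    adjacencySource-All {Q} c l x z = Reduction.adjacency-All N′ u edges {Q} c (λ e a → All.lookup (edges-All {Q} c l) (∈-lookup e) a) (Reduction.decode N′ u edges x) (Reduction.decode N′ u edges z)

    -- What a solution keeps, weighted by multiplicity: all `N * N` pairs, one tuple for each
    -- constraint, and for each bit position the set of the selected input.
    goal : ℕ
    goal = R * (N * N) + 2 * (C + n)

    edges-bound : ℕ
    edges-bound = u * (u * R) + 2 * (length cubeEdges + length selectEdges)

    length-cubeEdges : length cubeEdges ≤ C * D ^ suc a
    length-cubeEdges = length-concatMap-≤ (λ c → map (cubeEdge c) (vectors D (suc a))) constraints
      (λ c → ≤-reflexive (trans (length-map (cubeEdge c) (vectors D (suc a))) (length-vectors D (suc a))))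

    length-selectEdges : length selectEdges ≤ suc t * n
    length-selectEdges = ≤-trans (length-concatMap-≤ (λ i → map (selectEdge i) (allFin n)) (allFin (suc t))
      (λ i → ≤-reflexive (trans (length-map (selectEdge i) (allFin n)) (length-tabulate {n = n} id))))
      (≤-reflexive (cong (_* n) (length-tabulate {n = suc t} id)))

    length-edges : length edges ≤ edges-bound
    length-edges = begin
      length edges ≡⟨ length-++ pairEdges ⟩
      length pairEdges + length ((cubeEdges ++ selectEdges) ++ (cubeEdges ++ selectEdges))
        ≤⟨ +-mono-≤ pairs≤ (≤-reflexive rest) ⟩
      edges-bound ∎
      where
      open ≤-Reasoning
      pairs≤ : length pairEdges ≤ u * (u * R)
      pairs≤ = ≤-trans (length-concatMap-≤ _ (allFin u) {u * R} (λ ℓ₁ →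
          ≤-trans (length-concatMap-≤ _ (allFin u) {R} (λ ℓ₂ → ≤-reflexive (length-replicate R))) (≤-reflexive (cong (_* R) (length-tabulate {n = u} id)))))
        (≤-reflexive (cong (_* (u * R)) (length-tabulate {n = u} id)))
      rest : length ((cubeEdges ++ selectEdges) ++ (cubeEdges ++ selectEdges)) ≡ 2 * (length cubeEdges + length selectEdges)
      rest = trans (length-++ (cubeEdges ++ selectEdges))
        (cong₂ _+_ (length-++ cubeEdges) (trans (length-++ cubeEdges) (sym (+-identityʳ _))))

    module Scores (y : ℕ → Bool) where

      sat : (Fin u → Bool) → Hyperedge → Bool
      sat S = satisfied y S

      pairScore cubeScore selectScore : (Fin u → Bool) → ℕ
      pairScore   S = ∑ (allFin u) (λ ℓ₁ → ∑ (allFin u) (λ ℓ₂ → ind (sat S (pairEdge ℓ₁ ℓ₂))))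
      cubeScore   S = score y S cubeEdges
      selectScore S = score y S selectEdges

      score-edges : ∀ S → score y S edges ≡ R * pairScore S + 2 * (cubeScore S + selectScore S)
      score-edges S = trans (∑-++ pairEdges _ f) (cong₂ _+_ pairs rest)
        where
        f = ind ∘ sat S
        pairs : ∑ pairEdges f ≡ R * pairScore S
        pairs = trans (∑-concatMap _ (allFin u) f) (trans (∑-cong (allFin u) (λ ℓ₁ →
            trans (∑-concatMap _ (allFin u) f) (trans (∑-cong (allFin u) (λ ℓ₂ → ∑-replicate R (pairEdge ℓ₁ ℓ₂) f)) (∑-* (allFin u) R _))))
          (∑-* (allFin u) R _))
        rest : ∑ ((cubeEdges ++ selectEdges) ++ (cubeEdges ++ selectEdges)) f ≡ 2 * (cubeScore S + selectScore S)
        rest = trans (∑-++ (cubeEdges ++ selectEdges) _ f)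
          (cong₂ _+_ (∑-++ cubeEdges selectEdges f) (trans (∑-++ cubeEdges selectEdges f) (sym (+-identityʳ _))))

      size : (Fin u → Bool) → ℕ
      size S = ∑ (allFin u) (ind ∘ S)

      size-rows : ∀ S → size S ≡ ∑ (allFin N) (λ i → ∑ (allFin D) (λ d → ind (S (combine i d))))
      size-rows S = ∑-allFin-* N D (ind ∘ S)

      N<u : N < u
      N<u = <-≤-trans (≤-trans (s≤s (m≤m+n N N′)) (≤-reflexive (lemma N′))) (*-monoʳ-≤ N D≥2)
        where
        lemma : ∀ k → suc (suc k + k) ≡ suc k * 2
        lemma = solve-∀

      not-everything : ∀ S → size S ≤ N → ¬ T (sat S everything)
      not-everything S small t = <⇒≱ N<u (≤-trans (≤-reflexive (sym full)) small)
        where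
        full : size S ≡ u
        full = trans (∑-cong (allFin u) (λ ℓ → ≤-antisym (ind≤1 (S ℓ)) (T⇒1≤ind (satisfied⁻ y S everything t ℓ _)))) (trans (∑-allFin-const u 1) (*-identityʳ u))

      pair-kept : ∀ S → size S ≤ N → ∀ ℓ₁ ℓ₂ → T (sat S (pairEdge ℓ₁ ℓ₂)) → T (S ℓ₁) × T (S ℓ₂) × Compatible ℓ₁ ℓ₂
      pair-kept S small ℓ₁ ℓ₂ t with compatible? ℓ₁ ℓ₂
      ... | no _ = contradiction t (not-everything S small)
      ... | yes c = kept ℓ₁ (∨ˡ {isYes (ℓ₁ Fin.≟ ℓ₁)} (isYes (ℓ₁ Fin.≟ ℓ₂)) (fromWitness {a? = ℓ₁ Fin.≟ ℓ₁} refl))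
                  , kept ℓ₂ (∨ʳ (isYes (ℓ₂ Fin.≟ ℓ₁)) (fromWitness {a? = ℓ₂ Fin.≟ ℓ₂} refl)) , c
        where
        kept = satisfied⁻ y S (literalPair ℓ₁ ℓ₂) t
        ∨ˡ : ∀ {a} b → T a → T (a ∨ b)
        ∨ˡ {true} _ _ = _
        ∨ʳ : ∀ a {b} → T b → T (a ∨ b)
        ∨ʳ true  _ = _
        ∨ʳ false t = t

      pair-kept⁺ : ∀ S ℓ₁ ℓ₂ → T (S ℓ₁) → T (S ℓ₂) → Compatible ℓ₁ ℓ₂ → T (sat S (pairEdge ℓ₁ ℓ₂))
      pair-kept⁺ S ℓ₁ ℓ₂ s₁ s₂ c with compatible? ℓ₁ ℓ₂
      ... | no ¬c = contradiction c ¬c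
      ... | yes _ = satisfied⁺ y S (literalPair ℓ₁ ℓ₂) kept
        where
        kept : ∀ ℓ → T (isYes (ℓ Fin.≟ ℓ₁) ∨ isYes (ℓ Fin.≟ ℓ₂)) → T (S ℓ)
        kept ℓ t with ℓ Fin.≟ ℓ₁
        ... | yes refl = s₁
        ... | no _ with ℓ Fin.≟ ℓ₂
        ...   | yes refl = s₂

      both : (Fin u → Bool) → Fin u → Fin u → ℕ
      both S ℓ₁ ℓ₂ = ind (S ℓ₁) * ind (S ℓ₂)

      ∑-both : ∀ S → ∑ (allFin u) (λ ℓ₁ → ∑ (allFin u) (both S ℓ₁)) ≡ size S * size S
      ∑-both S = trans (∑-cong (allFin u) (λ ℓ₁ → trans (∑-* (allFin u) (ind (S ℓ₁)) _) (*-comm (ind (S ℓ₁)) (size S)))) (∑-* (allFin u) (size S) _)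

      pair≤both : ∀ S → size S ≤ N → ∀ ℓ₁ ℓ₂ → ind (sat S (pairEdge ℓ₁ ℓ₂)) ≤ both S ℓ₁ ℓ₂
      pair≤both S small ℓ₁ ℓ₂ with sat S (pairEdge ℓ₁ ℓ₂) in eq
      ... | false = z≤n
      ... | true with pair-kept S small ℓ₁ ℓ₂ (subst T (sym eq) _)
      ...   | s₁ , s₂ , _ = *-mono-≤ (T⇒1≤ind s₁) (T⇒1≤ind s₂)

      pairScore≤ : ∀ S → size S ≤ N → pairScore S ≤ size S * size S
      pairScore≤ S small = ≤-trans (∑-mono (allFin u) (λ ℓ₁ → ∑-mono (allFin u) (pair≤both S small ℓ₁))) (≤-reflexive (∑-both S))

      conflict : ∀ S → size S ≤ N → ∀ ℓ₁ ℓ₂ → T (S ℓ₁) → T (S ℓ₂) → ¬ Compatible ℓ₁ ℓ₂ → pairScore S < size S * size S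
      conflict S small ℓ₁ ℓ₂ s₁ s₂ ¬c = <-≤-trans
        (∑-mono< (allFin u) (λ ℓ → ∑-mono (allFin u) (pair≤both S small ℓ)) (∈-allFin ℓ₁)
          (∑-mono< (allFin u) (pair≤both S small ℓ₁) (∈-allFin ℓ₂)
            (≤-trans (s≤s (≤-reflexive (¬T⇒ind≡0 (λ t → ¬c (proj₂ (proj₂ (pair-kept S small ℓ₁ ℓ₂ t))))))) (*-mono-≤ (T⇒1≤ind s₁) (T⇒1≤ind s₂)))))
        (≤-reflexive (∑-both S))

      record IsGraph (S : Fin u → Bool) (α : Fin N → Fin D) : Set where
        field
          graph⁺ : ∀ i → T (S (combine i (α i)))
          graph⁻ : ∀ ℓ → T (S ℓ) → α (var ℓ) ≡ val ℓ
          small  : size S ≤ N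

      -- The chain `N * N ≤ pairScore S ≤ size S * size S ≤ N * N` collapses: no two kept candidates
      -- conflict and exactly `N` are kept. Each variable then has at most one kept value, and by
      -- counting it has one.
      assignment : ∀ S → size S ≤ N → N * N ≤ pairScore S → ∃[ α ] IsGraph S α
      assignment S small large = proj₁ ∘ choose , record { graph⁺ = proj₂ ∘ choose ; graph⁻ = functional ; small = small }
        where
        size≡N : size S ≡ N
        size≡N = ≤-antisym small (square-cancel (≤-trans large (pairScore≤ S small)))
        consistent : ∀ ℓ₁ ℓ₂ → T (S ℓ₁) → T (S ℓ₂) → Compatible ℓ₁ ℓ₂
        consistent ℓ₁ ℓ₂ s₁ s₂ with compatible? ℓ₁ ℓ₂
        ... | yes c = c
        ... | no ¬c = contradiction (≤-trans (*-mono-≤ small small) large) (<⇒≱ (conflict S small ℓ₁ ℓ₂ s₁ s₂ ¬c))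
        row : Fin N → ℕ
        row i = ∑ (allFin D) (λ d → ind (S (combine i d)))
        row≤1 : ∀ i → row i ≤ 1
        row≤1 i = ∑-unique D (λ d → S (combine i d)) (λ d e sd se →
          trans (sym (val-combine i d)) (trans (cong val (consistent _ _ sd se (trans (var-combine i d) (sym (var-combine i e))))) (val-combine i e)))
        choose : ∀ i → ∃[ d ] T (S (combine i d))
        choose i with any? (λ d → T? (S (combine i d)))
        ... | yes found = found
        ... | no none = contradiction (≤-reflexive (trans (sym size≡N) (size-rows S)))
              (<⇒≱ (<-≤-trans (∑-mono< (allFin N) row≤1 (∈-allFin i) (s≤s (≤-reflexive row≡0))) (≤-reflexive (trans (∑-allFin-const N 1) (*-identityʳ N)))))
          where
          row≡0 : row i ≡ 0
          row≡0 = trans (∑-cong (allFin D) (λ d → ¬T⇒ind≡0 (λ t → none (d , t)))) (trans (∑-allFin-const D 0) (*-zeroʳ D))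
        functional : ∀ ℓ → T (S ℓ) → proj₁ (choose (var ℓ)) ≡ val ℓ
        functional ℓ sℓ with choose (var ℓ)
        ... | d , sd = trans (sym (val-combine (var ℓ) d)) (cong val (consistent (combine (var ℓ) d) ℓ sd sℓ (var-combine (var ℓ) d)))

      graphOf : (Fin N → Fin D) → Fin u → Bool
      graphOf α ℓ = isYes (α (var ℓ) Fin.≟ val ℓ)

      graphOf-row : ∀ α i d → graphOf α (combine i d) ≡ isYes (d Fin.≟ α i)
      graphOf-row α i d = trans (cong₂ (λ x v → isYes (α x Fin.≟ v)) (var-combine i d) (val-combine i d)) (flip (α i) d)
        where
        flip : ∀ x z → isYes (x Fin.≟ z) ≡ isYes (z Fin.≟ x)
        flip x z with x Fin.≟ z | z Fin.≟ x
        ... | yes _  | yes _  = refl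
        ... | no _   | no _   = refl
        ... | yes eq | no ne  = contradiction (sym eq) ne
        ... | no ne  | yes eq = contradiction (sym eq) ne

      graphOf-size : ∀ α → size (graphOf α) ≡ N
      graphOf-size α = trans (size-rows (graphOf α))
        (trans (∑-cong (allFin N) (λ i → trans (∑-cong (allFin D) (λ d → cong ind (graphOf-row α i d))) (∑-single D (α i))))
        (trans (∑-allFin-const N 1) (*-identityʳ N)))

      graphOf-isGraph : ∀ α → IsGraph (graphOf α) α
      graphOf-isGraph α = record
        { graph⁺ = λ i → subst T (sym (graphOf-row α i (α i))) (fromWitness refl)
        ; graph⁻ = λ ℓ t → toWitness t
        ; small  = ≤-reflexive (graphOf-size α)
        }

      graphOf-pairScore : ∀ α → N * N ≤ pairScore (graphOf α)
      graphOf-pairScore α = begin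
        N * N                                 ≡⟨ cong₂ _*_ (sym (graphOf-size α)) (sym (graphOf-size α)) ⟩
        size S * size S                       ≡⟨ sym (∑-both S) ⟩
        ∑ (allFin u) (λ ℓ₁ → ∑ (allFin u) (both S ℓ₁)) ≤⟨ ∑-mono (allFin u) (λ ℓ₁ → ∑-mono (allFin u) (both≤pair ℓ₁)) ⟩
        pairScore S                           ∎
        where
        open ≤-Reasoning
        S = graphOf α
        both≤pair : ∀ ℓ₁ ℓ₂ → both S ℓ₁ ℓ₂ ≤ ind (sat S (pairEdge ℓ₁ ℓ₂))
        both≤pair ℓ₁ ℓ₂ with S ℓ₁ in eq₁ | S ℓ₂ in eq₂
        ... | false | _     = z≤n
        ... | true  | false = z≤n
        ... | true  | true  = T⇒1≤ind (pair-kept⁺ S ℓ₁ ℓ₂ t₁ t₂ compatible)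
          where
          t₁ = subst T (sym eq₁) _
          t₂ = subst T (sym eq₂) _
          compatible : Compatible ℓ₁ ℓ₂
          compatible same = trans (sym (combine-remQuot {N} D ℓ₁)) (trans (cong₂ combine same
            (trans (sym (IsGraph.graph⁻ (graphOf-isGraph α) ℓ₁ t₁)) (trans (cong α same) (IsGraph.graph⁻ (graphOf-isGraph α) ℓ₂ t₂)))) (combine-remQuot {N} D ℓ₂))

      select-own : ∀ i j b → y (address i j) ≡ b → T (bitOf y (selectSource i j (inj₁ (yv j)) (value b)))
      select-own i j b eq with yv j Fin.≟ yv j
      ... | no ne = contradiction refl ne
      select-own i j true eq | yes _ with value true Fin.≟ value true
      ... | yes _ = subst T (sym eq) _
      ... | no ne = contradiction refl ne
      select-own i j false eq | yes _ with value false Fin.≟ value true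
      ... | yes ft = contradiction (sym ft) value-distinct
      ... | no _ with value false Fin.≟ value false
      ...   | yes _ = subst (T ∘ not) (sym eq) _
      ...   | no ne = contradiction refl ne

      module OfAssignment {S : Fin u → Bool} {α : Fin N → Fin D} (isGraph : IsGraph S α) where
        open IsGraph isGraph

        graph-∈ : ∀ i d → α i ≡ d → ∀ {ℓ} → i ≡ var ℓ → d ≡ val ℓ → T (S ℓ)
        graph-∈ i _ refl {ℓ} refl vl = subst (T ∘ S) (trans (cong (combine i) vl) (combine-remQuot {N} D ℓ)) (graph⁺ i)

        α₀ : Fin (suc M) → Fin D
        α₀ = α ∘ cellVar

        cube-kept⁻ : ∀ vs P v → T (sat S (cubeEdge (vs , P) v)) → T (P v) × v ≡ Vec.map α₀ vs
        cube-kept⁻ vs P v t with P v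
        ... | false = contradiction t (not-everything S small)
        ... | true  = _ , trans (sym (Vec.tabulate∘lookup v)) (trans (Vec.tabulate-cong same) (Vec.tabulate∘lookup (Vec.map α₀ vs)))
          where
          same : ∀ k → Vec.lookup v k ≡ Vec.lookup (Vec.map α₀ vs) k
          same k = trans (sym (cong proj₂ rq)) (trans (sym (graph⁻ ℓ kept)) (trans (cong (α ∘ proj₁) rq) (sym (Vec.lookup-map k α₀ vs))))
            where
            ℓ = combine (cellVar (Vec.lookup vs k)) (Vec.lookup v k)
            rq : remQuot {N} D ℓ ≡ (cellVar (Vec.lookup vs k) , Vec.lookup v k)
            rq = remQuot-combine {k = D} (cellVar (Vec.lookup vs k)) (Vec.lookup v k)
            kept : T (S ℓ)
            kept = satisfied⁻ y S (literals vs v) t ℓ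
              (fromWitness (k , sym (cong proj₁ rq) , sym (cong proj₂ rq)))

        cube-kept⁺ : ∀ vs P → T (P (Vec.map α₀ vs)) → T (sat S (cubeEdge (vs , P) (Vec.map α₀ vs)))
        cube-kept⁺ vs P p with P (Vec.map α₀ vs)
        ... | true = satisfied⁺ y S (literals vs (Vec.map α₀ vs)) kept
          where
          kept : ∀ ℓ → T (isYes (sameLiteral? vs (Vec.map α₀ vs) ℓ)) → T (S ℓ)
          kept ℓ t with toWitness {a? = sameLiteral? vs (Vec.map α₀ vs) ℓ} t
          ... | k , var≡ , val≡ = graph-∈ _ _ (sym (Vec.lookup-map k α₀ vs)) var≡ val≡

        -- Only the tuple `Vec.map α₀ vs` can be kept, so the sum over all tuples reduces to the
        -- value of the relation at this one.
        cube-score : ∀ c → ∑ (map (cubeEdge c) (vectors D (suc a))) (ind ∘ sat S) ≡ ind (proj₂ c (Vec.map α₀ (proj₁ c)))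
        cube-score (vs , P) = trans (∑-map (cubeEdge (vs , P)) (vectors D (suc a)) _)
          (trans (∑-cong (vectors D (suc a)) term)
          (trans (∑-* (vectors D (suc a)) (ind (P w)) _) (trans (cong (ind (P w) *_) (∑-vectors D (suc a) w)) (*-identityʳ _))))
          where
          w = Vec.map α₀ vs
          term : ∀ v → ind (sat S (cubeEdge (vs , P) v)) ≡ ind (P w) * ind (isYes (v ≟ᵛ w))
          term v with v ≟ᵛ w
          ... | no v≢w = trans (¬T⇒ind≡0 (v≢w ∘ proj₂ ∘ cube-kept⁻ vs P v)) (sym (*-zeroʳ (ind (P w))))
          ... | yes refl = trans (≤-antisym (ind-mono (proj₁ ∘ cube-kept⁻ vs P w)) (ind-mono (cube-kept⁺ vs P))) (sym (*-identityʳ (ind (P w))))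

        cubeScore≡ : cubeScore S ≡ ∑ constraints (λ c → ind (proj₂ c (Vec.map α₀ (proj₁ c))))
        cubeScore≡ = trans (∑-concatMap _ constraints _) (∑-cong constraints cube-score)

        cubeScore≤ : cubeScore S ≤ C
        cubeScore≤ = ≤-trans (≤-reflexive cubeScore≡) (≤-trans (∑-mono constraints (λ c → ind≤1 (proj₂ c (Vec.map α₀ (proj₁ c))))) (≤-reflexive (sym (length≡∑ constraints))))

        all-satisfied : C ≤ cubeScore S → All (Satisfies α₀) constraints
        all-satisfied C≤ = All.tabulate λ {c} c∈ → case T? (proj₂ c (Vec.map α₀ (proj₁ c))) of λ
          { (yes p) → p
          ; (no ¬p) → contradiction (≤-trans C≤ (≤-reflexive cubeScore≡))
              (<⇒≱ (<-≤-trans (∑-mono< constraints (λ c → ind≤1 (proj₂ c (Vec.map α₀ (proj₁ c)))) c∈ (s≤s (≤-reflexive (¬T⇒ind≡0 ¬p)))) (≤-reflexive (sym (length≡∑ constraints)))))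
          }

        cubeScore≥ : All (Satisfies α₀) constraints → C ≤ cubeScore S
        cubeScore≥ sats = ≤-trans (go sats) (≤-reflexive (sym cubeScore≡))
          where
          go : ∀ {cs} → All (Satisfies α₀) cs → length cs ≤ ∑ cs (λ c → ind (proj₂ c (Vec.map α₀ (proj₁ c))))
          go []       = z≤n
          go (p ∷ ps) = +-mono-≤ (T⇒1≤ind p) (go ps)

        Selects : Fin (suc t) → Set
        Selects i = ∀ k → α (indexVar k) ≡ value (code i k)

        value-injective : ∀ {b c} → value b ≡ value c → b ≡ c
        value-injective {true}  {true}  _  = refl
        value-injective {true}  {false} eq = contradiction eq value-distinct
        value-injective {false} {true}  eq = contradiction (sym eq) value-distinct
        value-injective {false} {false} _  = refl

        selects-unique : ∀ {i j} → Selects i → Selects j → i ≡ j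
        selects-unique {i} {j} si sj = code-injective i j (λ k → value-injective (trans (sym (si k)) (sj k)))

        select-kept⁻ : ∀ i j → T (sat S (selectEdge i j)) → Selects i × α₀ (yv j) ≡ value (y (address i j))
        select-kept⁻ i j t = selects , trans (cong (α ∘ proj₁) (sym rqʸ)) (trans (graph⁻ ℓʸ (kept ℓʸ memberʸ)) (cong proj₂ rqʸ))
          where
          kept = satisfied⁻ y S (selectEdge i j) t
          ℓʸ = combine (cellVar (yv j)) (value (y (address i j)))
          rqʸ : remQuot {N} D ℓʸ ≡ (cellVar (yv j) , value (y (address i j)))
          rqʸ = remQuot-combine {k = D} (cellVar (yv j)) (value (y (address i j)))
          memberʸ : T (bitOf y (selectEdge i j ℓʸ))
          memberʸ = subst (T ∘ bitOf y) (sym (trans (selectEdge-combine i j (cellVar (yv j)) (value (y (address i j))))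
            (cong (λ x → selectSource i j x (value (y (address i j)))) (splitAt-↑ˡ (suc M) (yv j) I)))) (select-own i j (y (address i j)) refl)
          selects : Selects i
          selects k = trans (cong (α ∘ proj₁) (sym rq)) (trans (graph⁻ ℓ (kept ℓ member)) (cong proj₂ rq))
            where
            ℓ = combine (indexVar k) (value (code i k))
            rq : remQuot {N} D ℓ ≡ (indexVar k , value (code i k))
            rq = remQuot-combine {k = D} (indexVar k) (value (code i k))
            member : T (bitOf y (selectEdge i j ℓ))
            member = subst (T ∘ bitOf y) (sym (trans (selectEdge-combine i j (indexVar k) (value (code i k)))
              (cong (λ x → selectSource i j x (value (code i k))) (splitAt-↑ʳ (suc M) I k)))) (fromWitness {a? = value (code i k) Fin.≟ value (code i k)} refl)

        select-kept⁺ : ∀ i j → Selects i → α₀ (yv j) ≡ value (y (address i j)) → T (sat S (selectEdge i j))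
        select-kept⁺ i j si yj = satisfied⁺ y S (selectEdge i j) kept
          where
          kept : ∀ ℓ → T (bitOf y (selectEdge i j ℓ)) → T (S ℓ)
          kept ℓ t with splitAt (suc M) (var ℓ) in eq
          ... | inj₂ k = graph-∈ (indexVar k) (value (code i k)) (si k) (Fin.splitAt⁻¹-↑ʳ eq) (sym (toWitness t))
          ... | inj₁ v with v Fin.≟ yv j
          ...   | yes refl with val ℓ Fin.≟ value true
          ...     | yes vt = graph-∈ (cellVar v) (value (y (address i j))) yj (Fin.splitAt⁻¹-↑ˡ {i = var ℓ} eq) (trans (cong value (is-true t)) (sym vt))
            where
            is-true : ∀ {b} → T b → b ≡ true
            is-true {true} _ = refl
          ...     | no _ with val ℓ Fin.≟ value false
          ...       | yes vf = graph-∈ (cellVar v) (value (y (address i j))) yj (Fin.splitAt⁻¹-↑ˡ {i = var ℓ} eq) (trans (cong value (is-false t)) (sym vf))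
            where
            is-false : ∀ {b} → T (not b) → b ≡ false
            is-false {false} _ = refl

        selectScore≡ : selectScore S ≡ ∑ (allFin n) (λ j → ∑ (allFin (suc t)) (λ i → ind (sat S (selectEdge i j))))
        selectScore≡ = trans (∑-concatMap (λ i → map (selectEdge i) (allFin n)) (allFin (suc t)) (ind ∘ sat S))
          (trans (∑-cong (allFin (suc t)) (λ i → ∑-map (selectEdge i) (allFin n) (ind ∘ sat S))) (∑-swap (allFin (suc t)) (allFin n) (λ i j → ind (sat S (selectEdge i j)))))

        column : Fin n → ℕ
        column j = ∑ (allFin (suc t)) (λ i → ind (sat S (selectEdge i j)))

        -- Two kept sets in a column would mean that the index variables spell the codes of two
        -- inputs, and codes are injective.
        column≤1 : ∀ j → column j ≤ 1
        column≤1 j = ∑-unique (suc t) (λ i → sat S (selectEdge i j))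
          (λ i i′ ti ti′ → selects-unique (proj₁ (select-kept⁻ i j ti)) (proj₁ (select-kept⁻ i′ j ti′)))

        selectScore≤ : selectScore S ≤ n
        selectScore≤ = ≤-trans (≤-reflexive selectScore≡) (≤-trans (∑-mono (allFin n) column≤1) (≤-reflexive (trans (∑-allFin-const n 1) (*-identityʳ n))))

        column-witness : n ≤ selectScore S → ∀ j → ∃[ i ] T (sat S (selectEdge i j))
        column-witness n≤ j with any? (λ i → T? (sat S (selectEdge i j)))
        ... | yes found = found
        ... | no none = contradiction (≤-trans n≤ (≤-reflexive selectScore≡))
              (<⇒≱ (<-≤-trans (∑-mono< (allFin n) column≤1 (∈-allFin j) (s≤s (≤-reflexive column≡0))) (≤-reflexive (trans (∑-allFin-const n 1) (*-identityʳ n)))))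
          where
          column≡0 : column j ≡ 0
          column≡0 = trans (∑-cong (allFin (suc t)) (λ i → ¬T⇒ind≡0 (λ s → none (i , s)))) (trans (∑-allFin-const (suc t) 0) (*-zeroʳ (suc t)))

        selected : n ≤ selectScore S → ∃[ i ] (∀ j → α₀ (yv j) ≡ value (y (address i j)))
        selected n≤ = common (column-witness n≤)
          where
          common : (∀ j → ∃[ i ] T (sat S (selectEdge i j))) → ∃[ i ] (∀ j → α₀ (yv j) ≡ value (y (address i j)))
          common f with any? {n = n} (λ j → yes j)
          -- For `n = 0` there is no bit position from which to read the index, and every index
          -- does.
          ... | no none = zero , λ j → contradiction (j , j) none
          ... | yes (j₀ , _) = proj₁ (f j₀) , λ j → subst (λ i → α₀ (yv j) ≡ value (y (address i j)))
                (selects-unique (proj₁ (select-kept⁻ _ j (proj₂ (f j)))) (proj₁ (select-kept⁻ _ j₀ (proj₂ (f j₀))))) (proj₂ (select-kept⁻ _ j (proj₂ (f j))))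

        selectScore≥ : ∀ i → Selects i → (∀ j → α₀ (yv j) ≡ value (y (address i j))) → n ≤ selectScore S
        selectScore≥ i si yi = begin
          n                              ≡⟨ sym (trans (∑-allFin-const n 1) (*-identityʳ n)) ⟩
          ∑ (allFin n) (λ _ → 1)         ≤⟨ ∑-mono (allFin n) (λ j → ≤-trans (T⇒1≤ind (select-kept⁺ i j si (yi j))) (∑-∈ (λ i → ind (sat S (selectEdge i j))) (∈-allFin i))) ⟩
          ∑ (allFin n) column            ≡⟨ sym selectScore≡ ⟩
          selectScore S                  ∎
          where open ≤-Reasoning

      edge-nonempty : ∀ e → e ∈ edges → ∃[ ℓ ] T (bitOf y (e ℓ))
      edge-nonempty e e∈ = All.lookup (All.++⁺ pairs (All.++⁺ (All.++⁺ cubes selects) (All.++⁺ cubes selects))) e∈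
        where
        Nonempty : Hyperedge → Set
        Nonempty e = ∃[ ℓ ] T (bitOf y (e ℓ))
        some : Fin u
        some = combine {N} {D} zero (value true)
        pairNonempty : ∀ ℓ₁ ℓ₂ → Nonempty (pairEdge ℓ₁ ℓ₂)
        pairNonempty ℓ₁ ℓ₂ with compatible? ℓ₁ ℓ₂
        ... | no _  = some , _
        ... | yes _ = ℓ₁ , T-∨ˡ {isYes (ℓ₁ Fin.≟ ℓ₁)} _ (fromWitness {a? = ℓ₁ Fin.≟ ℓ₁} refl)
          where
          T-∨ˡ : ∀ {a} b → T a → T (a ∨ b)
          T-∨ˡ {true} _ _ = _
        cube : ∀ c v → Nonempty (cubeEdge c v)
        cube (vs , P) v with P v
        ... | false = some , _
        -- The arity `suc a` guarantees a first variable in the scope.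
        ... | true  = combine (cellVar (Vec.lookup vs zero)) (Vec.lookup v zero)
                    , fromWitness {a? = sameLiteral? vs v (combine (cellVar (Vec.lookup vs zero)) (Vec.lookup v zero))}
                        (zero , sym (var-combine _ (Vec.lookup v zero)) , sym (val-combine (cellVar (Vec.lookup vs zero)) _))
        select : ∀ i j → Nonempty (selectEdge i j)
        select i j = combine (cellVar (yv j)) (value (y (address i j)))
          , subst (T ∘ bitOf y) (sym (trans (selectEdge-combine i j (cellVar (yv j)) (value (y (address i j))))
              (cong (λ x → selectSource i j x (value (y (address i j)))) (splitAt-↑ˡ (suc M) (yv j) I)))) (select-own i j (y (address i j)) refl)
        pairs : All Nonempty pairEdges
        pairs = All.concat⁺ (All.map⁺ (All.universal (λ ℓ₁ → All.concat⁺ (All.map⁺ (All.universal (λ ℓ₂ → All.replicate⁺ R (pairNonempty ℓ₁ ℓ₂)) (allFin u)))) (allFin u)))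
        cubes : All Nonempty cubeEdges
        cubes = All.concat⁺ (All.map⁺ (All.universal (λ c → All.map⁺ (All.universal (cube c) (vectors D (suc a)))) constraints))
        selects : All Nonempty selectEdges
        selects = All.concat⁺ (All.map⁺ (All.universal (λ i → All.map⁺ (All.universal (select i) (allFin n))) (allFin (suc t))))

      open Reduction N′ u edges using (V; core; module On)
      open On y (combine {N} {D} zero (value true)) (λ e → edge-nonempty _ (∈-lookup e)) public

      open Firefighting G using (CanSave)

      Solution : Set
      Solution = ∃[ α₀ ] All (Satisfies α₀) constraints × ∃[ i ] (∀ j → α₀ (yv j) ≡ value (y (address i j)))

      solution⇒can-save : Solution → CanSave s (N + goal)
      solution⇒can-save (α₀ , sats , i , yi) =
        Defending.can-save (λ k → combine k (α k)) (λ {k} {l} eq → trans (sym (var-combine k (α k))) (trans (cong var eq) (var-combine l (α l))))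
          S graph⁺ (λ ℓ sℓ → var ℓ , trans (cong (combine (var ℓ)) (graph⁻ ℓ sℓ)) (combine-remQuot {N} D ℓ))
          goal (≤-trans (+-mono-≤ (*-monoʳ-≤ R (graphOf-pairScore α)) (*-monoʳ-≤ 2 (+-mono-≤ (cubeScore≥ sats′) (selectScore≥ i selects yi′)))) (≤-reflexive (sym (score-edges S))))
        where
        α : Fin N → Fin D
        α x = [ α₀ , value ∘ code i ]′ (splitAt (suc M) x)
        S = graphOf α
        open IsGraph (graphOf-isGraph α)
        open OfAssignment (graphOf-isGraph α) using (Selects; cubeScore≥; selectScore≥)
        α-cell : ∀ v → α (cellVar v) ≡ α₀ v
        α-cell v = cong [ α₀ , value ∘ code i ]′ (splitAt-↑ˡ (suc M) v I)
        selects : Selects i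
        selects k = cong [ α₀ , value ∘ code i ]′ (splitAt-↑ʳ (suc M) I k)
        yi′ : ∀ j → α (cellVar (yv j)) ≡ value (y (address i j))
        yi′ j = trans (α-cell (yv j)) (yi j)
        sats′ : All (Satisfies (α ∘ cellVar)) constraints
        sats′ = All.map (λ {c} → subst (T ∘ proj₂ c) (Vec.map-cong (sym ∘ α-cell) (proj₁ c))) sats

      -- `leading-≤` forces all pairs to be kept, which yields an assignment; `remainder-≤` then
      -- gives `C + n ≤ Q`. As the two parts of `Q` are at most `C` and `n`, both bounds are
      -- attained.
      score⇒solution : ∀ S → ∣ Vec.tabulate S ∣ ≤ N → goal ≤ suc (score y S edges) → Solution
      score⇒solution S ∣S∣≤N goal≤ = solution (assignment S small large)
        where
        small : size S ≤ N
        small = ≤-trans (≤-reflexive (sym (card≡∑ u S))) ∣S∣≤N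
        P Q : ℕ
        P = pairScore S
        Q = cubeScore S + selectScore S
        bound : R * (N * N) + 2 * (C + n) ≤ suc (R * P + 2 * Q)
        bound = ≤-trans goal≤ (≤-reflexive (cong suc (score-edges S)))
        score≤length : ∀ es → score y S es ≤ length es
        score≤length es = ≤-trans (∑-mono es (λ e → ind≤1 (sat S e))) (≤-reflexive (sym (length≡∑ es)))
        large : N * N ≤ P
        large = leading-≤ R (length cubeEdges + length selectEdges) (N * N) P Q (2 * (C + n)) refl bound
          (+-mono-≤ (score≤length cubeEdges) (score≤length selectEdges))
        C+n≤Q : C + n ≤ Q
        C+n≤Q = remainder-≤ R (N * N) P Q (C + n) (≤-trans (pairScore≤ S small) (*-mono-≤ small small)) bound
        solution : ∃[ α ] IsGraph S α → Solution
        solution (α , isGraph) = α₀ , all-satisfied (+-cancelʳ-≤ n C (cubeScore S) (≤-trans C+n≤Q (+-monoʳ-≤ (cubeScore S) selectScore≤)))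
                          , selected (+-cancelˡ-≤ C n (selectScore S) (≤-trans C+n≤Q (+-monoˡ-≤ (selectScore S) cubeScore≤)))
          where open OfAssignment isGraph

      can-save⇒solution : CanSave s (N + goal) → Solution
      can-save⇒solution saved = let S , ∣S∣≤N , goal≤ = saved-score goal saved in score⇒solution S ∣S∣≤N goal≤

-- Runs of Turing machines as solutions of local constraints

module Tableaux where
  open Sums
  open AssignmentReduction
  open import Data.Bool.Properties using (T-∧)
  open import Data.Fin.Base using (Fin; zero; suc; toℕ; fromℕ; fromℕ<; inject₁; _↑ˡ_; _↑ʳ_; splitAt; combine; remQuot; pred)
  open import Data.Fin.Properties as Fin using (splitAt-↑ˡ; splitAt-↑ʳ; remQuot-combine; toℕ-inject₁; toℕ-fromℕ<; toℕ-fromℕ; toℕ-injective; toℕ<n)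
  open import Data.Fin.Induction using (<-weakInduction)
  open import Data.Integer.Base using (ℤ; +_; -[1+_])
  open import Data.List.Base as List using (List; []; _∷_; length; _++_; map; concatMap; allFin; applyDownFrom)
  open import Data.List.Properties using (length-++; length-map; length-tabulate)
  open import Data.List.Relation.Unary.All as All using (All; []; _∷_)
  import Data.List.Relation.Unary.All.Properties as All
  open import Data.Nat.Base as ℕ hiding (_⊔_; ∣_-_∣; pred)
  open import Data.Nat.Properties
  open import Data.Sum.Base as Sum using (_⊎_; inj₁; inj₂; [_,_]′)
  import Data.Vec.Base as Vec
  open import Data.Vec.Base using (Vec; []; _∷_)
  import Data.Vec.Properties as Vec

  private variable
    g : ℕ

  nth : List (Symbol g) → ℕ → Symbol g
  nth []       i       = blank
  nth (s ∷ ss) zero    = s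
  nth (s ∷ ss) (suc i) = nth ss i

  -- The head is always at 0, so a move shifts the whole tape. This view also forgets which blanks
  -- happen to be listed.
  cell : Tape g → ℤ → Symbol g
  cell (tape bs c as) (+ zero)  = c
  cell (tape bs c as) (+ suc i) = nth as i
  cell (tape bs c as) -[1+ i ]  = nth bs i

  before after : ℤ → ℤ
  before (+ zero)  = -[1+ 0 ]
  before (+ suc i) = + i
  before -[1+ i ]  = -[1+ suc i ]
  after (+ i)         = + suc i
  after -[1+ zero ]   = + 0
  after -[1+ suc i ]  = -[1+ i ]

  shift : Move → ℤ → ℤ
  shift left  = before
  shift stay  = id
  shift right = after

  cell-move : ∀ m (t : Tape g) z → cell (move m t) z ≡ cell t (shift m z)
  cell-move left  (tape []       c as)       (+ zero)        = refl
  cell-move left  (tape []       c as)       (+ suc zero)    = refl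
  cell-move left  (tape []       c as)       (+ suc (suc i)) = refl
  cell-move left  (tape []       c as)       -[1+ i ]        = refl
  cell-move left  (tape (b ∷ bs) c as)       (+ zero)        = refl
  cell-move left  (tape (b ∷ bs) c as)       (+ suc zero)    = refl
  cell-move left  (tape (b ∷ bs) c as)       (+ suc (suc i)) = refl
  cell-move left  (tape (b ∷ bs) c as)       -[1+ i ]        = refl
  cell-move stay  t                          z               = refl
  cell-move right (tape bs c [])             (+ zero)        = refl
  cell-move right (tape bs c [])             (+ suc i)       = refl
  cell-move right (tape bs c [])             -[1+ zero ]     = refl
  cell-move right (tape bs c [])             -[1+ suc i ]    = refl
  cell-move right (tape bs c (a ∷ as))       (+ zero)        = refl
  cell-move right (tape bs c (a ∷ as))       (+ suc i)       = refl
  cell-move right (tape bs c (a ∷ as))       -[1+ zero ]     = refl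
  cell-move right (tape bs c (a ∷ as))       -[1+ suc i ]    = refl

  override : ℤ → Symbol g → Symbol g → Symbol g
  override (+ zero) w s = w
  override _        w s = s

  cell-act : ∀ w m (t : Tape g) z → cell (act (w , m) t) z ≡ override (shift m z) w (cell t (shift m z))
  cell-act w m (tape bs c as) z = trans (cell-move m (tape bs w as) z) (written (shift m z))
    where
    written : ∀ z → cell (tape bs w as) z ≡ override z w (cell (tape bs c as) z)
    written (+ zero)  = refl
    written (+ suc i) = refl
    written -[1+ i ]  = refl

  cell-current : ∀ (t : Tape g) → cell t (+ 0) ≡ Tape.current t
  cell-current (tape bs c as) = refl

  -- The integer `p - h`: the position `p` of a window as seen from a head at `h`.
  offset : ℕ → ℕ → ℤ
  offset zero    p       = + p
  offset (suc h) zero    = -[1+ h ]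
  offset (suc h) (suc p) = offset h p

  after-offset : ∀ h p → after (offset h p) ≡ offset h (suc p)
  after-offset zero          p       = refl
  after-offset (suc zero)    zero    = refl
  after-offset (suc (suc h)) zero    = refl
  after-offset (suc h)       (suc p) = after-offset h p

  before-offset : ∀ h p → before (offset h (suc p)) ≡ offset h p
  before-offset zero    p       = refl
  before-offset (suc h) zero    = lemma h
    where
    lemma : ∀ h → before (offset h 0) ≡ -[1+ h ]
    lemma zero    = refl
    lemma (suc h) = refl
  before-offset (suc h) (suc p) = before-offset h p

  offset-head : ∀ h → offset h h ≡ + 0
  offset-head zero    = refl
  offset-head (suc h) = offset-head h

  offset-next : ∀ h → offset h (suc h) ≡ + 1
  offset-next zero    = refl
  offset-next (suc h) = offset-next h

  offset-+ : ∀ h i → offset h (h + i) ≡ + i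
  offset-+ zero    i = refl
  offset-+ (suc h) i = offset-+ h i

  isBit : Symbol g → Bool
  isBit (bit _) = true
  isBit _       = false

  -- Acceptance is a condition on two cells only, the scanned one and its right neighbour, so one
  -- constraint of fixed arity can test it.
  leadingBits-true⁻ : ∀ c (as : List (Symbol g)) → leadingBits (c ∷ as) ≡ true ∷ [] → c ≡ bit true × isBit (nth as 0) ≡ false
  leadingBits-true⁻ (bit b) []            refl = refl , refl
  leadingBits-true⁻ (bit b) (blank ∷ as)  refl = refl , refl
  leadingBits-true⁻ (bit b) (aux _ ∷ as)  refl = refl , refl

  leadingBits-true⁺ : ∀ c (as : List (Symbol g)) → c ≡ bit true → isBit (nth as 0) ≡ false → leadingBits (c ∷ as) ≡ true ∷ []
  leadingBits-true⁺ c []           refl _ = refl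
  leadingBits-true⁺ c (blank ∷ as) refl _ = refl
  leadingBits-true⁺ c (aux _ ∷ as) refl _ = refl

  module Steps (M : TuringMachine) where
    open TuringMachine M
    open Execution M public

    -- Halting configurations are repeated, so that every run fills a tableau with the same number
    -- of rows.
    stutter : Configuration → Configuration
    stutter c with step c
    ... | nothing = c
    ... | just c′ = c′

    steps : Configuration → ℕ → Configuration
    steps c zero    = c
    steps c (suc t) = stutter (steps c t)

    steps-stutter : ∀ c t → steps (stutter c) t ≡ steps c (suc t)
    steps-stutter c zero    = refl
    steps-stutter c (suc t) = cong stutter (steps-stutter c t)

    stutter-halted : ∀ {c} → step c ≡ nothing → stutter c ≡ c
    stutter-halted {c} h with step c
    ... | nothing = refl

    stutter-step : ∀ {c c′} → step c ≡ just c′ → stutter c ≡ c′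
    stutter-step {c} h with step c
    stutter-step refl | just _ = refl

    steps-halted : ∀ {c} t → step c ≡ nothing → steps c t ≡ c
    steps-halted zero    h = refl
    steps-halted (suc t) h = trans (cong stutter (steps-halted t h)) (stutter-halted h)

    run⇒steps : ∀ t {c c′} → run t c ≡ just c′ → steps c t ≡ c′ × step c′ ≡ nothing
    run⇒steps t {c} r with step c in eq
    run⇒steps zero    refl | nothing = refl , eq
    run⇒steps (suc t) refl | nothing = steps-halted (suc t) eq , eq
    run⇒steps (suc t) {c} r | just c₁ = let s , h = run⇒steps t r in
      trans (sym (steps-stutter c t)) (trans (cong (λ c → steps c t) (stutter-step eq)) s) , h

    steps⇒run : ∀ t c → step (steps c t) ≡ nothing → run t c ≡ just (steps c t)
    steps⇒run t c h with step c in eq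
    steps⇒run t       c h | nothing = cong just (sym (steps-halted t eq))
    steps⇒run zero    c h | just c₁ = contradiction (trans (sym h) eq) λ ()
    steps⇒run (suc t) c h | just c₁ = trans (steps⇒run t c₁ (subst (λ c → step c ≡ nothing) shift-steps h)) (cong just (sym shift-steps))
      where
      shift-steps : steps c (suc t) ≡ steps c₁ t
      shift-steps = trans (sym (steps-stutter c t)) (cong (λ c → steps c t) (stutter-step eq))

    steps-+ : ∀ c s t → steps c (s + t) ≡ steps (steps c t) s
    steps-+ c zero    t = refl
    steps-+ c (suc s) t = cong stutter (steps-+ c s t)

    run-longer : ∀ {s t c c′} → s ≤ t → run s c ≡ just c′ → steps c t ≡ c′ × step c′ ≡ nothing
    run-longer {s} {t} {c} s≤t r with run⇒steps s r
    ... | st , h = trans (cong (steps c) (sym (m∸n+n≡m s≤t))) (trans (steps-+ c (t ∸ s) s) (trans (cong (λ c → steps c (t ∸ s)) st) (steps-halted (t ∸ s) h))) , h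

    Action : Set
    Action = Maybe (Fin states × Vec (Symbol auxSymbols × Move) (suc workTapes))

    nextState : Action → Fin states → Fin states
    nextState nothing        q = q
    nextState (just (q′ , _)) q = q′

    -- With offsets relative to the head a move changes every cell: `f m` is the old cell that the
    -- move `m` brings to `z`, and it has been overwritten if it was the scanned one.
    nextCell : Action → Fin (suc workTapes) → ℤ → (Move → Symbol auxSymbols) → Symbol auxSymbols
    nextCell nothing         j z f = f stay
    nextCell (just (_ , as)) j z f = let w , m = Vec.lookup as j in override (shift m z) w (f m)

    nextCell-cong : ∀ a j z {f f′ : Move → Symbol auxSymbols} → (∀ m → f m ≡ f′ m) → nextCell a j z f ≡ nextCell a j z f′
    nextCell-cong nothing         j z h = h stay
    nextCell-cong (just (_ , as)) j z h = let w , m = Vec.lookup as j in cong (override (shift m z) w) (h m)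

    symbols : Configuration → Vec (Symbol auxSymbols) (suc workTapes)
    symbols (_ , ts) = Vec.map Tape.current ts

    cellOf : Configuration → Fin (suc workTapes) → ℤ → Symbol auxSymbols
    cellOf (_ , ts) j z = cell (Vec.lookup ts j) z

    stutter-state : ∀ c → proj₁ (stutter c) ≡ nextState (δ (proj₁ c) (symbols c)) (proj₁ c)
    stutter-state (q , ts) with δ q (Vec.map Tape.current ts)
    ... | nothing = refl
    ... | just _  = refl

    stutter-cell : ∀ c j z → cellOf (stutter c) j z ≡ nextCell (δ (proj₁ c) (symbols c)) j z (λ m → cellOf c j (shift m z))
    stutter-cell (q , ts) j z with δ q (Vec.map Tape.current ts)
    ... | nothing = refl
    ... | just (_ , as) = trans (cong (λ t → cell t z) (Vec.lookup-zipWith act j as ts)) (cell-act _ _ (Vec.lookup ts j) z)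

    halted⇔ : ∀ c → step c ≡ nothing → δ (proj₁ c) (symbols c) ≡ nothing
    halted⇔ (q , ts) h with δ q (Vec.map Tape.current ts)
    ... | nothing = refl

    halted⇐ : ∀ c → δ (proj₁ c) (symbols c) ≡ nothing → step c ≡ nothing
    halted⇐ (q , ts) h rewrite h = refl

  module Initial (P : ℕ) where

    -- The three sorts of cells of the initial input tape: separators of `pair` and surrounding
    -- blanks are `fixed`, bits of the input are `free` here since the selected input determines
    -- them, and `witness` cells are guessed.
    data Kind : Set where
      fixed   : Maybe Bool → Kind
      free    : Kind
      witness : Kind

    witnessKind : ℕ → ℕ → Kind
    witnessKind zero    j       = fixed nothing
    witnessKind (suc P) zero    = witness
    witnessKind (suc P) (suc j) = witnessKind P j

    kind : ℕ → ℕ → Kind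
    kind zero    zero          = fixed (just false)
    kind zero    (suc j)       = witnessKind P j
    kind (suc n) zero          = fixed (just true)
    kind (suc n) (suc zero)    = free
    kind (suc n) (suc (suc i)) = kind n i

    symbolOf : Maybe Bool → Symbol g
    symbolOf nothing  = blank
    symbolOf (just b) = bit b

    -- The conditions on a cell c and its left neighbour p: only blanks follow a blank of the witness.
    Ok : Kind → Symbol g → Symbol g → Set
    Ok (fixed s) p c = c ≡ symbolOf s
    Ok free      p c = ⊤
    Ok witness   p c = c ≡ blank ⊎ (T (isBit c) × T (isBit p))

    input : (ℕ → Bool) → ℕ → Word → List (Symbol g)
    input f n w = map bit (pair (applyDownFrom f n , w))

    blanks : ∀ P (d : ℕ → Symbol g) B → d 0 ≡ blank → (∀ j → j < B → Ok (witnessKind P j) (d j) (d (suc j))) →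
             ∀ j → j < B → d (suc j) ≡ blank
    blanks zero    d B       d0 ok j             j<B = ok j j<B
    blanks (suc P) d (suc B) d0 ok zero          _ with ok 0 z<s
    ... | inj₁ d1 = d1
    ... | inj₂ (_ , b) rewrite d0 = ⊥-elim b
    blanks (suc P) d (suc B) d0 ok (suc j) (s≤s j<B) =
      blanks P (d ∘ suc) B (blanks (suc P) d (suc B) d0 ok zero z<s) (λ j j<B → ok (suc j) (s≤s j<B)) j j<B

    -- The witness is the block of bits before the first blank; `blanks` shows that nothing follows
    -- it within the window.
    witnessContent : ∀ P (d : ℕ → Symbol g) B → (∀ j → j < B → Ok (witnessKind P j) (d j) (d (suc j))) →
                     ∃[ w ] length w ≤ P × (∀ j → j < B → d (suc j) ≡ nth (map bit w) j)
    witnessContent zero    d B       ok = [] , z≤n , ok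
    witnessContent (suc P) d zero    ok = [] , z≤n , λ _ ()
    witnessContent {g} (suc P) d (suc B) ok = go (d 1) refl (ok 0 z<s)
      where
      Goal : Set
      Goal = ∃[ w ] length w ≤ suc P × (∀ j → j < suc B → d (suc j) ≡ nth (map bit w) j)
      rest : ∀ j → j < B → Ok (witnessKind P j) (d (suc j)) (d (suc (suc j)))
      rest j j<B = ok (suc j) (s≤s j<B)
      empty : d 1 ≡ blank → Goal
      empty d1 = [] , z≤n , λ { zero _ → d1 ; (suc j) (s≤s j<B) → blanks P (d ∘ suc) B d1 rest j j<B }
      go : (c : Symbol g) → d 1 ≡ c → Ok witness (d 0) (d 1) → Goal
      go blank   d1 _          = empty d1
      go (aux _) d1 (inj₁ d1′) = empty d1′
      go (aux _) d1 (inj₂ (b , _)) rewrite d1 = ⊥-elim b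
      go (bit b) d1 _ with witnessContent P (d ∘ suc) B rest
      ... | w , w≤P , content = b ∷ w , s≤s w≤P , λ { zero _ → d1 ; (suc j) (s≤s j<B) → content j j<B }

    -- d holds the cells from the one before the head on.
    content : ∀ n f (d : ℕ → Symbol g) B → (∀ i → i < B → Ok (kind n i) (d i) (d (suc i))) →
              (∀ a → a < n → d (suc (suc (2 * (n ∸ suc a)))) ≡ bit (f a)) →
              ∃[ w ] length w ≤ P × (∀ i → i < B → d (suc i) ≡ nth (input f n w) i)
    content zero    f d zero    ok bits = [] , z≤n , λ _ ()
    content zero    f d (suc B) ok bits with witnessContent P (d ∘ suc) B (λ j j<B → ok (suc j) (s≤s j<B))
    ... | w , w≤P , rest = w , w≤P , λ { zero _ → ok 0 z<s ; (suc j) (s≤s j<B) → rest j j<B }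
    content (suc n) f d B ok bits with content n f (λ i → d (suc (suc i))) (B ∸ 2) (λ i i<B → ok (suc (suc i)) (in-range i<B)) bits′
      where
      in-range : ∀ {i B} → i < B ∸ 2 → suc (suc i) < B
      in-range {i} {suc (suc B)} i<B = s≤s (s≤s i<B)
      bits′ : ∀ a → a < n → d (suc (suc (suc (suc (2 * (n ∸ suc a)))))) ≡ bit (f a)
      bits′ a a<n = subst (λ i → d (suc (suc i)) ≡ bit (f a)) (trans (cong (2 *_) (+-∸-assoc 1 a<n)) (*-suc 2 (n ∸ suc a))) (bits a (≤-trans a<n (n≤1+n n)))
    ... | w , w≤P , rest = w , w≤P , λ
      { zero i<B → ok 0 i<B
      ; (suc zero) i<B → subst (λ i → d (suc (suc (2 * i))) ≡ bit (f n)) (n∸n≡0 n) (bits n ≤-refl)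
      ; (suc (suc i)) i<B → rest i (∸-monoˡ-≤ 2 i<B)
      }

    witnessOk : ∀ P w (d : ℕ → Symbol g) → length w ≤ P → T (isBit (d 0)) → (∀ j → d (suc j) ≡ nth (map bit w) j) →
                ∀ j → Ok (witnessKind P j) (d j) (d (suc j))
    witnessOk zero    []      d _ d0 same j       = same j
    witnessOk (suc P) []      d _ d0 same zero    = inj₁ (same 0)
    witnessOk (suc P) (b ∷ w) d _ d0 same zero rewrite same 0 = inj₂ (_ , d0)
    witnessOk (suc P) []      d _ d0 same (suc j) = allBlank P j
      where
      allBlank : ∀ P j → Ok (witnessKind P j) (d (suc j)) (d (suc (suc j)))
      allBlank P j = go (witnessKind P j) (same (suc j)) (shape P j)
        where
        shape : ∀ P j → witnessKind P j ≡ witness ⊎ witnessKind P j ≡ fixed nothing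
        shape zero    j       = inj₂ refl
        shape (suc P) zero    = inj₁ refl
        shape (suc P) (suc j) = shape P j
        go : ∀ k {p c} → c ≡ blank → k ≡ witness ⊎ k ≡ fixed nothing → Ok k p c
        go _ eq (inj₁ refl) = inj₁ eq
        go _ eq (inj₂ refl) = eq
    witnessOk (suc P) (b ∷ w) d (s≤s w≤P) d0 same (suc j) = witnessOk P w (d ∘ suc) w≤P (subst (T ∘ isBit) (sym (same 0)) _) (same ∘ suc) j

    contentOk : ∀ n f w (d : ℕ → Symbol g) → length w ≤ P → (∀ i → d (suc i) ≡ nth (input f n w) i) →
                ∀ i → Ok (kind n i) (d i) (d (suc i))
    contentOk zero    f w d w≤P same zero          = same 0
    contentOk zero    f w d w≤P same (suc j)       = witnessOk P w (d ∘ suc) w≤P (subst (T ∘ isBit) (sym (same 0)) _) (same ∘ suc) j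
    contentOk (suc n) f w d w≤P same zero          = same 0
    contentOk (suc n) f w d w≤P same (suc zero)    = _
    contentOk (suc n) f w d w≤P same (suc (suc i)) = contentOk n f w (λ i → d (suc (suc i))) w≤P (λ i → same (suc (suc i))) i

    content-bits : ∀ n f w a → a < n → nth {g} (input f n w) (suc (2 * (n ∸ suc a))) ≡ bit (f a)
    content-bits {g} (suc n) f w a a<1+n with m≤n⇒m<n∨m≡n a<1+n
    ... | inj₂ refl rewrite n∸n≡0 n = refl
    ... | inj₁ (s≤s a<n) = subst (λ i → nth {g} (input f (suc n) w) (suc i) ≡ bit (f a))
          (sym (trans (cong (2 *_) (+-∸-assoc 1 a<n)) (*-suc 2 (n ∸ suc a)))) (content-bits n f w a a<n)

  -- The computation of M on pair (x , w) for some w with at most P bits, where x has n bits, as a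
  -- system of constraints: the cells of a tape are addressed by their offset from the head, so that
  -- the next contents of a cell depend on the state, the scanned symbols, the cell and its two neighbours.
  -- The window has fixed width, and the cells close to its border are not constrained after the start.
  module CookLevin (M : TuringMachine) (K P n : ℕ) where
    open TuringMachine M
    open Steps M
    open Initial P

    D arity H w width sites N₀ : ℕ
    D     = 3 + (auxSymbols + states)
    arity = 4 + suc workTapes
    H     = suc K
    -- The window loses one reliable cell per step at either border. The positions `H` and `H + 1`
    -- read by `acceptConstraint` must survive `K` steps, which needs `K ≤ H` and
    -- `H + 1 + K < width`; `2 * n` makes room for the input bits and their separators.
    w     = suc (K + (K + 2 * n))
    width = 2 + w
    sites = suc (suc workTapes * width)
    N₀    = suc K * sites

    codeSymbol : Symbol auxSymbols → Fin D
    codeSymbol blank       = zero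
    codeSymbol (bit true)  = suc zero
    codeSymbol (bit false) = suc (suc zero)
    codeSymbol (aux i)     = 3 ↑ʳ (i ↑ˡ states)

    codeState : Fin states → Fin D
    codeState q = 3 ↑ʳ (auxSymbols ↑ʳ q)

    -- All variables share one domain, so a cell may carry the code of a state and conversely. Such
    -- values decode to a default, which is harmless because soundness speaks of decoded values
    -- only.
    symbol : Fin D → Symbol auxSymbols
    symbol zero                = blank
    symbol (suc zero)          = bit true
    symbol (suc (suc zero))    = bit false
    symbol (suc (suc (suc r))) = [ aux , (λ _ → blank) ]′ (splitAt auxSymbols r)

    state : Fin D → Fin states
    state (suc (suc (suc r))) = [ (λ _ → start) , id ]′ (splitAt auxSymbols r)
    state _                   = start

    symbol-code : ∀ s → symbol (codeSymbol s) ≡ s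
    symbol-code blank       = refl
    symbol-code (bit true)  = refl
    symbol-code (bit false) = refl
    symbol-code (aux i)     rewrite splitAt-↑ˡ auxSymbols i states = refl

    state-code : ∀ q → state (codeState q) ≡ q
    state-code q rewrite splitAt-↑ʳ auxSymbols states q = refl

    stateVar : Fin (suc K) → Fin N₀
    stateVar τ = combine {suc K} {sites} τ zero

    cellVar : Fin (suc K) → Fin (suc workTapes) → Fin width → Fin N₀
    cellVar τ j p = combine {suc K} {sites} τ (suc (combine j p))

    head<width : suc H < width
    head<width = s≤s (s≤s (s≤s (m≤m+n K _)))

    head : Fin width
    head = fromℕ< (≤-trans (n≤1+n (suc H)) head<width)

    next : Fin width
    next = fromℕ< head<width

    toℕ-head : toℕ head ≡ H
    toℕ-head = toℕ-fromℕ< (≤-trans (n≤1+n (suc H)) head<width)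

    toℕ-next : toℕ next ≡ suc H
    toℕ-next = toℕ-fromℕ< head<width

    -- `applyDownFrom` lists the bit of the largest index first and `pair` puts a separator before
    -- each bit, so bit `a` is at distance `1 + 2 * (n ∸ suc a)` from the head.
    inputPosition< : ∀ a → a < n → suc (H + 2 * (n ∸ suc a)) < width
    inputPosition< a a<n = s≤s (s≤s (s≤s (+-monoʳ-≤ K (begin
      2 * (n ∸ suc a) ≤⟨ *-monoʳ-≤ 2 (m∸n≤m n (suc a)) ⟩
      2 * n           ≤⟨ m≤n+m (2 * n) K ⟩
      K + 2 * n       ∎))))
      where open ≤-Reasoning

    inputVar : Fin n → Fin N₀
    inputVar a = cellVar zero zero (fromℕ< (inputPosition< (toℕ a) (toℕ<n a)))

    Neighbourhood : Set
    Neighbourhood = Vec (Fin D) (suc arity)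

    heads : Fin (suc K) → Vec (Fin N₀) (suc workTapes)
    heads τ = Vec.tabulate (λ j → cellVar τ j head)

    leftOf middle rightOf : Fin w → Fin width
    leftOf  r = inject₁ (inject₁ r)
    middle  r = suc (inject₁ r)
    rightOf r = suc (suc r)

    neighbour : Symbol auxSymbols → Symbol auxSymbols → Symbol auxSymbols → Move → Symbol auxSymbols
    neighbour l m r left  = l
    neighbour l m r stay  = m
    neighbour l m r right = r

    around : (Fin N₀ → Fin D) → Fin K → Fin (suc workTapes) → Fin w → Move → Symbol auxSymbols
    around α τ j r = neighbour (at (leftOf r)) (at (middle r)) (at (rightOf r))
      where
      at : Fin width → Symbol auxSymbols
      at p = symbol (α (cellVar (inject₁ τ) j p))

    toℕ-leftOf : ∀ r → toℕ (leftOf r) ≡ toℕ r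
    toℕ-leftOf r = trans (toℕ-inject₁ (inject₁ r)) (toℕ-inject₁ r)

    toℕ-middle : ∀ r → toℕ (middle r) ≡ suc (toℕ r)
    toℕ-middle r = cong suc (toℕ-inject₁ r)

    stateConstraint : Fin K → Constraint N₀ D (suc arity)
    -- The copies of `stateVar zero` are padding that gives all constraints the same arity.
    stateConstraint τ = (stateVar (suc τ) ∷ stateVar (inject₁ τ) ∷ stateVar zero ∷ stateVar zero ∷ stateVar zero ∷ heads (inject₁ τ)) , R
      where
      R : Neighbourhood → Bool
      R (c ∷ q ∷ _ ∷ _ ∷ _ ∷ ss) = isYes (c Fin.≟ codeState (nextState (δ (state q) (Vec.map symbol ss)) (state q)))

    cellConstraint : Fin K → Fin (suc workTapes) → Fin w → Constraint N₀ D (suc arity)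
    cellConstraint τ j r = (cellVar (suc τ) j (middle r) ∷ stateVar (inject₁ τ) ∷ cellVar (inject₁ τ) j (leftOf r) ∷ cellVar (inject₁ τ) j (middle r)
                            ∷ cellVar (inject₁ τ) j (rightOf r) ∷ heads (inject₁ τ)) , R
      where
      z = offset H (toℕ (middle r))
      R : Neighbourhood → Bool
      R (c ∷ q ∷ l ∷ m ∷ r ∷ ss) = isYes (c Fin.≟ codeSymbol (nextCell (δ (state q) (Vec.map symbol ss)) j z (neighbour (symbol l) (symbol m) (symbol r))))

    startConstraint : Constraint N₀ D (suc arity)
    startConstraint = (stateVar zero ∷ stateVar zero ∷ stateVar zero ∷ stateVar zero ∷ stateVar zero ∷ heads zero) , R
      where
      R : Neighbourhood → Bool
      R (c ∷ _) = isYes (c Fin.≟ codeState start)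

    isBlank : Symbol auxSymbols → Bool
    isBlank blank = true
    isBlank _     = false

    ok? : Kind → Fin D → Fin D → Bool
    ok? (fixed s) p c = isYes (c Fin.≟ codeSymbol (symbolOf s))
    ok? free      p c = true
    ok? witness   p c = isBlank (symbol c) ∨ (isBit (symbol c) ∧ isBit (symbol p))

    kindFrom : ℕ → ℕ → Kind
    kindFrom zero    p       = kind n p
    kindFrom (suc h) zero    = fixed nothing
    kindFrom (suc h) (suc p) = kindFrom h p

    initialKind : Fin (suc workTapes) → Fin width → Kind
    initialKind zero    p = kindFrom H (toℕ p)
    initialKind (suc _) p = fixed nothing

    -- At position 0 `pred` returns the cell itself as its left neighbour. This does no harm: the
    -- cell lies left of the head or on a work tape and is fixed to be blank.
    initialConstraint : Fin (suc workTapes) → Fin width → Constraint N₀ D (suc arity)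
    initialConstraint j p = (cellVar zero j p ∷ stateVar zero ∷ cellVar zero j (pred p) ∷ stateVar zero ∷ stateVar zero ∷ heads zero) , R
      where
      R : Neighbourhood → Bool
      R (c ∷ _ ∷ l ∷ _) = ok? (initialKind j p) l c

    halts : Action → Bool
    halts nothing  = true
    halts (just _) = false

    acceptConstraint : Constraint N₀ D (suc arity)
    acceptConstraint = (stateVar zero ∷ stateVar (fromℕ K) ∷ stateVar zero ∷ stateVar zero ∷ cellVar (fromℕ K) zero next ∷ heads (fromℕ K)) , R
      where
      R : Neighbourhood → Bool
      R (_ ∷ q ∷ _ ∷ _ ∷ r ∷ s ∷ ss) = halts (δ (state q) (Vec.map symbol (s ∷ ss))) ∧ (isYes (s Fin.≟ codeSymbol (bit true)) ∧ not (isBit (symbol r)))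

    constraints : List (Constraint N₀ D (suc arity))
    constraints =
      startConstraint ∷ acceptConstraint ∷
      (map stateConstraint (allFin K) ++
       concatMap (λ j → map (initialConstraint j) (allFin width)) (allFin (suc workTapes)) ++
       concatMap (λ τ → concatMap (λ j → map (cellConstraint τ j) (allFin w)) (allFin (suc workTapes))) (allFin K))

    record AllSatisfied (α : Fin N₀ → Fin D) : Set where
      field
        start-sat   : Satisfies α startConstraint
        accept-sat  : Satisfies α acceptConstraint
        state-sat   : ∀ τ → Satisfies α (stateConstraint τ)
        initial-sat : ∀ j p → Satisfies α (initialConstraint j p)
        cell-sat    : ∀ τ j r → Satisfies α (cellConstraint τ j r)

    all-map⁻ : ∀ {A : Set} {Q : A → Set} m (f : Fin m → A) → All Q (map f (allFin m)) → ∀ i → Q (f i)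
    all-map⁻ m f h i = All.tabulate⁻ (All.map⁻ h) i

    all-map⁺ : ∀ {A : Set} {Q : A → Set} m (f : Fin m → A) → (∀ i → Q (f i)) → All Q (map f (allFin m))
    all-map⁺ m f h = All.map⁺ (All.tabulate⁺ h)

    all-concatMap⁻ : ∀ {A : Set} {Q : A → Set} m (f : Fin m → List A) → All Q (concatMap f (allFin m)) → ∀ i → All Q (f i)
    all-concatMap⁻ m f h i = all-map⁻ m f (All.concat⁻ h) i

    all-concatMap⁺ : ∀ {A : Set} {Q : A → Set} m (f : Fin m → List A) → (∀ i → All Q (f i)) → All Q (concatMap f (allFin m))
    all-concatMap⁺ m f h = All.concat⁺ (all-map⁺ m f h)

    satisfied⁻ : ∀ α → All (Satisfies α) constraints → AllSatisfied α
    satisfied⁻ α (s ∷ a ∷ rest) with All.++⁻ (map stateConstraint (allFin K)) rest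
    ... | st , rest′ with All.++⁻ (concatMap (λ j → map (initialConstraint j) (allFin width)) (allFin (suc workTapes))) rest′
    ...   | ini , cel = record
      { start-sat   = s
      ; accept-sat  = a
      ; state-sat   = all-map⁻ K stateConstraint st
      ; initial-sat = λ j → all-map⁻ width (initialConstraint j) (all-concatMap⁻ (suc workTapes) (λ j → map (initialConstraint j) (allFin width)) ini j)
      ; cell-sat    = λ τ j → all-map⁻ w (cellConstraint τ j) (all-concatMap⁻ (suc workTapes) (λ j → map (cellConstraint τ j) (allFin w))
                        (all-concatMap⁻ K (λ τ → concatMap (λ j → map (cellConstraint τ j) (allFin w)) (allFin (suc workTapes))) cel τ) j)
      }

    satisfied⁺ : ∀ α → AllSatisfied α → All (Satisfies α) constraints
    satisfied⁺ α sat = start-sat ∷ accept-sat ∷ All.++⁺ (all-map⁺ K stateConstraint state-sat) (All.++⁺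
      (all-concatMap⁺ (suc workTapes) (λ j → map (initialConstraint j) (allFin width)) (λ j → all-map⁺ width (initialConstraint j) (initial-sat j)))
      (all-concatMap⁺ K (λ τ → concatMap (λ j → map (cellConstraint τ j) (allFin w)) (allFin (suc workTapes)))
        (λ τ → all-concatMap⁺ (suc workTapes) (λ j → map (cellConstraint τ j) (allFin w)) (λ j → all-map⁺ w (cellConstraint τ j) (cell-sat τ j)))))
      where open AllSatisfied sat

    length-constraints : length constraints ≤ 2 + (K + (suc workTapes * width + K * (suc workTapes * w)))
    length-constraints = s≤s (s≤s (begin
      length (states′ ++ initials ++ cells)                   ≡⟨ trans (length-++ states′) (cong (λ k → length states′ + k) (length-++ initials)) ⟩
      length states′ + (length initials + length cells)       ≤⟨ +-mono-≤ (≤-reflexive (length-family K stateConstraint)) (+-mono-≤ initials≤ cells≤) ⟩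
      K + (suc workTapes * width + K * (suc workTapes * w))   ∎))
      where
      open ≤-Reasoning
      length-family : ∀ {A : Set} m (f : Fin m → A) → length (map f (allFin m)) ≡ m
      length-family m f = trans (length-map f (allFin m)) (length-tabulate {n = m} id)
      blocks : ∀ {A : Set} m (f : Fin m → List A) {c} → (∀ i → length (f i) ≤ c) → length (concatMap f (allFin m)) ≤ m * c
      blocks m f {c} h = ≤-trans (length-concatMap-≤ f (allFin m) h) (≤-reflexive (cong (_* c) (length-tabulate {n = m} id)))
      states′ initials cells : List (Constraint N₀ D (suc arity))
      states′  = map stateConstraint (allFin K)
      initials = concatMap (λ j → map (initialConstraint j) (allFin width)) (allFin (suc workTapes))
      cells    = concatMap (λ τ → concatMap (λ j → map (cellConstraint τ j) (allFin w)) (allFin (suc workTapes))) (allFin K)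
      initials≤ : length initials ≤ suc workTapes * width
      initials≤ = blocks (suc workTapes) (λ j → map (initialConstraint j) (allFin width)) (λ j → ≤-reflexive (length-family width (initialConstraint j)))
      cells≤ : length cells ≤ K * (suc workTapes * w)
      cells≤ = blocks K (λ τ → concatMap (λ j → map (cellConstraint τ j) (allFin w)) (allFin (suc workTapes)))
        (λ τ → blocks (suc workTapes) (λ j → map (cellConstraint τ j) (allFin w)) (λ j → ≤-reflexive (length-family w (cellConstraint τ j))))

    Accepts : Configuration → Set
    Accepts c = step c ≡ nothing × output c ≡ true ∷ []

    module Correct (f : ℕ → Bool) where

      x : Word
      x = applyDownFrom f n

      Accepted : Set
      Accepted = ∃[ v ] length v ≤ P × Accepts (steps (initial (pair (x , v))) K)

      Assignment : Set
      Assignment = ∃[ α ] All (Satisfies α) constraints × (∀ a → α (inputVar a) ≡ codeSymbol (bit (f (toℕ a))))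

      input-cell : ∀ u i → cell (inputTape {auxSymbols} u) (+ i) ≡ nth (map bit u) i
      input-cell []      zero    = refl
      input-cell []      (suc i) = refl
      input-cell (b ∷ u) zero    = refl
      input-cell (b ∷ u) (suc i) = refl

      input-left : ∀ u i → cell (inputTape {auxSymbols} u) -[1+ i ] ≡ blank
      input-left []      i = refl
      input-left (b ∷ u) i = refl

      blank-cell : ∀ z → cell (emptyTape {auxSymbols}) z ≡ blank
      blank-cell (+ zero)  = refl
      blank-cell (+ suc i) = refl
      blank-cell -[1+ i ]  = refl

      module Real (v : Word) where

        at : ℕ → Configuration
        at = steps (initial (pair (x , v)))

        cellAt : ℕ → Fin (suc workTapes) → ℕ → Symbol auxSymbols
        cellAt τ j p = cellOf (at τ) j (offset H p)

        stateAt : ℕ → Fin states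
        stateAt τ = proj₁ (at τ)

        action : ℕ → Action
        action τ = δ (stateAt τ) (symbols (at τ))

        head-symbol : ∀ τ j → Vec.lookup (symbols (at τ)) j ≡ cellAt τ j H
        head-symbol τ j = trans (Vec.lookup-map j Tape.current (proj₂ (at τ)))
          (trans (sym (cell-current (Vec.lookup (proj₂ (at τ)) j))) (cong (cell (Vec.lookup (proj₂ (at τ)) j)) (sym (offset-head H))))

        next-cell : ∀ τ j p → cellAt (suc τ) j (suc p) ≡
                    nextCell (action τ) j (offset H (suc p)) (neighbour (cellAt τ j p) (cellAt τ j (suc p)) (cellAt τ j (suc (suc p))))
        next-cell τ j p = trans (stutter-cell (at τ) j (offset H (suc p))) (nextCell-cong (action τ) j (offset H (suc p)) same)
          where
          same : ∀ m → cellOf (at τ) j (shift m (offset H (suc p))) ≡ neighbour (cellAt τ j p) (cellAt τ j (suc p)) (cellAt τ j (suc (suc p))) m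
          same left  = cong (cellOf (at τ) j) (before-offset H p)
          same stay  = refl
          same right = cong (cellOf (at τ) j) (after-offset H (suc p))

        initial-left : ∀ h p → p < h → cellOf (at 0) zero (offset h p) ≡ blank
        initial-left (suc h) zero    _         = input-left (pair (x , v)) h
        initial-left (suc h) (suc p) (s≤s p<h) = initial-left h p p<h

        initial-right : ∀ i → cellAt 0 zero (H + i) ≡ nth (input f n v) i
        initial-right i = trans (cong (cellOf (at 0) zero) (offset-+ H i)) (input-cell (pair (x , v)) i)

        initial-work : ∀ j p → cellAt 0 (suc j) p ≡ blank
        initial-work j p = trans (cong (λ t → cell t (offset H p)) (Vec.lookup-replicate j emptyTape)) (blank-cell (offset H p))

      kindFrom-right : ∀ h i → kindFrom h (h + i) ≡ kind n i
      kindFrom-right zero    i = refl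
      kindFrom-right (suc h) i = kindFrom-right h i

      kindFrom-left : ∀ h p → p < h → kindFrom h p ≡ fixed nothing
      kindFrom-left (suc h) zero    _         = refl
      kindFrom-left (suc h) (suc p) (s≤s p<h) = kindFrom-left h p p<h

      ok?⇒Ok : ∀ k p c → T (ok? k p c) → Ok k (symbol p) (symbol c)
      ok?⇒Ok (fixed s) p c t = trans (cong symbol (toWitness {a? = c Fin.≟ codeSymbol (symbolOf s)} t)) (symbol-code (symbolOf s))
      ok?⇒Ok free      p c t = _
      ok?⇒Ok witness   p c t with symbol c
      ... | blank = inj₁ refl
      ... | bit b = inj₂ (_ , t)

      Ok⇒ok? : ∀ k p c s → c ≡ codeSymbol s → Ok k (symbol p) s → T (ok? k p c)
      Ok⇒ok? (fixed r) p c s refl refl = fromWitness {a? = codeSymbol s Fin.≟ codeSymbol s} refl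
      Ok⇒ok? free      p c s eq   ok   = _
      Ok⇒ok? witness   p c s refl ok rewrite symbol-code s with s | ok
      ... | blank | inj₁ _ = _
      ... | bit b | inj₂ (_ , t) = t

      -- Total, with 0 as default outside the window, so that the initial tape can be treated as a
      -- function on all of `ℕ`.
      pos : ℕ → Fin width
      pos p with p <? width
      ... | yes p<w = fromℕ< p<w
      ... | no _    = zero

      toℕ-pos : ∀ {p} → p < width → toℕ (pos p) ≡ p
      toℕ-pos {p} p<width with p <? width
      ... | yes p<w = toℕ-fromℕ< p<w
      ... | no p≮w  = contradiction p<width p≮w

      pos-toℕ : ∀ p {q} → toℕ p ≡ q → p ≡ pos q
      pos-toℕ p refl = toℕ-injective (sym (toℕ-pos (toℕ<n p)))

      toℕ-pred : ∀ {m} (p : Fin m) → toℕ (pred p) ≡ ℕ.pred (toℕ p)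
      toℕ-pred zero    = refl
      toℕ-pred (suc p) = toℕ-inject₁ p

      symbols-tabulate : ∀ α τ c → (∀ j → symbol (α (cellVar τ j head)) ≡ Vec.lookup (symbols c) j) →
                         Vec.map symbol (Vec.map α (heads τ)) ≡ symbols c
      symbols-tabulate α τ c h = begin
        Vec.map symbol (Vec.map α (heads τ))                          ≡⟨ sym (Vec.map-∘ symbol α (heads τ)) ⟩
        Vec.map (symbol ∘ α) (heads τ)                                ≡⟨ sym (Vec.tabulate-∘ (symbol ∘ α) (λ j → cellVar τ j head)) ⟩
        Vec.tabulate (λ j → symbol (α (cellVar τ j head)))            ≡⟨ Vec.tabulate-cong h ⟩
        Vec.tabulate (Vec.lookup (symbols c))                         ≡⟨ Vec.tabulate∘lookup (symbols c) ⟩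
        symbols c                                                     ∎
        where open ≡-Reasoning

      module Sound (α : Fin N₀ → Fin D) (sat : AllSatisfied α)
                   (inputs : ∀ a → α (inputVar a) ≡ codeSymbol (bit (f (toℕ a)))) where
        open AllSatisfied sat

        d : ℕ → Symbol auxSymbols
        -- Position `K` is the one just left of the head `H`; `content` expects the cells from there
        -- on.
        d i = symbol (α (cellVar zero zero (pos (K + i))))

        initial-ok : ∀ i → i < width ∸ H → Ok (kind n i) (d i) (d (suc i))
        initial-ok i i<B = subst₂ (Ok (kind n i)) (cong (symbol ∘ α ∘ cellVar zero zero) pred≡) (cong (λ q → symbol (α (cellVar zero zero (pos q)))) (sym (+-suc K i)))
          (subst (λ k → Ok k (symbol (α (cellVar zero zero (pred (pos (H + i)))))) (symbol (α (cellVar zero zero (pos (H + i))))))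
            (trans (cong (kindFrom H) p≡) (kindFrom-right H i))
            (ok?⇒Ok (kindFrom H (toℕ (pos (H + i)))) (α (cellVar zero zero (pred (pos (H + i))))) (α (cellVar zero zero (pos (H + i)))) (initial-sat zero (pos (H + i)))))
          where
          in-range : H + i < width
          in-range = ≤-trans (≤-reflexive (trans (sym (+-suc H i)) (+-comm H (suc i)))) (m≤n∸o⇒m+o≤n (suc i) (s≤s (≤-trans (m≤m+n K _) (≤-trans (n≤1+n _) (n≤1+n _)))) i<B)
            where
            m≤n∸o⇒m+o≤n : ∀ m {n o} → o ≤ n → m ≤ n ∸ o → m + o ≤ n
            m≤n∸o⇒m+o≤n m o≤n h = ≤-trans (+-monoˡ-≤ _ h) (≤-reflexive (m∸n+n≡m o≤n))
          p≡ : toℕ (pos (H + i)) ≡ H + i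
          p≡ = toℕ-pos in-range
          pred≡ : pred (pos (H + i)) ≡ pos (K + i)
          pred≡ = pos-toℕ _ (trans (toℕ-pred (pos (H + i))) (cong ℕ.pred p≡))

        input-bits : ∀ a → a < n → d (suc (suc (2 * (n ∸ suc a)))) ≡ bit (f a)
        input-bits a a<n = trans (cong (symbol ∘ α ∘ cellVar zero zero) (sym (pos-toℕ _ (trans (toℕ-fromℕ< (inputPosition< (toℕ a′) (toℕ<n a′)))
            (trans (cong (λ a → suc (H + 2 * (n ∸ suc a))) a′≡) (sym (trans (+-suc K _) (cong suc (+-suc K _)))))))))
          (trans (cong symbol (inputs a′)) (trans (symbol-code (bit (f (toℕ a′)))) (cong (bit ∘ f) a′≡)))
          where
          a′ = fromℕ< a<n
          a′≡ : toℕ a′ ≡ a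
          a′≡ = toℕ-fromℕ< a<n

        found : ∃[ v ] length v ≤ P × (∀ i → i < width ∸ H → d (suc i) ≡ nth (input f n v) i)
        found = content n f d (width ∸ H) initial-ok input-bits

        v : Word
        v = proj₁ found

        open Real v

        -- A cell is determined only if its whole past cone lies inside the window. One position is
        -- lost at each border per step, hence the two inequalities in `cell-claim`.
        record Claim (τ : Fin (suc K)) : Set where
          field
            state-claim : state (α (stateVar τ)) ≡ stateAt (toℕ τ)
            cell-claim  : ∀ j p → toℕ τ ≤ toℕ p → toℕ p + toℕ τ < width → symbol (α (cellVar τ j p)) ≡ cellAt (toℕ τ) j (toℕ p)

          symbols-claim : Vec.map symbol (Vec.map α (heads τ)) ≡ symbols (at (toℕ τ))
          symbols-claim = symbols-tabulate α τ (at (toℕ τ)) λ j →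
            trans (cell-claim j head (≤-trans τ≤K (≤-trans (n≤1+n K) (≤-reflexive (sym toℕ-head))))
                    (≤-trans (s≤s (+-mono-≤ (≤-reflexive toℕ-head) τ≤K)) (s≤s (s≤s (m≤n⇒m≤1+n (+-monoʳ-≤ K (m≤m+n K (2 * n))))))))
              (trans (cong (cellAt (toℕ τ) j) toℕ-head) (sym (head-symbol (toℕ τ) j)))
            where
            τ≤K : toℕ τ ≤ K
            τ≤K = s≤s⁻¹ (toℕ<n τ)

        initial-claim : Claim zero
        initial-claim = record
          { state-claim = trans (cong state (toWitness {a? = α (stateVar zero) Fin.≟ codeState start} start-sat)) (state-code start)
          ; cell-claim  = cells
          }
          where
          cells : ∀ j p → 0 ≤ toℕ p → toℕ p + 0 < width → symbol (α (cellVar zero j p)) ≡ cellAt 0 j (toℕ p)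
          cells (suc j) p _ _ = trans (ok?⇒Ok (fixed nothing) (α (cellVar zero (suc j) (pred p))) (α (cellVar zero (suc j) p)) (initial-sat (suc j) p)) (sym (initial-work j (toℕ p)))
          cells zero p _ _ with toℕ p <? H
          ... | yes p<H = trans (subst (λ k → Ok k (symbol (α (cellVar zero zero (pred p)))) (symbol (α (cellVar zero zero p)))) (kindFrom-left H (toℕ p) p<H) (ok?⇒Ok _ _ _ (initial-sat zero p)))
                            (sym (initial-left H (toℕ p) p<H))
          ... | no p≮H = trans (cong (symbol ∘ α ∘ cellVar zero zero) (pos-toℕ p (trans (sym H+i) (sym (+-suc K i)))))
                           (trans (proj₂ (proj₂ found) i (∸-monoˡ-< (toℕ<n p) (≮⇒≥ p≮H)))
                           (trans (sym (initial-right i)) (cong (cellAt 0 zero) H+i)))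
            where
            i = toℕ p ∸ H
            H+i : H + i ≡ toℕ p
            H+i = m+[n∸m]≡n (≮⇒≥ p≮H)

        next-claim : ∀ (τ : Fin K) → Claim (inject₁ τ) → Claim (suc τ)
        next-claim τ claim = record { state-claim = states′ ; cell-claim = cells }
          where
          open Claim claim
          e : toℕ (inject₁ τ) ≡ toℕ τ
          e = toℕ-inject₁ τ
          act≡ : δ (state (α (stateVar (inject₁ τ)))) (Vec.map symbol (Vec.map α (heads (inject₁ τ)))) ≡ action (toℕ τ)
          act≡ = trans (cong₂ δ state-claim symbols-claim) (cong action e)
          states′ : state (α (stateVar (suc τ))) ≡ stateAt (suc (toℕ τ))
          states′ = trans (cong state (toWitness {a? = α (stateVar (suc τ)) Fin.≟ _} (state-sat τ)))
            (trans (state-code _) (trans (cong₂ nextState act≡ (trans state-claim (cong stateAt e))) (sym (stutter-state (at (toℕ τ))))))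
          cells-at : ∀ j (r : Fin w) → toℕ τ ≤ toℕ r → suc (suc (toℕ r)) + toℕ τ < width →
                     symbol (α (cellVar (suc τ) j (middle r))) ≡ cellAt (suc (toℕ τ)) j (suc (toℕ r))
          cells-at j r τ≤r r+τ< = trans (cong symbol (toWitness {a? = α (cellVar (suc τ) j (middle r)) Fin.≟ _} (cell-sat τ j r)))
            (trans (symbol-code _) (trans (cong₂ (λ a z → nextCell a j z (around α τ j r)) act≡ (cong (offset H) (toℕ-middle r)))
            (trans (nextCell-cong (action (toℕ τ)) j (offset H (suc (toℕ r))) same) (sym (next-cell (toℕ τ) j (toℕ r))))))
            where
            claim-at : ∀ p {q} → toℕ p ≡ q → toℕ τ ≤ q → q + toℕ τ < width → symbol (α (cellVar (inject₁ τ) j p)) ≡ cellAt (toℕ τ) j q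
            claim-at p refl lo hi = trans (cell-claim j p (subst (_≤ toℕ p) (sym e) lo) (subst (λ t → toℕ p + t < width) (sym e) hi)) (cong (λ t → cellAt t j (toℕ p)) e)
            same : ∀ m → around α τ j r m
                         ≡ neighbour (cellAt (toℕ τ) j (toℕ r)) (cellAt (toℕ τ) j (suc (toℕ r))) (cellAt (toℕ τ) j (suc (suc (toℕ r)))) m
            same left  = claim-at (leftOf r) (toℕ-leftOf r) τ≤r (≤-trans (n≤1+n _) (≤-trans (n≤1+n _) r+τ<))
            same stay  = claim-at (middle r) (toℕ-middle r) (m≤n⇒m≤1+n τ≤r) (≤-trans (n≤1+n _) r+τ<)
            same right = claim-at (rightOf r) refl (m≤n⇒m≤1+n (m≤n⇒m≤1+n τ≤r)) r+τ<
          cells : ∀ j p → suc (toℕ τ) ≤ toℕ p → toℕ p + suc (toℕ τ) < width → symbol (α (cellVar (suc τ) j p)) ≡ cellAt (suc (toℕ τ)) j (toℕ p)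
          cells j (suc p) (s≤s τ≤p) p+τ< = subst₂ (λ p q → symbol (α (cellVar (suc τ) j (suc p))) ≡ cellAt (suc (toℕ τ)) j (suc q)) p≡ r≡
              (cells-at j r (subst (toℕ τ ≤_) (sym r≡) τ≤p) (subst (λ q → suc (suc q) + toℕ τ < width) (sym r≡) (subst (λ k → suc k < width) (+-suc (toℕ p) (toℕ τ)) p+τ<)))
            where
            p<w : toℕ p < w
            p<w = s≤s⁻¹ (≤-trans (s≤s (s≤s (≤-trans (m≤m+n (toℕ p) (toℕ τ)) (≤-reflexive refl)))) (s≤s⁻¹ (subst (λ k → suc k < width) (+-suc (toℕ p) (toℕ τ)) p+τ<)))
            r : Fin w
            r = fromℕ< p<w
            r≡ : toℕ r ≡ toℕ p
            r≡ = toℕ-fromℕ< p<w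
            p≡ : inject₁ r ≡ p
            p≡ = toℕ-injective (trans (toℕ-inject₁ r) r≡)

        final-claim : Claim (fromℕ K)
        final-claim = <-weakInduction Claim initial-claim next-claim (fromℕ K)

        accepts : Accepts (at K)
        accepts = halted⇐ (at K) halted , accepted
          where
          open Claim final-claim
          e : toℕ (fromℕ K) ≡ K
          e = toℕ-fromℕ K
          accept-parts = Equivalence.to (T-∧ {halts (δ (state (α (stateVar (fromℕ K)))) (Vec.map symbol (Vec.map α (heads (fromℕ K)))))}) accept-sat
          output-parts = Equivalence.to (T-∧ {isYes (α (cellVar (fromℕ K) zero head) Fin.≟ codeSymbol (bit true))}) (proj₂ accept-parts)
          halts⁻ : ∀ a → T (halts a) → a ≡ nothing
          halts⁻ nothing _ = refl
          not⁻ : ∀ {b} → T (not b) → b ≡ false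
          not⁻ {false} _ = refl
          halted : action K ≡ nothing
          halted = trans (sym (cong₂ δ (trans state-claim (cong stateAt e)) (trans symbols-claim (cong (symbols ∘ at) e)))) (halts⁻ _ (proj₁ accept-parts))
          head≡ : cellAt K zero H ≡ bit true
          head≡ = trans (sym (trans (cell-claim zero head (≤-trans (≤-reflexive e) (≤-trans (n≤1+n K) (≤-reflexive (sym toℕ-head))))
                      (≤-trans (s≤s (+-mono-≤ (≤-reflexive toℕ-head) (≤-reflexive e))) (s≤s (s≤s (m≤n⇒m≤1+n (+-monoʳ-≤ K (m≤m+n K (2 * n))))))))
                    (cong₂ (λ t p → cellAt t zero p) e toℕ-head)))
                  (cong symbol (toWitness {a? = α (cellVar (fromℕ K) zero head) Fin.≟ codeSymbol (bit true)} (proj₁ output-parts)))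
          next≡ : isBit (cellAt K zero (suc H)) ≡ false
          next≡ = trans (cong isBit (sym (trans (cell-claim zero next (≤-trans (≤-reflexive e) (≤-trans (n≤1+n K) (≤-trans (n≤1+n H) (≤-reflexive (sym toℕ-next)))))
                      (≤-trans (s≤s (+-mono-≤ (≤-reflexive toℕ-next) (≤-reflexive e))) (s≤s (s≤s (s≤s (+-monoʳ-≤ K (m≤m+n K (2 * n))))))))
                    (cong₂ (λ t p → cellAt t zero p) e toℕ-next))))
                  (not⁻ (proj₂ output-parts))
          accepted : output (at K) ≡ true ∷ []
          accepted with at K | head≡ | next≡
          ... | q , tape bs c as ∷ ts | h | nx = leadingBits-true⁺ c as (trans (cong (cell (tape bs c as)) (sym (offset-head K))) h) (trans (cong (isBit ∘ cell (tape bs c as)) (sym (offset-next K))) nx)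

      module Complete (v : Word) (v≤P : length v ≤ P) (accepting : Accepts (steps (initial (pair (x , v))) K)) where
        open Real v

        value : Fin (suc K) → Fin sites → Fin D
        value τ zero    = codeState (stateAt (toℕ τ))
        value τ (suc r) = let j , p = remQuot {suc workTapes} width r in codeSymbol (cellAt (toℕ τ) j (toℕ p))

        α : Fin N₀ → Fin D
        α i = uncurry value (remQuot {suc K} sites i)

        α-state : ∀ τ → α (stateVar τ) ≡ codeState (stateAt (toℕ τ))
        α-state τ = cong (uncurry value) (remQuot-combine {suc K} {sites} τ zero)

        α-cell : ∀ τ j p → α (cellVar τ j p) ≡ codeSymbol (cellAt (toℕ τ) j (toℕ p))
        α-cell τ j p = trans (cong (uncurry value) (remQuot-combine {suc K} {sites} τ (suc (combine j p))))
          (cong (λ r → codeSymbol (cellAt (toℕ τ) (proj₁ r) (toℕ (proj₂ r)))) (remQuot-combine {suc workTapes} {width} j p))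

        α-cell′ : ∀ τ j p {t q} → toℕ τ ≡ t → toℕ p ≡ q → symbol (α (cellVar τ j p)) ≡ cellAt t j q
        α-cell′ τ j p refl refl = trans (cong symbol (α-cell τ j p)) (symbol-code _)

        α-symbols : ∀ τ {t} → toℕ τ ≡ t → Vec.map symbol (Vec.map α (heads τ)) ≡ symbols (at t)
        α-symbols τ {t} e = symbols-tabulate α τ (at t) (λ j → trans (α-cell′ τ j head e toℕ-head) (sym (head-symbol t j)))

        α-action : ∀ τ {t} → toℕ τ ≡ t → δ (state (α (stateVar τ))) (Vec.map symbol (Vec.map α (heads τ))) ≡ action t
        α-action τ refl = cong₂ δ (trans (cong state (α-state τ)) (state-code _)) (α-symbols τ refl)

        α-initial : ∀ j p → T (ok? (initialKind j p) (α (cellVar zero j (pred p))) (α (cellVar zero j p)))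
        α-initial (suc j) p = Ok⇒ok? (fixed nothing) (α (cellVar zero (suc j) (pred p))) (α (cellVar zero (suc j) p)) (cellAt 0 (suc j) (toℕ p)) (α-cell zero (suc j) p) (initial-work j (toℕ p))
        α-initial zero p = Ok⇒ok? (kindFrom H (toℕ p)) (α (cellVar zero zero (pred p))) (α (cellVar zero zero p)) (cellAt 0 zero (toℕ p)) (α-cell zero zero p) (okay (toℕ p <? H))
          where
          okay : Dec (toℕ p < H) → Ok (kindFrom H (toℕ p)) (symbol (α (cellVar zero zero (pred p)))) (cellAt 0 zero (toℕ p))
          okay (yes p<H) = subst (λ k → Ok k (symbol (α (cellVar zero zero (pred p)))) (cellAt 0 zero (toℕ p))) (sym (kindFrom-left H (toℕ p) p<H)) (initial-left H (toℕ p) p<H)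
          okay (no p≮H) = subst₂ (λ k c → Ok k (symbol (α (cellVar zero zero (pred p)))) c)
              (trans (sym (kindFrom-right H i)) (cong (kindFrom H) H+i)) (cong (cellAt 0 zero) (trans (+-suc K i) H+i))
              (subst (λ c → Ok (kind n i) c (cellAt 0 zero (K + suc i))) (sym (α-cell′ zero zero (pred p) refl (trans (toℕ-pred p) (cong ℕ.pred (sym H+i)))))
                (contentOk n f v (λ i → cellAt 0 zero (K + i)) v≤P (λ i → trans (cong (cellAt 0 zero) (+-suc K i)) (initial-right i)) i))
            where
            i = toℕ p ∸ H
            H+i : H + i ≡ toℕ p
            H+i = m+[n∸m]≡n (≮⇒≥ p≮H)

        allSatisfied : AllSatisfied α
        allSatisfied = record
          { start-sat   = fromWitness {a? = α (stateVar zero) Fin.≟ codeState start} (α-state zero)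
          ; accept-sat  = accept
          ; state-sat   = λ τ → fromWitness {a? = α (stateVar (suc τ)) Fin.≟ _} (trans (α-state (suc τ)) (cong codeState (trans (stutter-state (at (toℕ τ)))
                            (sym (cong₂ nextState (α-action (inject₁ τ) (toℕ-inject₁ τ)) (trans (cong state (α-state (inject₁ τ))) (trans (state-code _) (cong stateAt (toℕ-inject₁ τ)))))))))
          ; initial-sat = α-initial
          ; cell-sat    = cells
          }
          where
          cells : ∀ τ j r → Satisfies α (cellConstraint τ j r)
          cells τ j r = fromWitness {a? = α (cellVar (suc τ) j (middle r)) Fin.≟ _} (trans (α-cell (suc τ) j (middle r)) (cong codeSymbol
              (trans (cong (cellAt (suc (toℕ τ)) j) (toℕ-middle r)) (trans (next-cell (toℕ τ) j (toℕ r)) (trans (nextCell-cong (action (toℕ τ)) j (offset H (suc (toℕ r))) (λ m → sym (same m)))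
                (cong₂ (λ a z → nextCell a j z (around α τ j r))
                  (sym (α-action (inject₁ τ) (toℕ-inject₁ τ))) (cong (offset H) (sym (toℕ-middle r)))))))))
            where
            same : ∀ m → around α τ j r m
                         ≡ neighbour (cellAt (toℕ τ) j (toℕ r)) (cellAt (toℕ τ) j (suc (toℕ r))) (cellAt (toℕ τ) j (suc (suc (toℕ r)))) m
            same left  = α-cell′ (inject₁ τ) j (leftOf r) (toℕ-inject₁ τ) (toℕ-leftOf r)
            same stay  = α-cell′ (inject₁ τ) j (middle r) (toℕ-inject₁ τ) (toℕ-middle r)
            same right = α-cell′ (inject₁ τ) j (rightOf r) (toℕ-inject₁ τ) refl
          scanned : cellAt K zero H ≡ bit true × isBit (cellAt K zero (suc H)) ≡ false
          scanned with at K | proj₂ accepting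
          ... | q , tape bs c as ∷ ts | out = let h , nx = leadingBits-true⁻ c as out in
            trans (cong (cell (tape bs c as)) (offset-head K)) h , trans (cong (isBit ∘ cell (tape bs c as)) (offset-next K)) nx
          accept : Satisfies α acceptConstraint
          accept = Equivalence.from T-∧
            ( subst (T ∘ halts) (sym (trans (α-action (fromℕ K) (toℕ-fromℕ K)) (halted⇔ (at K) (proj₁ accepting)))) _
            , Equivalence.from T-∧
              ( fromWitness {a? = α (cellVar (fromℕ K) zero head) Fin.≟ codeSymbol (bit true)}
                  (trans (α-cell (fromℕ K) zero head) (cong codeSymbol (trans (cong₂ (λ t p → cellAt t zero p) (toℕ-fromℕ K) toℕ-head) (proj₁ scanned))))
              , subst (T ∘ not) (sym (trans (cong isBit (α-cell′ (fromℕ K) zero next (toℕ-fromℕ K) toℕ-next)) (proj₂ scanned))) _))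

        inputs : ∀ a → α (inputVar a) ≡ codeSymbol (bit (f (toℕ a)))
        inputs a = trans (α-cell zero zero (fromℕ< (inputPosition< (toℕ a) (toℕ<n a)))) (cong codeSymbol (trans (cong (cellAt 0 zero) (trans (toℕ-fromℕ< (inputPosition< (toℕ a) (toℕ<n a))) (sym (+-suc H _))))
          (trans (initial-right (suc (2 * (n ∸ suc (toℕ a))))) (content-bits n f v (toℕ a) (toℕ<n a)))))

      accepted⇔assignment : Accepted ⇔ Assignment
      accepted⇔assignment = mk⇔
        (λ (v , v≤P , acc) → let open Complete v v≤P acc in α , satisfied⁺ α allSatisfied , inputs)
        (λ (α , sat , inputs) → let open Sound α (satisfied⁻ α sat) inputs in v , proj₁ (proj₂ found) , accepts)

-- A Turing machine that interprets straight-line programs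

module Interpreters where
  open FirefighterReduction using (Source; const; literal; bitOf)
  open Tableaux
  open import Data.Bool.Properties using (T-∧; ∧-assoc; ∨-assoc; ∧-identityʳ; ∨-identityʳ)
  open import Data.Fin.Base using (Fin; zero; suc; toℕ; fromℕ<; combine; remQuot; splitAt; join)
  open import Data.Fin using (#_)
  open import Data.Fin.Properties using (splitAt-join; remQuot-combine)
  open import Data.Integer.Base using (ℤ; +_; -[1+_])
  open import Data.List.Base as List using (List; []; _∷_; [_]; length; _++_; map; concatMap; replicate; reverse; foldl)
  open import Data.Bool.ListAction using (any; all)
  open import Data.List.Properties using (++-assoc; map-++; unfold-reverse; ++-identityʳ; foldl-++; reverse-map; reverse-involutive)
  open import Data.Maybe.Base as Maybe using (Maybe; just; nothing)
  open import Data.Nat.Base using (ℕ; zero; suc; _+_; _*_; _∸_; _≤_; _<_; s≤s)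
  open import Data.Nat.Properties
  open import Data.Sum.Base as Sum using (_⊎_; inj₁; inj₂)
  import Data.Vec.Base as Vec
  open import Data.Vec.Base using (Vec; []; _∷_)
  import Data.Vec.Properties as Vec

  -- Machine states are elements of `Fin`; a retraction onto a structured type suffices to let such
  -- a type serve as control.
  record Finite (A : Set) : Set where
    field
      cardinality : ℕ
      to          : A → Fin cardinality
      from        : Fin cardinality → A
      from-to     : ∀ a → from (to a) ≡ a

  open Finite

  finiteFin : ∀ n → Finite (Fin n)
  finiteFin n = record { cardinality = n ; to = id ; from = id ; from-to = λ _ → refl }

  finiteBool : Finite Bool
  finiteBool = record
    { cardinality = 2
    ; to          = λ { true → zero ; false → suc zero }
    ; from        = λ { zero → true ; (suc _) → false }
    ; from-to     = λ { true → refl ; false → refl }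
    }

  _×ᶠ_ : ∀ {A B} → Finite A → Finite B → Finite (A × B)
  F ×ᶠ G = record
    { cardinality = cardinality F * cardinality G
    ; to          = λ (a , b) → combine (to F a) (to G b)
    ; from        = λ i → let j , k = remQuot (cardinality G) i in from F j , from G k
    ; from-to     = λ (a , b) → trans (cong (λ (j , k) → from F j , from G k) (remQuot-combine {k = cardinality G} (to F a) (to G b)))
                                  (cong₂ _,_ (from-to F a) (from-to G b))
    }

  _⊎ᶠ_ : ∀ {A B} → Finite A → Finite B → Finite (A ⊎ B)
  F ⊎ᶠ G = record
    { cardinality = cardinality F + cardinality G
    ; to          = join (cardinality F) (cardinality G) ∘ Sum.map (to F) (to G)
    ; from        = Sum.map (from F) (from G) ∘ splitAt (cardinality F)
    ; from-to     = λ
      { (inj₁ a) → trans (cong (Sum.map (from F) (from G)) (splitAt-join (cardinality F) (cardinality G) (inj₁ (to F a)))) (cong inj₁ (from-to F a))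
      ; (inj₂ b) → trans (cong (Sum.map (from F) (from G)) (splitAt-join (cardinality F) (cardinality G) (inj₂ (to G b)))) (cong inj₂ (from-to G b))
      }
    }

  private variable
    g : ℕ

  -- Walking beyond the listed cells and back leaves explicit blanks, so tapes are restored only
  -- cell by cell. A record rather than a function type lets the two tapes be inferred.
  record _≈_ {g} (t t′ : Tape g) : Set where
    constructor cellwise
    field same : ∀ z → cell t z ≡ cell t′ z

  open _≈_

  ≈-refl : ∀ {t : Tape g} → t ≈ t
  ≈-refl = cellwise λ z → refl

  ≈-trans : ∀ {t t′ t″ : Tape g} → t ≈ t′ → t′ ≈ t″ → t ≈ t″
  ≈-trans p q = cellwise λ z → trans (same p z) (same q z)

  current-cong : ∀ {t t′ : Tape g} → t ≈ t′ → Tape.current t ≡ Tape.current t′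
  current-cong {t = t} {t′} p = trans (sym (cell-current t)) (trans (same p (+ 0)) (cell-current t′))

  move-cong : ∀ m {t t′ : Tape g} → t ≈ t′ → move m t ≈ move m t′
  move-cong m {t} {t′} p = cellwise λ z → trans (cell-move m t z) (trans (same p (shift m z)) (sym (cell-move m t′ z)))

  moves : ℕ → Move → Tape g → Tape g
  moves zero    m t = t
  moves (suc k) m t = moves k m (move m t)

  shifts : ℕ → Move → ℤ → ℤ
  shifts zero    m z = z
  shifts (suc k) m z = shift m (shifts k m z)

  cell-moves : ∀ k m (t : Tape g) z → cell (moves k m t) z ≡ cell t (shifts k m z)
  cell-moves zero    m t z = refl
  cell-moves (suc k) m t z = trans (cell-moves k m (move m t) z) (cell-move m t (shifts k m z))

  shifts-shift : ∀ k m z → shifts k m (shift m z) ≡ shift m (shifts k m z)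
  shifts-shift zero    m z = refl
  shifts-shift (suc k) m z = cong (shift m) (shifts-shift k m z)

  before-after : ∀ z → before (after z) ≡ z
  before-after (+ i)         = refl
  before-after -[1+ zero ]   = refl
  before-after -[1+ suc i ]  = refl

  after-before : ∀ z → after (before z) ≡ z
  after-before (+ zero)     = refl
  after-before (+ suc i)    = refl
  after-before -[1+ i ]     = refl

  shifts-left-right : ∀ k z → shifts k left (shifts k right z) ≡ z
  shifts-left-right zero    z = refl
  shifts-left-right (suc k) z = trans (sym (shifts-shift k left _)) (trans (cong (shifts k left) (before-after (shifts k right z))) (shifts-left-right k z))

  shifts-right-left : ∀ k z → shifts k right (shifts k left z) ≡ z
  shifts-right-left zero    z = refl
  shifts-right-left (suc k) z = trans (sym (shifts-shift k right _)) (trans (cong (shifts k right) (after-before (shifts k left z))) (shifts-right-left k z))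

  moves-right-left : ∀ k (t : Tape g) → moves k right (moves k left t) ≈ t
  moves-right-left k t = cellwise λ z → trans (cell-moves k right (moves k left t) z) (trans (cell-moves k left t (shifts k right z)) (cong (cell t) (shifts-left-right k z)))

  moves-left-right : ∀ k (t : Tape g) → moves k left (moves k right t) ≈ t
  moves-left-right k t = cellwise λ z → trans (cell-moves k left (moves k right t) z) (trans (cell-moves k right t (shifts k left z)) (cong (cell t) (shifts-right-left k z)))

  shifts-left-0 : ∀ k → shifts (suc k) left (+ 0) ≡ -[1+ k ]
  shifts-left-0 zero    = refl
  shifts-left-0 (suc k) = cong before (shifts-left-0 k)

  current-left : ∀ k (t : Tape g) → Tape.current (moves (suc k) left t) ≡ cell t -[1+ k ]
  current-left k t = trans (sym (cell-current (moves (suc k) left t))) (trans (cell-moves (suc k) left t (+ 0)) (cong (cell t) (shifts-left-0 k)))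

  asBit : Symbol g → Bool
  asBit (bit b) = b
  asBit _       = false

  isBitOf : Bool → Symbol g → Bool
  isBitOf true  (bit b) = b
  isBitOf false (bit b) = not b
  isBitOf _     _       = false

  sameBit : Bool → Bool → Bool
  sameBit true  b = b
  sameBit false b = not b

  -- Stored words lie to the left of a head that scans a blank, so bit `a` is `a + 1` moves away.
  bitLeft : Tape g → ℕ → Bool
  bitLeft t a = asBit (cell t -[1+ a ])

  -- The accumulator `e` plays the role of the flag `equal`, so this is what the compiled comparison
  -- computes while the head walks right. The final test excludes a longer block of bits.
  matches : Bool → Word → Tape g → Bool
  matches e []      t = e ∧ not (isBit (Tape.current t))
  matches e (b ∷ z) t = matches (e ∧ isBitOf b (Tape.current t)) z (move right t)

  matches-cong : ∀ e z {t t′ : Tape g} → t ≈ t′ → matches e z t ≡ matches e z t′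
  matches-cong e []      p = cong (λ s → e ∧ not (isBit s)) (current-cong p)
  matches-cong e (b ∷ z) p = trans (cong (λ s → matches (e ∧ isBitOf b s) z _) (current-cong p)) (matches-cong _ z (move-cong right p))

  matches⁻ : ∀ e z (t : Tape g) → T (matches e z t) → T e × outputOf t ≡ z
  matches⁻ e [] (tape bs c as) m with Equivalence.to (T-∧ {e}) m
  ... | te , nb = te , none c nb
    where
    none : ∀ c → T (not (isBit c)) → leadingBits (c ∷ as) ≡ []
    none blank   _ = refl
    none (aux _) _ = refl
  matches⁻ e (b ∷ z) (tape bs c as) m with matches⁻ (e ∧ isBitOf b c) z (move right (tape bs c as)) m
  ... | te∧ , out with Equivalence.to (T-∧ {e}) te∧
  ...   | te , is = te , first b c is as out
    where
    next : ∀ as → outputOf (move right (tape bs c as)) ≡ leadingBits as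
    next []       = refl
    next (a ∷ as) = refl
    first : ∀ b c′ → T (isBitOf b c′) → ∀ as → outputOf (move right (tape bs c as)) ≡ z → leadingBits (c′ ∷ as) ≡ b ∷ z
    first true  (bit true)  _ as o = cong (true ∷_)  (trans (sym (next as)) o)
    first false (bit false) _ as o = cong (false ∷_) (trans (sym (next as)) o)

  matches⁺ : ∀ e z (t : Tape g) → T e → outputOf t ≡ z → T (matches e z t)
  matches⁺ e []      (tape bs (bit _) as) te ()
  matches⁺ e []      (tape bs blank as)   te _ = Equivalence.from T-∧ (te , _)
  matches⁺ e []      (tape bs (aux _) as) te _ = Equivalence.from T-∧ (te , _)
  matches⁺ e (b ∷ z) (tape bs (bit b) as) te refl = matches⁺ (e ∧ isBitOf b (bit b)) z _ (Equivalence.from T-∧ (te , is b)) (next as)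
    where
    is : ∀ b → T (isBitOf {g} b (bit b))
    is true  = _
    is false = _
    next : ∀ as → outputOf (move right (tape bs (bit b) as)) ≡ leadingBits as
    next []       = refl
    next (a ∷ as) = refl

  -- The default agrees with `asBit` on blanks, so a witness of any length describes a full tuple of
  -- inputs, exactly the one that the machine reads.
  nthBit : Word → ℕ → Bool
  nthBit []       i       = false
  nthBit (b ∷ bs) zero    = b
  nthBit (b ∷ bs) (suc i) = nthBit bs i

  agrees : (ℕ → Bool) → (ℕ → Bool) → ℕ × ℕ → Bool
  agrees x y (a , c) = sameBit (x a) (y c)

  -- A machine that executes straight-line programs on its own tapes and on those of a machine K.
  -- A program may depend on the length of the input, so all loops and address computations happen when the program is written.

  data Op : Set where
    leftX rightX leftW rightW leftK rightK : Op
    reset compare recordInput recordOutput : Op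
    emit emitW                             : Bool → Op
    emitFirst stepK checkEnd               : Op
    check                                  : Bool → Op

  opcode : Op → Fin 19
  opcode leftX         = # 0
  opcode rightX        = # 1
  opcode leftW         = # 2
  opcode rightW        = # 3
  opcode leftK         = # 4
  opcode rightK        = # 5
  opcode reset         = # 6
  opcode compare       = # 7
  opcode recordInput   = # 8
  opcode recordOutput  = # 9
  opcode (emit true)   = # 10
  opcode (emit false)  = # 11
  opcode (emitW true)  = # 12
  opcode (emitW false) = # 13
  opcode emitFirst     = # 14
  opcode stepK         = # 15
  opcode checkEnd      = # 16
  opcode (check true)  = # 17
  opcode (check false) = # 18

  operation : Fin 19 → Op
  operation = Vec.lookup (leftX ∷ rightX ∷ leftW ∷ rightW ∷ leftK ∷ rightK ∷ reset ∷ compare ∷ recordInput ∷ recordOutput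
    ∷ emit true ∷ emit false ∷ emitW true ∷ emitW false ∷ emitFirst ∷ stepK ∷ checkEnd ∷ check true ∷ check false ∷ [])

  -- Codes are at most 18, so the wrap-around does not occur within the code of an operation.
  successor : Fin 19 → Fin 19
  successor i with suc (toℕ i) <? 19
  ... | yes i<19 = fromℕ< i<19
  ... | no _     = zero

  -- Unary codes can be decoded by the finite control: it counts on `false` and executes on `true`.
  opBits : Op → Word
  opBits o = replicate (toℕ (opcode o)) false ++ true ∷ []

  programBits : List Op → Word
  programBits = concatMap opBits

  module Interpreter (K : TuringMachine) where
    open TuringMachine K renaming (auxSymbols to s; workTapes to k; states to #states; start to start; δ to δᴷ)
    module KS = Steps K

    record State : Set where
      constructor ⟨_,_,_,_,_,_,_,_⟩
      field
        X W K₀ : Tape s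
        Kₛ     : Vec (Tape s) k
        q      : Fin #states
        equal inputFound outputFound : Bool

    open State

    setK : KS.Configuration → State → State
    setK (q′ , t ∷ ts) v = record v { K₀ = t ; Kₛ = ts ; q = q′ }

    exec : Op → State → State
    exec leftX        v = record v { X = move left (X v) }
    exec rightX       v = record v { X = move right (X v) }
    exec leftW        v = record v { W = move left (W v) }
    exec rightW       v = record v { W = move right (W v) }
    exec leftK        v = record v { K₀ = move left (K₀ v) }
    exec rightK       v = record v { K₀ = move right (K₀ v) }
    exec reset        v = record v { equal = true }
    exec compare      v = record v { equal = equal v ∧ sameBit (asBit (Tape.current (X v))) (asBit (Tape.current (W v))) }
    exec recordInput  v = record v { inputFound = inputFound v ∨ equal v }
    exec recordOutput v = record v { outputFound = outputFound v ∨ equal v }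
    exec (emit b)     v = record v { K₀ = act (bit b , left) (K₀ v) }
    exec (emitW b)    v = record v { K₀ = act (bit (sameBit b (asBit (Tape.current (W v)))) , left) (K₀ v) }
    exec emitFirst    v = record v { K₀ = act (bit true , stay) (K₀ v) }
    exec stepK        v = setK (KS.stutter (q v , K₀ v ∷ Kₛ v)) v
    exec checkEnd     v = record v { equal = equal v ∧ not (isBit (Tape.current (K₀ v))) }
    exec (check b)    v = record v { equal = equal v ∧ isBitOf b (Tape.current (K₀ v)) }

    execs : List Op → State → State
    execs os v = foldl (λ v o → exec o v) v os

    execBit : Bool → Fin 19 × State → Fin 19 × State
    execBit false (r , v) = successor r , v
    execBit true  (r , v) = zero , exec (operation r) v

    execBits : Word → Fin 19 × State → Fin 19 × State
    execBits []       rv = rv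
    execBits (b ∷ bs) rv = execBits bs (execBit b rv)

    execBits-++ : ∀ bs cs rv → execBits (bs ++ cs) rv ≡ execBits cs (execBits bs rv)
    execBits-++ []       cs rv = refl
    execBits-++ (b ∷ bs) cs rv = execBits-++ bs cs (execBit b rv)

    execBits-op : ∀ o v → execBits (opBits o) (zero , v) ≡ (zero , exec o v)
    execBits-op leftX         v = refl
    execBits-op rightX        v = refl
    execBits-op leftW         v = refl
    execBits-op rightW        v = refl
    execBits-op leftK         v = refl
    execBits-op rightK        v = refl
    execBits-op reset         v = refl
    execBits-op compare       v = refl
    execBits-op recordInput   v = refl
    execBits-op recordOutput  v = refl
    execBits-op (emit true)   v = refl
    execBits-op (emit false)  v = refl
    execBits-op (emitW true)  v = refl
    execBits-op (emitW false) v = refl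
    execBits-op emitFirst     v = refl
    execBits-op stepK         v = refl
    execBits-op checkEnd      v = refl
    execBits-op (check true)  v = refl
    execBits-op (check false) v = refl

    execBits-program : ∀ os v → execBits (programBits os) (zero , v) ≡ (zero , execs os v)
    execBits-program []       v = refl
    execBits-program (o ∷ os) v = trans (execBits-++ (opBits o) (programBits os) (zero , v))
      (trans (cong (execBits (programBits os)) (execBits-op o v)) (execBits-program os (exec o v)))

    execs-++ : ∀ os ps v → execs (os ++ ps) v ≡ execs ps (execs os v)
    execs-++ os ps v = foldl-++ (λ v o → exec o v) v os ps

    execs-leftX : ∀ j v → execs (replicate j leftX) v ≡ record v { X = moves j left (X v) }
    execs-leftX zero    v = refl
    execs-leftX (suc j) v = execs-leftX j (exec leftX v)

    execs-rightX : ∀ j v → execs (replicate j rightX) v ≡ record v { X = moves j right (X v) }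
    execs-rightX zero    v = refl
    execs-rightX (suc j) v = execs-rightX j (exec rightX v)

    execs-leftW : ∀ j v → execs (replicate j leftW) v ≡ record v { W = moves j left (W v) }
    execs-leftW zero    v = refl
    execs-leftW (suc j) v = execs-leftW j (exec leftW v)

    execs-rightW : ∀ j v → execs (replicate j rightW) v ≡ record v { W = moves j right (W v) }
    execs-rightW zero    v = refl
    execs-rightW (suc j) v = execs-rightW j (exec rightW v)

    execs-leftK : ∀ j v → execs (replicate j leftK) v ≡ record v { K₀ = moves j left (K₀ v) }
    execs-leftK zero    v = refl
    execs-leftK (suc j) v = execs-leftK j (exec leftK v)

    execs-stepK : ∀ j v → execs (replicate j stepK) v ≡ setK (KS.steps (q v , K₀ v ∷ Kₛ v) j) v
    execs-stepK zero    v = refl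
    execs-stepK (suc j) v = trans (execs-stepK j (exec stepK v))
      (trans (cong (λ c → setK (KS.steps c j) (exec stepK v)) (conf (KS.stutter (q v , K₀ v ∷ Kₛ v)) v))
      (trans (set-set (KS.steps (KS.stutter (q v , K₀ v ∷ Kₛ v)) j) (KS.stutter (q v , K₀ v ∷ Kₛ v)) v)
        (cong (λ c → setK c v) (KS.steps-stutter (q v , K₀ v ∷ Kₛ v) j))))
      where
      conf : ∀ c v → (q (setK c v) , K₀ (setK c v) ∷ Kₛ (setK c v)) ≡ c
      conf (_ , _ ∷ _) v = refl
      set-set : ∀ c c′ v → setK c (setK c′ v) ≡ setK c v
      set-set (_ , _ ∷ _) (_ , _ ∷ _) v = refl

    comparison : ℕ × ℕ → List Op
    comparison (a , c) = (replicate (suc a) leftX ++ replicate (suc c) leftW) ++ compare ∷ (replicate (suc c) rightW ++ replicate (suc a) rightX)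

    -- A fragment may leave X and W with additional blanks at their ends.
    execs-comparison : ∀ a c v → ∃[ x′ ] ∃[ w′ ] x′ ≈ X v × w′ ≈ W v ×
      execs (comparison (a , c)) v ≡ record v { X = x′ ; W = w′ ; equal = equal v ∧ sameBit (bitLeft (X v) a) (bitLeft (W v) c) }
    execs-comparison a c v = moves (suc a) right x₁ , moves (suc c) right w₁ , moves-right-left (suc a) (X v) , moves-right-left (suc c) (W v) , (begin
      execs (comparison (a , c)) v
        ≡⟨ execs-++ (replicate (suc a) leftX ++ replicate (suc c) leftW) _ v ⟩
      execs (compare ∷ back) (execs (replicate (suc a) leftX ++ replicate (suc c) leftW) v)
        ≡⟨ cong (execs (compare ∷ back)) (trans (execs-++ (replicate (suc a) leftX) _ v) (trans (cong (execs (replicate (suc c) leftW)) (execs-leftX (suc a) v)) (execs-leftW (suc c) _))) ⟩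
      execs back (exec compare (record v { X = x₁ ; W = w₁ }))
        ≡⟨ trans (execs-++ (replicate (suc c) rightW) _ _) (trans (cong (execs (replicate (suc a) rightX)) (execs-rightW (suc c) _)) (execs-rightX (suc a) _)) ⟩
      record v { X = moves (suc a) right x₁ ; W = moves (suc c) right w₁ ; equal = equal v ∧ sameBit (asBit (Tape.current x₁)) (asBit (Tape.current w₁)) }
        ≡⟨ cong₂ (λ σ τ → record v { X = moves (suc a) right x₁ ; W = moves (suc c) right w₁ ; equal = equal v ∧ sameBit (asBit σ) (asBit τ) }) (current-left a (X v)) (current-left c (W v)) ⟩
      record v { X = moves (suc a) right x₁ ; W = moves (suc c) right w₁ ; equal = equal v ∧ sameBit (bitLeft (X v) a) (bitLeft (W v) c) } ∎)
      where
      open ≡-Reasoning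
      x₁ = moves (suc a) left (X v)
      w₁ = moves (suc c) left (W v)
      back = replicate (suc c) rightW ++ replicate (suc a) rightX

    bitLeft-cong : ∀ {t t′ : Tape s} → t ≈ t′ → ∀ a → bitLeft t a ≡ bitLeft t′ a
    bitLeft-cong p a = cong asBit (same p -[1+ a ])

    bitLeft-≈ : ∀ {t t′ : Tape s} {x : ℕ → Bool} → t ≈ t′ → (∀ a → bitLeft t′ a ≡ x a) → ∀ a → bitLeft t a ≡ x a
    bitLeft-≈ p px a = trans (bitLeft-cong p a) (px a)

    execs-comparisons : ∀ ps v (x y : ℕ → Bool) → (∀ a → bitLeft (X v) a ≡ x a) → (∀ a → bitLeft (W v) a ≡ y a) →
      ∃[ x′ ] ∃[ w′ ] x′ ≈ X v × w′ ≈ W v ×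
      execs (concatMap comparison ps) v ≡ record v { X = x′ ; W = w′ ; equal = equal v ∧ all (agrees x y) ps }
    execs-comparisons []             v x y px py = X v , W v , ≈-refl , ≈-refl , cong (λ e → record v { equal = e }) (sym (∧-identityʳ (equal v)))
    execs-comparisons ((a , c) ∷ ps) v x y px py =
      let x₁ , w₁ , x₁≈ , w₁≈ , eq₁ = execs-comparison a c v
          x₂ , w₂ , x₂≈ , w₂≈ , eq₂ = execs-comparisons ps (record v { X = x₁ ; W = w₁ ; equal = equal v ∧ sameBit (bitLeft (X v) a) (bitLeft (W v) c) }) x y
                                            (bitLeft-≈ x₁≈ px) (bitLeft-≈ w₁≈ py)
      in x₂ , w₂ , ≈-trans x₂≈ x₁≈ , ≈-trans w₂≈ w₁≈ ,
        trans (execs-++ (comparison (a , c)) (concatMap comparison ps) v) (trans (cong (execs (concatMap comparison ps)) eq₁) (trans eq₂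
          (cong (λ e → record v { X = x₂ ; W = w₂ ; equal = e })
            (trans (∧-assoc (equal v) _ _) (cong (λ b → equal v ∧ (b ∧ all (agrees x y) ps)) (cong₂ sameBit (px a) (py c)))))))

    inputTest : List (ℕ × ℕ) → List Op
    inputTest ps = reset ∷ (concatMap comparison ps ++ recordInput ∷ [])

    execs-inputTests : ∀ rows v (x y : ℕ → Bool) → (∀ a → bitLeft (X v) a ≡ x a) → (∀ a → bitLeft (W v) a ≡ y a) →
      ∃[ x′ ] ∃[ w′ ] ∃[ e ] w′ ≈ W v ×
      execs (concatMap inputTest rows) v ≡ record v { X = x′ ; W = w′ ; equal = e ; inputFound = inputFound v ∨ any (all (agrees x y)) rows }
    execs-inputTests []           v x y px py = X v , W v , equal v , ≈-refl , cong (λ e → record v { inputFound = e }) (sym (∨-identityʳ (inputFound v)))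
    execs-inputTests (ps ∷ rows) v x y px py =
      let x₁ , w₁ , x₁≈ , w₁≈ , eq₁ = execs-comparisons ps (exec reset v) x y px py
          x₂ , w₂ , e , w₂≈ , eq₂ = execs-inputTests rows (record v { X = x₁ ; W = w₁ ; equal = all (agrees x y) ps ; inputFound = inputFound v ∨ all (agrees x y) ps }) x y
                                            (bitLeft-≈ x₁≈ px) (bitLeft-≈ w₁≈ py)
      in x₂ , w₂ , e , ≈-trans w₂≈ w₁≈ ,
        trans (execs-++ (inputTest ps) (concatMap inputTest rows) v)
          (trans (cong (execs (concatMap inputTest rows)) (trans (execs-++ (concatMap comparison ps) (recordInput ∷ []) (exec reset v)) (cong (exec recordInput) eq₁)))
          (trans eq₂ (cong (λ f → record v { X = x₂ ; W = w₂ ; equal = e ; inputFound = f }) (∨-assoc (inputFound v) _ _))))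

    emission : Source → List Op
    emission (const b)     = emit b ∷ []
    emission (literal a b) = replicate (suc a) leftW ++ emitW b ∷ replicate (suc a) rightW

    sameBit-bitOf : ∀ y a b → sameBit b (y a) ≡ bitOf y (literal a b)
    sameBit-bitOf y a true  = refl
    sameBit-bitOf y a false = refl

    execs-emission : ∀ o v (y : ℕ → Bool) → (∀ a → bitLeft (W v) a ≡ y a) →
      ∃[ w′ ] w′ ≈ W v × execs (emission o) v ≡ record v { W = w′ ; K₀ = act (bit (bitOf y o) , left) (K₀ v) }
    execs-emission (const b)     v y py = W v , ≈-refl , refl
    execs-emission (literal a b) v y py = moves (suc a) right w₁ , moves-right-left (suc a) (W v) ,
      trans (execs-++ (replicate (suc a) leftW) _ v) (trans (cong (execs (emitW b ∷ replicate (suc a) rightW)) (execs-leftW (suc a) v))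
      (trans (execs-rightW (suc a) _) (cong (λ e → record v { W = moves (suc a) right w₁ ; K₀ = act (bit e , left) (K₀ v) })
        (trans (cong (sameBit b) (trans (cong asBit (current-left a (W v))) (py a))) (sameBit-bitOf y a b)))))
      where
      w₁ = moves (suc a) left (W v)

    written : Word → Tape s → Tape s
    written bs t = foldl (λ t b → act (bit b , left) t) t bs

    execs-emissions : ∀ os v (y : ℕ → Bool) → (∀ a → bitLeft (W v) a ≡ y a) →
      ∃[ w′ ] execs (concatMap emission os) v ≡ record v { W = w′ ; K₀ = written (map (bitOf y) os) (K₀ v) }
    execs-emissions []       v y py = W v , refl
    execs-emissions (o ∷ os) v y py =
      let w₁ , w₁≈ , eq₁ = execs-emission o v y py
          w₂ , eq₂ = execs-emissions os (record v { W = w₁ ; K₀ = act (bit (bitOf y o) , left) (K₀ v) }) y (bitLeft-≈ w₁≈ py)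
      in w₂ , trans (execs-++ (emission o) (concatMap emission os) v) (trans (cong (execs (concatMap emission os)) eq₁) eq₂)

    written-empty : ∀ bs as → written bs (tape [] blank as) ≡ tape [] blank (map bit (reverse bs) ++ as)
    written-empty []       as = refl
    written-empty (b ∷ bs) as = trans (written-empty bs (bit b ∷ as)) (cong (tape [] blank) (begin
      map bit (reverse bs) ++ bit b ∷ as           ≡⟨ sym (++-assoc (map bit (reverse bs)) _ as) ⟩
      (map bit (reverse bs) ++ bit b ∷ []) ++ as   ≡⟨ cong (_++ as) (sym (map-++ bit (reverse bs) _)) ⟩
      map bit (reverse bs ++ b ∷ []) ++ as         ≡⟨ cong (λ l → map bit l ++ as) (sym (unfold-reverse b bs)) ⟩
      map bit (reverse (b ∷ bs)) ++ as             ∎))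
      where open ≡-Reasoning

    checks : Word → List Op
    checks z = concatMap (λ b → check b ∷ rightK ∷ []) z ++ checkEnd ∷ []

    execs-checks : ∀ z v → execs (checks z) v ≡ record v { equal = matches (equal v) z (K₀ v) ; K₀ = moves (length z) right (K₀ v) }
    execs-checks []      v = refl
    execs-checks (b ∷ z) v = execs-checks z (exec rightK (exec (check b) v))

    outputTest : Word → List Op
    outputTest z = reset ∷ (checks z ++ recordOutput ∷ replicate (length z) leftK)

    execs-outputTest : ∀ z v → execs (outputTest z) v ≡
      record v { equal = matches true z (K₀ v) ; outputFound = outputFound v ∨ matches true z (K₀ v) ; K₀ = moves (length z) left (moves (length z) right (K₀ v)) }
    execs-outputTest z v = trans (execs-++ (checks z) _ (exec reset v))
      (trans (cong (execs (recordOutput ∷ replicate (length z) leftK)) (execs-checks z (exec reset v))) (execs-leftK (length z) _))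

    -- Each test brings the head back, but restores the tape only up to listed blanks; hence the
    -- comparison with a fixed tape `t` as invariant.
    execs-outputTests : ∀ zs v t → K₀ v ≈ t →
      outputFound (execs (concatMap outputTest zs) v) ≡ outputFound v ∨ any (λ z → matches true z t) zs ×
      inputFound (execs (concatMap outputTest zs) v) ≡ inputFound v
    execs-outputTests []       v t p = sym (∨-identityʳ _) , refl
    execs-outputTests (z ∷ zs) v t p
      with execs-outputTests zs (record v { equal = matches true z (K₀ v) ; outputFound = outputFound v ∨ matches true z (K₀ v) ; K₀ = moves (length z) left (moves (length z) right (K₀ v)) })
             t (≈-trans (moves-left-right (length z) (K₀ v)) p)
    ... | out , inp =
        trans (cong outputFound whole) (trans out (trans (∨-assoc (outputFound v) _ _) (cong (λ m → outputFound v ∨ (m ∨ any (λ z → matches true z t) zs)) (matches-cong true z p))))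
      , trans (cong inputFound whole) inp
      where
      whole = trans (execs-++ (outputTest z) (concatMap outputTest zs) v) (cong (execs (concatMap outputTest zs)) (execs-outputTest z v))

    initialState : Word → Word → State
    initialState xs ws = ⟨ tape (map bit xs) blank [] , tape (map bit ws) blank [] , emptyTape , Vec.replicate k emptyTape , start , false , false , false ⟩

    -- The word for `K` is written from right to left, so that the head ends at its beginning. Its
    -- first bit is always `true`, since the number of vertices is positive and in unary; it is
    -- written without a move, which produces the input tape of `K` on the nose.
    program : List (List (ℕ × ℕ)) → List Source → ℕ → List Word → List Op
    program rows template t zs =
      concatMap inputTest rows ++ concatMap emission (reverse template) ++ emitFirst ∷ (replicate t stepK ++ concatMap outputTest zs)

    bitLeft-word : ∀ xs a → bitLeft (tape {s} (map bit xs) blank []) a ≡ nthBit xs a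
    bitLeft-word []       a       = refl
    bitLeft-word (x ∷ xs) zero    = refl
    bitLeft-word (x ∷ xs) (suc a) = bitLeft-word xs a

    accepted : State → Bool
    accepted v = inputFound v ∧ outputFound v

    execs-program : ∀ rows template t zs xs ws → let x = nthBit xs ; y = nthBit ws in
      accepted (execs (program rows template t zs) (initialState xs ws)) ≡
      any (all (agrees x y)) rows ∧ any (λ z → matches true z (Vec.head (proj₂ (KS.steps (KS.initial (true ∷ map (bitOf y) template)) t)))) zs
    execs-program rows template t zs xs ws
      with execs-inputTests rows (initialState xs ws) (nthBit xs) (nthBit ws) (bitLeft-word xs) (bitLeft-word ws)
    ... | x₁ , w₁ , e , w₁≈ , eq₁
      with execs-emissions (reverse template) (record (initialState xs ws) { X = x₁ ; W = w₁ ; equal = e ; inputFound = any (all (agrees (nthBit xs) (nthBit ws))) rows })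
             (nthBit ws) (bitLeft-≈ w₁≈ (bitLeft-word ws))
    ...   | w₂ , eq₂ = trans (cong accepted whole) (cong₂ _∧_ (trans (proj₂ tests) (set-input c v₃)) (trans (proj₁ tests) (cong (λ b → b ∨ any (λ z → matches true z (Vec.head (proj₂ c))) zs) (set-output c v₃))))
      where
      y = nthBit ws
      u = true ∷ map (bitOf y) template
      found = any (all (agrees (nthBit xs) y)) rows
      v₃ : State
      v₃ = record (initialState xs ws) { X = x₁ ; W = w₂ ; equal = e ; inputFound = found ; K₀ = inputTape u }
      c = KS.steps (KS.initial u) t
      rest = emitFirst ∷ (replicate t stepK ++ concatMap outputTest zs)
      set-input : ∀ c v → inputFound (setK c v) ≡ inputFound v
      set-input (_ , _ ∷ _) v = refl
      set-output : ∀ c v → outputFound (setK c v) ≡ outputFound v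
      set-output (_ , _ ∷ _) v = refl
      set-K₀ : ∀ c v → K₀ (setK c v) ≡ Vec.head (proj₂ c)
      set-K₀ (_ , _ ∷ _) v = refl
      tests = execs-outputTests zs (setK c v₃) (Vec.head (proj₂ c)) (subst (_≈ Vec.head (proj₂ c)) (sym (set-K₀ c v₃)) ≈-refl)
      emitted : act (bit true , stay) (written (map (bitOf y) (reverse template)) emptyTape) ≡ inputTape u
      emitted = trans (cong (act (bit true , stay)) (written-empty (map (bitOf y) (reverse template)) []))
        (cong (tape [] (bit true)) (trans (++-identityʳ _) (cong (map bit) (trans (cong reverse (reverse-map (bitOf y) template)) (reverse-involutive _)))))
      whole : execs (program rows template t zs) (initialState xs ws) ≡ execs (concatMap outputTest zs) (setK c v₃)
      whole = trans (execs-++ (concatMap inputTest rows) _ (initialState xs ws))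
        (trans (cong (execs (concatMap emission (reverse template) ++ rest)) eq₁)
        (trans (execs-++ (concatMap emission (reverse template)) rest _)
        (trans (cong (execs rest) eq₂)
        (trans (cong (λ k₀ → execs (replicate t stepK ++ concatMap outputTest zs) (record v₃ { K₀ = k₀ })) emitted)
        (trans (execs-++ (replicate t stepK) (concatMap outputTest zs) v₃) (cong (execs (concatMap outputTest zs)) (execs-stepK t v₃)))))))

    -- The input tape holds pair (pair (x , p) , w); the word x is copied to X, the program p to P and w to W.
    -- Copying reverses words, so the program is executed from its last bit on.

    Control : Set
    Control = Fin 7 ⊎ ((Fin 19 × (Fin #states × (Bool × (Bool × Bool)))) ⊎ Fin 1)

    pattern reading i         = inj₁ i
    pattern running r q e f h = inj₂ (inj₁ (r , (q , (e , (f , h)))))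
    pattern finished          = inj₂ (inj₂ zero)

    finiteControl : Finite Control
    finiteControl = finiteFin 7 ⊎ᶠ ((finiteFin 19 ×ᶠ (finiteFin #states ×ᶠ (finiteBool ×ᶠ (finiteBool ×ᶠ finiteBool)))) ⊎ᶠ finiteFin 1)

    -- R₀ … R₃ read the four bits that encode a bit of x, R₄ and R₅ the two bits for a bit of p, and R₆ reads w.
    pattern R₀ = zero
    pattern R₁ = suc zero
    pattern R₂ = suc (suc zero)
    pattern R₃ = suc (suc (suc zero))
    pattern R₄ = suc (suc (suc (suc zero)))
    pattern R₅ = suc (suc (suc (suc (suc zero))))
    pattern R₆ = suc (suc (suc (suc (suc (suc zero)))))

    Words : Set
    Words = Word × Word × Word

    readBit : Fin 7 → Bool → Words → Fin 7 × Words
    readBit R₀ true  ws              = R₁ , ws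
    -- Occurs, like `false` in `R₂`, only when the first component of the outer pair is not itself a
    -- `pair`.
    readBit R₀ false ws              = R₆ , ws
    readBit R₁ true  ws              = R₂ , ws
    readBit R₁ false ws              = R₄ , ws
    readBit R₂ true  ws              = R₃ , ws
    readBit R₂ false ws              = R₆ , ws
    readBit R₃ b     (ps , xs , ws)  = R₀ , ps , b ∷ xs , ws
    readBit R₄ true  ws              = R₅ , ws
    readBit R₄ false ws              = R₆ , ws
    readBit R₅ b     (ps , xs , ws)  = R₄ , b ∷ ps , xs , ws
    readBit R₆ b     (ps , xs , ws)  = R₆ , ps , xs , b ∷ ws

    readWord : Word → Fin 7 × Words → Fin 7 × Words
    readWord []      s        = s
    readWord (b ∷ u) (i , ws) = readWord u (readBit i b ws)

    Cells : Set
    Cells = Vec (Symbol s × Move) 3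

    readAction : Fin 7 → Bool → Symbol s → Symbol s → Symbol s → Cells
    readAction R₃ b p x w = (p , stay) ∷ (bit b , right) ∷ (w , stay) ∷ []
    readAction R₅ b p x w = (bit b , right) ∷ (x , stay) ∷ (w , stay) ∷ []
    readAction R₆ b p x w = (p , stay) ∷ (x , stay) ∷ (bit b , right) ∷ []
    readAction _  b p x w = (p , stay) ∷ (x , stay) ∷ (w , stay) ∷ []

    nextReading : Fin 7 → Bool → Fin 7
    nextReading i b = proj₁ (readBit i b ([] , [] , []))

    idle : Symbol s → Symbol s × Move
    idle c = c , stay

    idles : ∀ {n} → Vec (Symbol s) n → Vec (Symbol s × Move) n
    idles = Vec.map idle

    Effect : Set
    Effect = (Fin #states × Bool × Bool × Bool) × (Symbol s × Move) × (Symbol s × Move) × Vec (Symbol s × Move) (suc k)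

    effect : Op → Fin #states → Bool → Bool → Bool → Symbol s → Symbol s → Vec (Symbol s) (suc k) → Effect
    effect leftX        q e f h x w ks       = (q , e , f , h) , (x , left) , (w , stay) , idles ks
    effect rightX       q e f h x w ks       = (q , e , f , h) , (x , right) , (w , stay) , idles ks
    effect leftW        q e f h x w ks       = (q , e , f , h) , (x , stay) , (w , left) , idles ks
    effect rightW       q e f h x w ks       = (q , e , f , h) , (x , stay) , (w , right) , idles ks
    effect leftK        q e f h x w (c ∷ ks) = (q , e , f , h) , (x , stay) , (w , stay) , (c , left) ∷ idles ks
    effect rightK       q e f h x w (c ∷ ks) = (q , e , f , h) , (x , stay) , (w , stay) , (c , right) ∷ idles ks
    effect reset        q e f h x w ks       = (q , true , f , h) , (x , stay) , (w , stay) , idles ks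
    effect compare      q e f h x w ks       = (q , e ∧ sameBit (asBit x) (asBit w) , f , h) , (x , stay) , (w , stay) , idles ks
    effect recordInput  q e f h x w ks       = (q , e , f ∨ e , h) , (x , stay) , (w , stay) , idles ks
    effect recordOutput q e f h x w ks       = (q , e , f , h ∨ e) , (x , stay) , (w , stay) , idles ks
    effect (emit b)     q e f h x w (c ∷ ks) = (q , e , f , h) , (x , stay) , (w , stay) , (bit b , left) ∷ idles ks
    effect (emitW b)    q e f h x w (c ∷ ks) = (q , e , f , h) , (x , stay) , (w , stay) , (bit (sameBit b (asBit w)) , left) ∷ idles ks
    effect emitFirst    q e f h x w (c ∷ ks) = (q , e , f , h) , (x , stay) , (w , stay) , (bit true , stay) ∷ idles ks
    effect stepK        q e f h x w ks       with δᴷ q ks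
    ... | nothing        = (q , e , f , h) , (x , stay) , (w , stay) , idles ks
    ... | just (q′ , as) = (q′ , e , f , h) , (x , stay) , (w , stay) , as
    effect checkEnd     q e f h x w (c ∷ ks) = (q , e ∧ not (isBit c) , f , h) , (x , stay) , (w , stay) , idles (c ∷ ks)
    effect (check b)    q e f h x w (c ∷ ks) = (q , e ∧ isBitOf b c , f , h) , (x , stay) , (w , stay) , idles (c ∷ ks)

    Actions : Set
    Actions = Vec (Symbol s × Move) (5 + k)

    startRunning : Symbol s → Symbol s → Symbol s → Symbol s → Vec (Symbol s) (suc k) → Maybe (Control × Actions)
    startRunning c p x w ks = just (running zero start false false false , idle c ∷ (p , left) ∷ idle x ∷ idle w ∷ idles ks)

    -- The answer goes into the cell behind the input, with only blanks to its right, so the output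
    -- is this single bit.
    finish : Bool → Symbol s → Symbol s → Symbol s → Vec (Symbol s) (suc k) → Maybe (Control × Actions)
    finish b p x w ks = just (finished , (bit b , stay) ∷ idle p ∷ idle x ∷ idle w ∷ idles ks)

    transition : Control → Vec (Symbol s) (5 + k) → Maybe (Control × Actions)
    transition (reading i) (bit b ∷ p ∷ x ∷ w ∷ ks) = just (reading (nextReading i b) , (bit b , right) ∷ (readAction i b p x w Vec.++ idles ks))
    transition (reading i) (blank ∷ p ∷ x ∷ w ∷ ks) = startRunning blank p x w ks
    transition (reading i) (aux a ∷ p ∷ x ∷ w ∷ ks) = startRunning (aux a) p x w ks
    transition (running r q e f h) (c ∷ bit false ∷ x ∷ w ∷ ks) = just (running (successor r) q e f h , idle c ∷ (bit false , left) ∷ idle x ∷ idle w ∷ idles ks)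
    transition (running r q e f h) (c ∷ bit true  ∷ x ∷ w ∷ ks) =
      let (q , e , f , h) , ax , aw , ak = effect (operation r) q e f h x w ks in
      just (running zero q e f h , idle c ∷ (bit true , left) ∷ ax ∷ aw ∷ ak)
    transition (running r q e f h) (c ∷ blank ∷ x ∷ w ∷ ks) = finish (f ∧ h) blank x w ks
    transition (running r q e f h) (c ∷ aux a ∷ x ∷ w ∷ ks) = finish (f ∧ h) (aux a) x w ks
    transition finished _ = nothing

    -- The encoding of the control is a parameter, so that `to finite c` stays opaque and the
    -- simulation proofs compute with structured states.
    module Machine (finite : Finite Control) where

      machine : TuringMachine
      machine = record
        { workTapes  = 4 + k
        ; auxSymbols = s
        ; states     = cardinality finite
        ; start      = to finite (reading zero)
        ; δ          = λ i cs → Maybe.map (λ (c , as) → to finite c , as) (transition (from finite i) cs)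
        }

      open Steps machine public

      at : Control → Vec (Tape s) (5 + k) → Configuration
      at c ts = to finite c , ts

      stutter-at : ∀ c ts {c′ as} → transition c (Vec.map Tape.current ts) ≡ just (c′ , as) → stutter (at c ts) ≡ at c′ (Vec.zipWith act as ts)
      stutter-at c ts {c′} {as} h = stutter-step stepped
        where
        stepped : step (at c ts) ≡ just (at c′ (Vec.zipWith act as ts))
        stepped rewrite from-to finite c | h = refl

      halted-finished : ∀ ts → step (at finished ts) ≡ nothing
      halted-finished ts rewrite from-to finite finished = refl

      zipWith-idles : ∀ {n} (ts : Vec (Tape s) n) → Vec.zipWith act (idles (Vec.map Tape.current ts)) ts ≡ ts
      zipWith-idles []       = refl
      zipWith-idles (t ∷ ts) = cong (t ∷_) (zipWith-idles ts)

      word : Word → Tape s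
      word ws = tape (map bit ws) blank []

      unread : List (Symbol s) → Word → Tape s
      unread bs []      = tape bs blank []
      unread bs (b ∷ u) = tape bs (bit b) (map bit u)

      readingAt : List (Symbol s) → Word → Fin 7 × Words → Configuration
      readingAt bs u (i , ps , xs , ws) = at (reading i) (unread bs u ∷ word ps ∷ word xs ∷ word ws ∷ emptyTape ∷ Vec.replicate k emptyTape)

      advance : ∀ bs b u → act (bit b , right) (unread bs (b ∷ u)) ≡ unread (bit b ∷ bs) u
      advance bs b []      = refl
      advance bs b (c ∷ u) = refl

      read-step : ∀ bs b u i ws → stutter (readingAt bs (b ∷ u) (i , ws)) ≡ readingAt (bit b ∷ bs) u (readBit i b ws)
      read-step bs b u i (ps , xs , ws) = trans (stutter-at (reading i) (unread bs (b ∷ u) ∷ word ps ∷ word xs ∷ word ws ∷ emptyTape ∷ Vec.replicate k emptyTape) refl)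
        (trans (cong₂ (λ t ts → at (reading (nextReading i b)) (t ∷ ts)) (advance bs b u) (rest i b)) (control i b))
        where
        ks = emptyTape ∷ Vec.replicate k emptyTape
        done : Fin 7 → Bool → Vec (Tape s) (4 + k)
        done i b = let _ , ps′ , xs′ , ws′ = readBit i b (ps , xs , ws) in word ps′ ∷ word xs′ ∷ word ws′ ∷ ks
        rest : ∀ i b → Vec.zipWith act (readAction i b blank blank blank Vec.++ idles (Vec.map Tape.current ks)) (word ps ∷ word xs ∷ word ws ∷ ks) ≡ done i b
        rest R₀ true  = cong (λ ks → word ps ∷ word xs ∷ word ws ∷ ks) (zipWith-idles ks)
        rest R₀ false = cong (λ ks → word ps ∷ word xs ∷ word ws ∷ ks) (zipWith-idles ks)
        rest R₁ true  = cong (λ ks → word ps ∷ word xs ∷ word ws ∷ ks) (zipWith-idles ks)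
        rest R₁ false = cong (λ ks → word ps ∷ word xs ∷ word ws ∷ ks) (zipWith-idles ks)
        rest R₂ true  = cong (λ ks → word ps ∷ word xs ∷ word ws ∷ ks) (zipWith-idles ks)
        rest R₂ false = cong (λ ks → word ps ∷ word xs ∷ word ws ∷ ks) (zipWith-idles ks)
        rest R₃ b     = cong (λ ks → word ps ∷ word (b ∷ xs) ∷ word ws ∷ ks) (zipWith-idles ks)
        rest R₄ true  = cong (λ ks → word ps ∷ word xs ∷ word ws ∷ ks) (zipWith-idles ks)
        rest R₄ false = cong (λ ks → word ps ∷ word xs ∷ word ws ∷ ks) (zipWith-idles ks)
        rest R₅ b     = cong (λ ks → word (b ∷ ps) ∷ word xs ∷ word ws ∷ ks) (zipWith-idles ks)
        rest R₆ b     = cong (λ ks → word ps ∷ word xs ∷ word (b ∷ ws) ∷ ks) (zipWith-idles ks)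
        control : ∀ i b → at (reading (nextReading i b)) (unread (bit b ∷ bs) u ∷ done i b) ≡ readingAt (bit b ∷ bs) u (readBit i b (ps , xs , ws))
        control R₀ true  = refl
        control R₀ false = refl
        control R₁ true  = refl
        control R₁ false = refl
        control R₂ true  = refl
        control R₂ false = refl
        control R₃ b     = refl
        control R₄ true  = refl
        control R₄ false = refl
        control R₅ b     = refl
        control R₆ b     = refl

      read-steps : ∀ u bs st → ∃[ bs′ ] steps (readingAt bs u st) (length u) ≡ readingAt bs′ [] (readWord u st)
      read-steps []      bs st       = bs , refl
      read-steps (b ∷ u) bs (i , ws) with read-steps u (bit b ∷ bs) (readBit i b ws)
      ... | bs′ , eq = bs′ , trans (sym (steps-stutter (readingAt bs (b ∷ u) (i , ws)) (length u))) (trans (cong (λ c → steps c (length u)) (read-step bs b u i ws)) eq)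

      -- The program tape is described as `move left` of the tape one cell further right: this shows
      -- the next bit, or a blank once the program is exhausted, without a case distinction.
      runningAt : List (Symbol s) → Symbol s → List (Symbol s) → Word → Fin 19 × State → Configuration
      runningAt bs c as ps (r , ⟨ x , w , k₀ , kₛ , q , e , f , h ⟩) =
        at (running r q e f h) (tape bs blank [] ∷ move left (tape (map bit ps) c as) ∷ x ∷ w ∷ k₀ ∷ kₛ)

      start-step : ∀ bs i ps xs ws → stutter (readingAt bs [] (i , ps , xs , ws)) ≡ runningAt bs blank [] ps (zero , initialState xs ws)
      start-step bs i ps xs ws = trans (stutter-at (reading i) (tape bs blank [] ∷ word ps ∷ word xs ∷ word ws ∷ emptyTape ∷ Vec.replicate k emptyTape) refl)
        (cong (λ ks → at (running zero start false false false) (tape bs blank [] ∷ move left (word ps) ∷ word xs ∷ word ws ∷ ks)) (zipWith-idles (emptyTape ∷ Vec.replicate k emptyTape)))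

      stateAt : Tape s → Tape s → State → Configuration
      stateAt t p ⟨ x , w , k₀ , kₛ , q , e , f , h ⟩ = at (running zero q e f h) (t ∷ p ∷ x ∷ w ∷ k₀ ∷ kₛ)

      effectAt : Tape s → Tape s → Effect → Tape s → Tape s → Vec (Tape s) (suc k) → Configuration
      effectAt t p ((q , e , f , h) , ax , aw , ak) x w ks = at (running zero q e f h) (t ∷ p ∷ act ax x ∷ act aw w ∷ Vec.zipWith act ak ks)

      effect-exec : ∀ t p o x w (k₀ : Tape s) (kₛ : Vec (Tape s) k) q e f h →
        effectAt t p (effect o q e f h (Tape.current x) (Tape.current w) (Tape.current k₀ ∷ Vec.map Tape.current kₛ)) x w (k₀ ∷ kₛ) ≡
        stateAt t p (exec o ⟨ x , w , k₀ , kₛ , q , e , f , h ⟩)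
      effect-exec t p leftX x w k₀ kₛ q e f h = cong (λ ks → at (running zero q e f h) (t ∷ p ∷ move left x ∷ w ∷ ks)) (zipWith-idles (k₀ ∷ kₛ))
      effect-exec t p rightX x w k₀ kₛ q e f h = cong (λ ks → at (running zero q e f h) (t ∷ p ∷ move right x ∷ w ∷ ks)) (zipWith-idles (k₀ ∷ kₛ))
      effect-exec t p leftW x w k₀ kₛ q e f h = cong (λ ks → at (running zero q e f h) (t ∷ p ∷ x ∷ move left w ∷ ks)) (zipWith-idles (k₀ ∷ kₛ))
      effect-exec t p rightW x w k₀ kₛ q e f h = cong (λ ks → at (running zero q e f h) (t ∷ p ∷ x ∷ move right w ∷ ks)) (zipWith-idles (k₀ ∷ kₛ))
      effect-exec t p reset x w k₀ kₛ q e f h = cong (λ ks → at (running zero q true f h) (t ∷ p ∷ x ∷ w ∷ ks)) (zipWith-idles (k₀ ∷ kₛ))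
      effect-exec t p compare x w k₀ kₛ q e f h = cong (λ ks → at (running zero q (e ∧ sameBit (asBit (Tape.current x)) (asBit (Tape.current w))) f h) (t ∷ p ∷ x ∷ w ∷ ks)) (zipWith-idles (k₀ ∷ kₛ))
      effect-exec t p recordInput x w k₀ kₛ q e f h = cong (λ ks → at (running zero q e (f ∨ e) h) (t ∷ p ∷ x ∷ w ∷ ks)) (zipWith-idles (k₀ ∷ kₛ))
      effect-exec t p recordOutput x w k₀ kₛ q e f h = cong (λ ks → at (running zero q e f (h ∨ e)) (t ∷ p ∷ x ∷ w ∷ ks)) (zipWith-idles (k₀ ∷ kₛ))
      effect-exec t p checkEnd x w k₀ kₛ q e f h = cong (λ ks → at (running zero q (e ∧ not (isBit (Tape.current k₀))) f h) (t ∷ p ∷ x ∷ w ∷ ks)) (zipWith-idles (k₀ ∷ kₛ))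
      effect-exec t p (check b) x w k₀ kₛ q e f h = cong (λ ks → at (running zero q (e ∧ isBitOf b (Tape.current k₀)) f h) (t ∷ p ∷ x ∷ w ∷ ks)) (zipWith-idles (k₀ ∷ kₛ))
      effect-exec t p leftK x w k₀ kₛ q e f h = cong (λ ks → at (running zero q e f h) (t ∷ p ∷ x ∷ w ∷ move left k₀ ∷ ks)) (zipWith-idles kₛ)
      effect-exec t p rightK x w k₀ kₛ q e f h = cong (λ ks → at (running zero q e f h) (t ∷ p ∷ x ∷ w ∷ move right k₀ ∷ ks)) (zipWith-idles kₛ)
      effect-exec t p (emit b) x w k₀ kₛ q e f h = cong (λ ks → at (running zero q e f h) (t ∷ p ∷ x ∷ w ∷ act (bit b , left) k₀ ∷ ks)) (zipWith-idles kₛ)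
      effect-exec t p (emitW b) x w k₀ kₛ q e f h = cong (λ ks → at (running zero q e f h) (t ∷ p ∷ x ∷ w ∷ act (bit (sameBit b (asBit (Tape.current w))) , left) k₀ ∷ ks)) (zipWith-idles kₛ)
      effect-exec t p emitFirst x w k₀ kₛ q e f h = cong (λ ks → at (running zero q e f h) (t ∷ p ∷ x ∷ w ∷ act (bit true , stay) k₀ ∷ ks)) (zipWith-idles kₛ)
      effect-exec t p stepK x w k₀ kₛ q e f h with δᴷ q (Tape.current k₀ ∷ Vec.map Tape.current kₛ)
      ... | nothing            = cong (λ ks → at (running zero q e f h) (t ∷ p ∷ x ∷ w ∷ ks)) (zipWith-idles (k₀ ∷ kₛ))
      ... | just (q′ , a ∷ as) = refl

      run-step : ∀ bs c as b ps rv → stutter (runningAt bs c as (b ∷ ps) rv) ≡ runningAt bs (bit b) (c ∷ as) ps (execBit b rv)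
      run-step bs c as false ps (r , ⟨ x , w , k₀ , kₛ , q , e , f , h ⟩) = trans (stutter-at _ (tape bs blank [] ∷ tape (map bit ps) (bit false) (c ∷ as) ∷ x ∷ w ∷ k₀ ∷ kₛ) refl)
        (cong (λ ks → at (running (successor r) q e f h) (tape bs blank [] ∷ move left (tape (map bit ps) (bit false) (c ∷ as)) ∷ x ∷ w ∷ ks)) (zipWith-idles (k₀ ∷ kₛ)))
      run-step bs c as true ps (r , ⟨ x , w , k₀ , kₛ , q , e , f , h ⟩) = trans (stutter-at _ (tape bs blank [] ∷ tape (map bit ps) (bit true) (c ∷ as) ∷ x ∷ w ∷ k₀ ∷ kₛ) refl)
        (effect-exec (tape bs blank []) (move left (tape (map bit ps) (bit true) (c ∷ as))) (operation r) x w k₀ kₛ q e f h)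

      run-steps : ∀ ps bs c as rv → ∃[ c′ ] ∃[ as′ ] steps (runningAt bs c as ps rv) (length ps) ≡ runningAt bs c′ as′ [] (execBits ps rv)
      run-steps []       bs c as rv = c , as , refl
      run-steps (b ∷ ps) bs c as rv with run-steps ps bs (bit b) (c ∷ as) (execBit b rv)
      ... | c′ , as′ , eq = c′ , as′ , trans (sym (steps-stutter (runningAt bs c as (b ∷ ps) rv) (length ps))) (trans (cong (λ c → steps c (length ps)) (run-step bs c as b ps rv)) eq)

      finish-step : ∀ bs c as rv → ∃[ ts ] stutter (runningAt bs c as [] rv) ≡ at finished (tape bs (bit (accepted (proj₂ rv))) [] ∷ ts)
      finish-step bs c as (r , ⟨ x , w , k₀ , kₛ , q , e , f , h ⟩) =
        Vec.zipWith act (idles (Vec.map Tape.current others)) others , stutter-at (running r q e f h) (tape bs blank [] ∷ others) refl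
        where
        others : Vec (Tape s) (4 + k)
        others = move left (tape [] c as) ∷ x ∷ w ∷ k₀ ∷ kₛ

      verdict : Word → Bool
      verdict u = let _ , ps , xs , ws = readWord u (R₀ , [] , [] , []) in accepted (proj₂ (execBits ps (zero , initialState xs ws)))

      readBit-length : ∀ i b ps xs ws → length (proj₁ (proj₂ (readBit i b (ps , xs , ws)))) ≤ suc (length ps)
      readBit-length R₀ true  ps xs ws = n≤1+n _
      readBit-length R₀ false ps xs ws = n≤1+n _
      readBit-length R₁ true  ps xs ws = n≤1+n _
      readBit-length R₁ false ps xs ws = n≤1+n _
      readBit-length R₂ true  ps xs ws = n≤1+n _
      readBit-length R₂ false ps xs ws = n≤1+n _
      readBit-length R₃ b     ps xs ws = n≤1+n _
      readBit-length R₄ true  ps xs ws = n≤1+n _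
      readBit-length R₄ false ps xs ws = n≤1+n _
      readBit-length R₅ b     ps xs ws = ≤-refl
      readBit-length R₆ b     ps xs ws = n≤1+n _

      readWord-length : ∀ u i ps xs ws → length (proj₁ (proj₂ (readWord u (i , ps , xs , ws)))) ≤ length u + length ps
      readWord-length []      i ps xs ws = ≤-refl
      readWord-length (b ∷ u) i ps xs ws = let i′ , ps′ , xs′ , ws′ = readBit i b (ps , xs , ws) in
        ≤-trans (readWord-length u i′ ps′ xs′ ws′) (≤-trans (+-monoʳ-≤ (length u) (readBit-length i b ps xs ws)) (≤-reflexive (+-suc (length u) (length ps))))

      -- One step for each bit of `u`, one to start, one for each program bit, of which there are at
      -- most `length u`, and one to finish: at most `2 + 2 * length u` steps.
      machine-outputs : ∀ u → OutputsWithin (eval (2 ∷ 2 ∷ []) (length u)) u (verdict u ∷ [])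
      machine-outputs u with readWord u (R₀ , [] , [] , []) in req | readWord-length u R₀ [] [] []
      ... | i , ps , xs , ws | ps≤u with read-steps u [] (R₀ , [] , [] , [])
      ... | bs , read with run-steps ps bs blank [] (zero , initialState xs ws)
      ... | c , as , ran with finish-step bs c as (execBits ps (zero , initialState xs ws))
      ... | ts , fin = cong (Maybe.map output) (trans (steps⇒run t (initial u) (trans (cong step final) (halted-finished final-tapes))) (cong just final))
        where
        t = eval (2 ∷ 2 ∷ []) (length u)
        m = suc (length ps + suc (length u))
        final-tapes = tape bs (bit (accepted (proj₂ (execBits ps (zero , initialState xs ws))))) [] ∷ ts
        initial≡ : initial u ≡ readingAt [] u (R₀ , [] , [] , [])
        initial≡ = cong (λ t → at (reading zero) (t ∷ Vec.replicate (4 + k) emptyTape)) (input u)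
          where
          input : ∀ u → inputTape {s} u ≡ unread [] u
          input []      = refl
          input (b ∷ u) = refl
        exact : steps (initial u) m ≡ at finished final-tapes
        exact = trans (cong stutter (trans (steps-+ (initial u) (length ps) (suc (length u)))
          (trans (cong (λ c → steps c (length ps)) (trans (cong stutter (trans (cong (λ c → steps c (length u)) initial≡) (trans read (cong (readingAt bs []) req)))) (start-step bs i ps xs ws))) ran))) fin
        m≤t : m ≤ t
        m≤t = begin
          suc (length ps + suc (length u)) ≤⟨ s≤s (+-monoˡ-≤ (suc (length u)) (≤-trans ps≤u (≤-reflexive (+-identityʳ (length u))))) ⟩
          suc (length u + suc (length u))  ≡⟨ lemma (length u) ⟩
          t                                ∎
          where
          open ≤-Reasoning
          lemma : ∀ l → suc (l + suc l) ≡ 2 + l * (2 + l * 0)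
          lemma = solve-∀
        final : steps (initial u) t ≡ at finished final-tapes
        final = trans (cong (steps (initial u)) (sym (m∸n+n≡m m≤t))) (trans (steps-+ (initial u) (t ∸ m) m)
          (trans (cong (λ c → steps c (t ∸ m)) exact) (steps-halted (t ∸ m) (halted-finished final-tapes))))

-- Covering a set of words by few values of a function on tuples

module Covers where
  open Sums
  open import Data.Bool.Properties using (T?)
  open import Data.List.Base as List using (List; []; _∷_; length; _++_; map; concatMap; filterᵇ)
  open import Data.List.Properties using (length-++; length-map; ++-assoc)
  open import Data.List.Membership.Propositional using (_∈_; find; lose)
  open import Data.List.Membership.Propositional.Properties using (∈-++⁺ˡ; ∈-++⁺ʳ; ∈-map⁺; ∈-map⁻; ∈-concatMap⁺; ∈-concatMap⁻)
  open import Data.List.Relation.Unary.Any as Any using (Any; here; there)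
  open import Data.List.Relation.Unary.All as All using (All; []; _∷_)
  import Data.List.Relation.Unary.All.Properties as All
  open import Data.Nat.Base hiding (_⊔_; ∣_-_∣)
  open import Data.Nat.Properties
  open import Relation.Binary.Definitions using (DecidableEquality)

  ∑-mono-∈ : ∀ {A : Set} (xs : List A) {f g} → (∀ {x} → x ∈ xs → f x ≤ g x) → ∑ xs f ≤ ∑ xs g
  ∑-mono-∈ []       h = z≤n
  ∑-mono-∈ (x ∷ xs) h = +-mono-≤ (h (here refl)) (∑-mono-∈ xs (h ∘ there))

  length-filterᵇ : ∀ {A : Set} (b : A → Bool) xs → length (filterᵇ b xs) ≡ ∑ xs (ind ∘ b)
  length-filterᵇ b []       = refl
  length-filterᵇ b (x ∷ xs) with b x
  ... | true  = cong suc (length-filterᵇ b xs)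
  ... | false = length-filterᵇ b xs

  ∈-filterᵇ⁺ : ∀ {A : Set} (b : A → Bool) {x xs} → x ∈ xs → T (b x) → x ∈ filterᵇ b xs
  ∈-filterᵇ⁺ b {x} {z ∷ xs} (here refl) t with b x
  ... | true = here refl
  ∈-filterᵇ⁺ b {x} {z ∷ xs} (there i) t with b z
  ... | true  = there (∈-filterᵇ⁺ b i t)
  ... | false = ∈-filterᵇ⁺ b i t

  ∈-filterᵇ⁻ : ∀ {A : Set} (b : A → Bool) {x xs} → x ∈ filterᵇ b xs → x ∈ xs × T (b x)
  ∈-filterᵇ⁻ b {x} {z ∷ xs} i with b z in eq
  ∈-filterᵇ⁻ b {x} {z ∷ xs} (here refl) | true = here refl , subst T (sym eq) _
  ∈-filterᵇ⁻ b {x} {z ∷ xs} (there i)   | true  = let j , t = ∈-filterᵇ⁻ b i in there j , t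
  ∈-filterᵇ⁻ b {x} {z ∷ xs} i           | false = let j , t = ∈-filterᵇ⁻ b i in there j , t

  average : ∀ {A : Set} (xs : List A) f c {x} → x ∈ xs → ∑ xs f ≤ length xs * c → ∃[ x ] x ∈ xs × f x ≤ c
  average xs f c {x} x∈ bound with Any.any? (λ x → f x ≤? c) xs
  ... | yes found = find found
  ... | no none = contradiction bound (<⇒≱ (begin-strict
    length xs * c          ≡⟨ sym (∑-const xs c) ⟩
    ∑ xs (λ _ → c)         <⟨ larger xs x∈ (λ x∈ → ≰⇒> (none ∘ lose x∈)) ⟩
    ∑ xs f                 ∎))
    where
    open ≤-Reasoning
    larger : ∀ xs {x} → x ∈ xs → (∀ {x} → x ∈ xs → c < f x) → ∑ xs (λ _ → c) < ∑ xs f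
    larger (x ∷ xs) _ h = +-mono-<-≤ (h (here refl)) (∑-mono-∈ xs (λ i → <⇒≤ (h (there i))))

  tuples : ∀ {A : Set} → ℕ → List A → List (List A)
  tuples zero    R = [] ∷ []
  tuples (suc t) R = concatMap (λ x → map (x ∷_) (tuples t R)) R

  ∈-tuples⁺ : ∀ {A : Set} {R : List A} y → All (_∈ R) y → y ∈ tuples (length y) R
  ∈-tuples⁺ []      []       = here refl
  ∈-tuples⁺ {R = R} (x ∷ y) (i ∷ is) = ∈-concatMap⁺ (λ x → map (x ∷_) (tuples (length y) R)) {xs = R} (Any.map (λ { refl → ∈-map⁺ (x ∷_) (∈-tuples⁺ y is) }) i)

  ∈-tuples⁻ : ∀ {A : Set} t (R : List A) {y} → y ∈ tuples t R → length y ≡ t × All (_∈ R) y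
  ∈-tuples⁻ zero    R (here refl) = refl , []
  ∈-tuples⁻ (suc t) R i with find (∈-concatMap⁻ (λ x → map (x ∷_) (tuples t R)) {xs = R} i)
  ... | x , x∈ , j with ∈-map⁻ (x ∷_) j
  ...   | y , y∈ , refl with ∈-tuples⁻ t R y∈
  ...     | refl , all = refl , x∈ ∷ all

  -- For every nonempty set R of elements there is a value z of f such that at least half of the elements of R
  -- occur in a tuple with value z: otherwise one could fix one coordinate after the other so that each halves the set of
  -- possible values, and there are fewer than 2 ^ t values.
  module Covering {A Z : Set} (_≟ᴬ_ : DecidableEquality A) (_≟ᶻ_ : DecidableEquality Z)
                  (t : ℕ) (f : List A → Z) (R₀ : List A) (values : List Z) (few : length values < 2 ^ t)
                  (f∈values : ∀ y → y ∈ tuples t R₀ → f y ∈ values) where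

    Covers : Z → A → Set
    Covers z x = Any (λ y → x ∈ y × f y ≡ z) (tuples t R₀)

    covers? : ∀ z x → Dec (Covers z x)
    covers? z x = Any.any? (λ y → Any.any? (x ≟ᴬ_) y ×-dec (f y ≟ᶻ z)) (tuples t R₀)

    cov : Z → A → Bool
    cov z x = isYes (covers? z x)

    count : Z → List A → ℕ
    count z R = ∑ R (λ x → ind (cov z x))

    -- `zs` contains the values of all extensions of the prefix `p` by `j` elements of `R`. If each
    -- value covers at most half of `R`, double counting gives an `x` covered by at most half of
    -- `zs`; every value of a tuple through `x` covers `x`, so appending `x` to `p` halves `zs`. For
    -- `j = 0` the list is empty although it contains the value of `p`.
    descend : ∀ R → (∀ {x} → x ∈ R → x ∈ R₀) → ∀ {x₀} → x₀ ∈ R →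
              ∀ j p zs → All (_∈ R₀) p → length p + j ≡ t → length zs < 2 ^ j →
              (∀ q → All (_∈ R) q → length q ≡ j → f (p ++ q) ∈ zs) →
              (∀ {z} → z ∈ zs → 2 * count z R ≤ length R) → ⊥
    descend R R⊆R₀ x₀∈ zero    p []       p⊆ len few complete bad = case complete [] [] refl of λ ()
    descend R R⊆R₀ x₀∈ zero    p (_ ∷ _)  p⊆ len (s≤s ()) complete bad
    descend R R⊆R₀ x₀∈ (suc j) p zs p⊆ len few complete bad =
      let x , x∈ , half = average R (λ x → 2 * ∑ zs (λ z → ind (cov z x))) (length zs) x₀∈ total in
      descend R R⊆R₀ x₀∈ j (p ++ x ∷ []) (filterᵇ (λ z → cov z x) zs) (All.++⁺ p⊆ (R⊆R₀ x∈ ∷ []))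
        (trans (cong (_+ j) (length-++ p)) (trans (+-assoc (length p) 1 j) len))
        (*-cancelˡ-< 2 _ _ (≤-<-trans (≤-trans (≤-reflexive (cong (2 *_) (length-filterᵇ (λ z → cov z x) zs))) half) few))
        (λ q q⊆ len-q → ∈-filterᵇ⁺ (λ z → cov z x) (subst (λ y → f y ∈ zs) (sym (++-assoc p (x ∷ []) q)) (complete (x ∷ q) (x∈ ∷ q⊆) (cong suc len-q)))
          (fromWitness {a? = covers? (f ((p ++ x ∷ []) ++ q)) x} (lose (subst (λ i → (p ++ x ∷ []) ++ q ∈ tuples i R₀) (length-whole q x len-q)
              (∈-tuples⁺ ((p ++ x ∷ []) ++ q) (All.++⁺ (All.++⁺ p⊆ (R⊆R₀ x∈ ∷ [])) (All.map R⊆R₀ q⊆))))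
            (∈-++⁺ˡ (∈-++⁺ʳ p (here refl)) , refl))))
        (λ z∈ → bad (proj₁ (∈-filterᵇ⁻ (λ z → cov z x) z∈)))
      where
      length-whole : ∀ q x → length q ≡ j → length ((p ++ x ∷ []) ++ q) ≡ t
      length-whole q x refl = trans (length-++ (p ++ x ∷ [])) (trans (cong (_+ length q) (length-++ p)) (trans (+-assoc (length p) 1 (length q)) len))
      total : ∑ R (λ x → 2 * ∑ zs (λ z → ind (cov z x))) ≤ length R * length zs
      total = begin
        ∑ R (λ x → 2 * ∑ zs (λ z → ind (cov z x)))  ≡⟨ ∑-* R 2 _ ⟩
        2 * ∑ R (λ x → ∑ zs (λ z → ind (cov z x)))  ≡⟨ cong (2 *_) (∑-swap R zs (λ x z → ind (cov z x))) ⟩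
        2 * ∑ zs (λ z → count z R)                  ≡⟨ sym (∑-* zs 2 _) ⟩
        ∑ zs (λ z → 2 * count z R)                  ≤⟨ ∑-mono-∈ zs bad ⟩
        ∑ zs (λ _ → length R)                       ≡⟨ ∑-const zs (length R) ⟩
        length zs * length R                        ≡⟨ *-comm (length zs) (length R) ⟩
        length R * length zs                        ∎
        where open ≤-Reasoning

    popular : ∀ R → (∀ {x} → x ∈ R → x ∈ R₀) → ∀ {x₀} → x₀ ∈ R → ∃[ z ] z ∈ values × length R < 2 * count z R
    popular R R⊆R₀ x₀∈ with Any.any? (λ z → length R <? 2 * count z R) values
    ... | yes found = find found
    ... | no none = ⊥-elim (descend R R⊆R₀ x₀∈ t [] values [] refl few
          (λ q q⊆ len → f∈values q (subst (λ i → q ∈ tuples i R₀) len (∈-tuples⁺ q (All.map R⊆R₀ q⊆))))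
          (λ z∈ → ≮⇒≥ (none ∘ lose z∈)))

    record Cover (r : ℕ) (R : List A) : Set where
      field
        selection  : List Z
        size       : length selection ≤ r
        sound      : ∀ {z} → z ∈ selection → z ∈ values × ∃[ x ] Covers z x
        complete   : ∀ {x} → x ∈ R → ∃[ z ] z ∈ selection × Covers z x

    -- Greedy: a popular value covers more than half of what remains, so fewer than `2 ^ r` elements
    -- are exhausted after `r` choices. Popularity is measured in `R` alone, though covering tuples
    -- may use all of `R₀`.
    cover : ∀ r R → (∀ {x} → x ∈ R → x ∈ R₀) → length R < 2 ^ r → Cover r R
    cover r       []      R⊆R₀ small = record { selection = [] ; size = z≤n ; sound = λ () ; complete = λ () }
    cover zero    (_ ∷ _) R⊆R₀ (s≤s ())
    cover (suc r) R@(_ ∷ _) R⊆R₀ small with popular R R⊆R₀ (here refl)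
    ... | z , z∈ , half = record
      { selection = z ∷ selection
      ; size      = s≤s size
      ; sound     = λ { (here refl) → z∈ , witness ; (there i) → sound i }
      ; complete  = covered
      }
      where
      remaining = filterᵇ (λ x → not (cov z x)) R
      split : ∀ xs → length (filterᵇ (λ x → not (cov z x)) xs) + count z xs ≡ length xs
      split []       = refl
      split (x ∷ xs) with cov z x
      ... | true  = trans (+-suc _ _) (cong suc (split xs))
      ... | false = cong suc (split xs)
      fewer : length remaining < 2 ^ r
      fewer = *-cancelˡ-< 2 _ _ (≤-<-trans (+-cancelʳ-≤ (2 * count z R) (2 * length remaining) (length R) (begin
        2 * length remaining + 2 * count z R   ≡⟨ sym (*-distribˡ-+ 2 (length remaining) (count z R)) ⟩
        2 * (length remaining + count z R)     ≡⟨ cong (2 *_) (split R) ⟩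
        2 * length R                           ≡⟨ cong (λ l → length R + l) (+-identityʳ (length R)) ⟩
        length R + length R                    ≤⟨ +-monoʳ-≤ (length R) (<⇒≤ half) ⟩
        length R + 2 * count z R               ∎)) small)
        where open ≤-Reasoning
      open Cover (cover r remaining (λ i → R⊆R₀ (proj₁ (∈-filterᵇ⁻ (λ x → not (cov z x)) {xs = R} i))) fewer)
      positive : 1 ≤ count z R
      positive = nonzero (count z R) half
        where
        nonzero : ∀ c {l} → l < 2 * c → 1 ≤ c
        nonzero (suc _) _ = s≤s z≤n
      witness : ∃[ x ] Covers z x
      witness = let x , _ , t = ∑-witness R (cov z) positive in x , toWitness {a? = covers? z x} t
      covered : ∀ {x} → x ∈ R → ∃[ z ] z ∈ _ × Covers z x
      covered {x} x∈ with covers? z x in eq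
      ... | yes c = z , here refl , c
      ... | no ¬c = let z′ , z′∈ , c = complete (∈-filterᵇ⁺ (λ x → not (cov z x)) x∈ (subst (T ∘ not ∘ isYes) (sym eq) _)) in z′ , there z′∈ , c

  wordsUpTo : ℕ → List Word
  wordsUpTo zero    = [] ∷ []
  wordsUpTo (suc m) = [] ∷ (map (true ∷_) (wordsUpTo m) ++ map (false ∷_) (wordsUpTo m))

  ∈-wordsUpTo : ∀ m w → length w ≤ m → w ∈ wordsUpTo m
  ∈-wordsUpTo zero    []          _         = here refl
  ∈-wordsUpTo (suc m) []          _         = here refl
  ∈-wordsUpTo (suc m) (true  ∷ w) (s≤s w≤m) = there (∈-++⁺ˡ (∈-map⁺ (true ∷_) (∈-wordsUpTo m w w≤m)))
  ∈-wordsUpTo (suc m) (false ∷ w) (s≤s w≤m) = there (∈-++⁺ʳ (map (true ∷_) (wordsUpTo m)) (∈-map⁺ (false ∷_) (∈-wordsUpTo m w w≤m)))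

  -- This count is the reason for composing one input more than a kernel has bits.
  length-wordsUpTo : ∀ m → length (wordsUpTo m) < 2 ^ suc m
  length-wordsUpTo zero    = s≤s (s≤s z≤n)
  length-wordsUpTo (suc m) = begin-strict
    suc (length (map (true ∷_) (wordsUpTo m) ++ map (false ∷_) (wordsUpTo m)))
      ≡⟨ cong suc (trans (length-++ (map (true ∷_) (wordsUpTo m))) (cong₂ _+_ (length-map _ (wordsUpTo m)) (length-map _ (wordsUpTo m)))) ⟩
    suc (length (wordsUpTo m) + length (wordsUpTo m))      <⟨ ≤-reflexive (lemma (length (wordsUpTo m))) ⟩
    2 * suc (length (wordsUpTo m))                         ≤⟨ *-monoʳ-≤ 2 (length-wordsUpTo m) ⟩
    2 * 2 ^ suc m                                          ∎
    where
    open ≤-Reasoning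
    lemma : ∀ l → suc (suc (l + l)) ≡ 2 * suc l
    lemma = solve-∀

  boundedWitness? : ∀ m (b : Word → Bool) → Dec (∃[ w ] length w ≤ m × T (b w))
  boundedWitness? m b with Any.any? (λ w → (length w ≤? m) ×-dec T? (b w)) (wordsUpTo m)
  ... | yes found = yes (let w , _ , ok = find found in w , ok)
  ... | no none   = no λ (w , w≤m , t) → none (lose (∈-wordsUpTo m w w≤m) (w≤m , t))

-- The encoding of an instance determines its answer

module Encodings where
  open FirefighterReduction using (module Spread)
  open import Data.Fin.Base using (Fin; zero; suc)
  open import Data.Fin.Subset using (⁅_⁆; _∪_; _∈_; _⊆_)
  open import Data.Fin.Subset.Properties using (⊆-antisym; x∈⁅x⁆; x∈⁅y⁆⇒x≡y)
  open import Data.List.Base as List using ([]; _∷_; _++_; replicate)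
  open import Data.List.Properties using (∷-injective; ∷-injectiveʳ)
  open import Data.Nat.Base using (zero; suc)
  open import Data.Nat.Binary.Base as ℕᵇ using (ℕᵇ; 2[1+_]; 1+[2_])
  open import Data.Nat.Binary.Properties using (toℕ-fromℕ)
  open import Data.Sum.Base using (inj₁; inj₂)
  import Data.Vec.Base as Vec
  open import Data.Vec.Base using (Vec; []; _∷_)
  import Data.Vec.Properties as Vec

  -- Equal adjacency matrices do not make two graphs propositionally equal without function
  -- extensionality, so plays are carried over move by move.
  module Transfer {n} (G H : Graph n) (same : ∀ u v → Graph.adjacent G u v ≡ Graph.adjacent H u v) where
    private
      module SG = Spread G
      module SH = Spread H

    spread-⊆ : ∀ D B → SG.spread D B ⊆ SH.spread D B
    spread-⊆ D B v∈ with SG.spread⁻ D B v∈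
    ... | inj₁ v∈B                    = SH.spread⁺ˡ D B v∈B
    ... | inj₂ (v∉D , u , u∈B , uv) = SH.spread⁺ʳ D B v∉D u∈B (subst T (same u _) uv)

    spread-⊇ : ∀ D B → SH.spread D B ⊆ SG.spread D B
    spread-⊇ D B v∈ with SH.spread⁻ D B v∈
    ... | inj₁ v∈B                    = SG.spread⁺ˡ D B v∈B
    ... | inj₂ (v∉D , u , u∈B , uv) = SG.spread⁺ʳ D B v∉D u∈B (subst T (sym (same u _)) uv)

    spread-≡ : ∀ D B → SG.spread D B ≡ SH.spread D B
    spread-≡ D B = ⊆-antisym (spread-⊆ D B) (spread-⊇ D B)

    play : ∀ {D B F} → SG.Play D B F → SH.Play D B F
    play {D} {B} (SG.stop stable) = SH.stop (trans (sym (spread-≡ D B)) stable)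
    play {D} {B} {F} (SG.defend unstable v v∉B p) = SH.defend (unstable ∘ trans (spread-≡ D B)) v v∉B
      (subst (λ B′ → SH.Play (D ∪ ⁅ v ⁆) B′ F) (spread-≡ (D ∪ ⁅ v ⁆) B) (play p))

    canSave : ∀ {s k} → SG.CanSave s k → SH.CanSave s k
    canSave (F , p , k≤) = F , play p , k≤

  unary-injective : ∀ m n {u v : Word} → replicate m true ++ false ∷ u ≡ replicate n true ++ false ∷ v → m ≡ n × u ≡ v
  unary-injective zero    zero    eq = refl , ∷-injectiveʳ eq
  unary-injective (suc m) (suc n) eq with unary-injective m n (∷-injectiveʳ eq)
  ... | refl , eq′ = refl , eq′

  toList-++-injective : ∀ {A : Set} {n} (v w : Vec A n) {us vs} → Vec.toList v ++ us ≡ Vec.toList w ++ vs → v ≡ w × us ≡ vs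
  toList-++-injective []      []      eq = refl , eq
  toList-++-injective (a ∷ v) (b ∷ w) eq with ∷-injective eq
  ... | refl , eq′ with toList-++-injective v w eq′
  ...   | refl , eq″ = refl , eq″

  concat-injective : ∀ {A : Set} {m n} (v w : Vec (Vec A m) n) → Vec.concat v ≡ Vec.concat w → v ≡ w
  concat-injective []       []       eq = refl
  concat-injective (as ∷ v) (bs ∷ w) eq with Vec.++-injective as bs eq
  ... | refl , eq′ = cong (as ∷_) (concat-injective v w eq′)

  tabulate-injective : ∀ {A : Set} {n} {f g : Fin n → A} → Vec.tabulate f ≡ Vec.tabulate g → ∀ i → f i ≡ g i
  tabulate-injective {f = f} {g} eq i = trans (sym (Vec.lookup∘tabulate f i)) (trans (cong (λ v → Vec.lookup v i) eq) (Vec.lookup∘tabulate g i))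

  binary-injective : ∀ a b → binary a ≡ binary b → a ≡ b
  binary-injective ℕᵇ.zero  ℕᵇ.zero  eq = refl
  binary-injective 2[1+ a ] 2[1+ b ] eq = cong 2[1+_] (binary-injective a b (∷-injectiveʳ eq))
  binary-injective 1+[2 a ] 1+[2 b ] eq = cong 1+[2_] (binary-injective a b (∷-injectiveʳ eq))
  binary-injective 2[1+ a ] 1+[2 b ] ()
  binary-injective 1+[2 a ] 2[1+ b ] ()

  open ParameterizedProblem SavingKVertices

  -- The verifier compares kernels as words only. A selected word that encodes some no-instance must
  -- rule out every instance with the same encoding, whatever its proofs of connectedness and of the
  -- star property.
  encode-Yes : ∀ I J → encode I ≡ encode J → Yes I → Yes J
  encode-Yes
    record { n = m ; G = G ; s = s ; X = X ; k = k }
    record { n = n ; G = H ; s = t ; X = Y ; k = l } eq saved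
    with unary-injective m n eq
  ... | refl , eq₁ with toList-++-injective (Vec.concat (Vec.tabulate λ u → Vec.tabulate (Graph.adjacent G u))) (Vec.concat (Vec.tabulate λ u → Vec.tabulate (Graph.adjacent H u))) eq₁
  ... | matrix , eq₂ with toList-++-injective ⁅ s ⁆ ⁅ t ⁆ eq₂
  ... | source , eq₃ with toList-++-injective X Y eq₃
  ... | _ , eq₄ = subst₂ (Firefighting.CanSave H) s≡t k≡l (Transfer.canSave G H same saved)
    where
    same : ∀ u v → Graph.adjacent G u v ≡ Graph.adjacent H u v
    same u = tabulate-injective (tabulate-injective (concat-injective _ _ matrix) u)
    s≡t : s ≡ t
    s≡t = x∈⁅y⁆⇒x≡y t (subst (s ∈_) source (x∈⁅x⁆ s))
    k≡l : k ≡ l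
    k≡l = trans (sym (toℕ-fromℕ k)) (trans (cong ℕᵇ.toℕ (binary-injective _ _ eq₄)) (toℕ-fromℕ l))

-- Symbolic encodings and the number of composed inputs

module Templates where
  open PolynomialBounds
  open FirefighterReduction
  open import Data.Fin.Base using (Fin; zero; suc; toℕ; combine; remQuot; inject≤; finToFun; funToFin)
  open import Data.Fin.Properties as Fin using (remQuot-combine; funToFin-finToFin; inject≤-injective)
  open import Data.Fin.Subset using (Subset; ⁅_⁆)
  open import Data.List.Base as List using (List; []; _∷_; length; _++_; map; replicate)
  open import Data.List.Properties using (length-++; length-map; length-replicate; map-++; map-replicate)
  open import Data.List.Relation.Unary.All as All using (All; []; _∷_)
  import Data.List.Relation.Unary.All.Properties as All
  open import Data.Nat.Base hiding (_⊔_; ∣_-_∣)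
  open import Data.Nat.Binary.Base as ℕᵇ using (ℕᵇ; 2[1+_]; 1+[2_])
  open import Data.Nat.Binary.Properties using (toℕ-fromℕ)
  open import Data.Nat.Properties
  import Data.Vec.Base as Vec
  open import Data.Vec.Base using (Vec; []; _∷_)
  import Data.Vec.Properties as Vec

  module _ {v : ℕ} (adjacentSource : Fin (suc v) → Fin (suc v) → Source) (s : Fin (suc v)) (X : Subset (suc v)) (k : ℕ) where

    -- The first `true` of the unary number `suc v` is left out; the operation `emitFirst` writes
    -- it.
    template : List Source
    template = replicate v (const true) ++ const false ∷
      (Vec.toList (Vec.concat (Vec.tabulate λ u → Vec.tabulate (adjacentSource u))) ++
      (Vec.toList (Vec.map const ⁅ s ⁆) ++ (Vec.toList (Vec.map const X) ++ map const (binary (ℕᵇ.fromℕ k)))))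

    toList-const : ∀ y {n} (p : Subset n) → map (bitOf y) (Vec.toList (Vec.map const p)) ≡ Vec.toList p
    toList-const y []      = refl
    toList-const y (b ∷ p) = cong (b ∷_) (toList-const y p)

    map-const : ∀ y bs → map (bitOf y) (map const bs) ≡ bs
    map-const y []       = refl
    map-const y (b ∷ bs) = cong (b ∷_) (map-const y bs)

    map-template : ∀ y → true ∷ map (bitOf y) template ≡ replicate (suc v) true ++ false ∷
      (Vec.toList (Vec.concat (Vec.tabulate λ u → Vec.tabulate (λ w → bitOf y (adjacentSource u w)))) ++ (Vec.toList ⁅ s ⁆ ++ (Vec.toList X ++ binary (ℕᵇ.fromℕ k))))
    map-template y = cong (true ∷_) (trans (map-++ f (replicate v (const true)) _) (cong₂ _++_ (map-replicate f v (const true)) (cong (false ∷_)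
      (trans (map-++ f (Vec.toList (Vec.concat (Vec.tabulate λ u → Vec.tabulate (adjacentSource u)))) _) (cong₂ _++_ matrix
      (trans (map-++ f (Vec.toList (Vec.map const ⁅ s ⁆)) _) (cong₂ _++_ (toList-const y ⁅ s ⁆)
      (trans (map-++ f (Vec.toList (Vec.map const X)) _) (cong₂ _++_ (toList-const y X) (map-const y (binary (ℕᵇ.fromℕ k))))))))))))
      where
      f = bitOf y
      matrix : map f (Vec.toList (Vec.concat (Vec.tabulate λ u → Vec.tabulate (adjacentSource u)))) ≡
               Vec.toList (Vec.concat (Vec.tabulate λ u → Vec.tabulate (λ w → f (adjacentSource u w))))
      matrix = trans (sym (Vec.toList-map f (Vec.concat rows))) (cong Vec.toList (trans (Vec.map-concat f rows) (cong Vec.concat (trans (sym (Vec.tabulate-∘ (Vec.map f) (λ u → Vec.tabulate (adjacentSource u))))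
        (Vec.tabulate-cong (λ u → sym (Vec.tabulate-∘ f (adjacentSource u))))))))
        where
        rows : Vec (Vec Source (suc v)) (suc v)
        rows = Vec.tabulate λ u → Vec.tabulate (adjacentSource u)

    All-toList : ∀ {A : Set} {Q : A → Set} {n} (xs : Vec A n) → (∀ i → Q (Vec.lookup xs i)) → All Q (Vec.toList xs)
    All-toList []       h = []
    All-toList (x ∷ xs) h = h zero ∷ All-toList xs (h ∘ suc)

    template-All : ∀ {Q : Source → Set} → (∀ b → Q (const b)) → (∀ u w → Q (adjacentSource u w)) → All Q template
    template-All {Q} constant adjacent = All.++⁺ (All.replicate⁺ v (constant true)) (constant false ∷ All.++⁺
      (matrix (Vec.tabulate λ u → Vec.tabulate (adjacentSource u)) (λ u w → subst Q (sym (trans (cong (λ r → Vec.lookup r w) (Vec.lookup∘tabulate (λ u → Vec.tabulate (adjacentSource u)) u)) (Vec.lookup∘tabulate (adjacentSource u) w))) (adjacent u w)))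
      (All.++⁺ (constants ⁅ s ⁆) (All.++⁺ (constants X) (All.map⁺ (All.universal constant (binary (ℕᵇ.fromℕ k)))))))
      where
      constants : ∀ {n} (p : Subset n) → All Q (Vec.toList (Vec.map const p))
      constants p = All-toList (Vec.map const p) (λ i → subst Q (sym (Vec.lookup-map i const p)) (constant _))
      matrix : ∀ {m n} (rows : Vec (Vec Source n) m) → (∀ u w → Q (Vec.lookup (Vec.lookup rows u) w)) → All Q (Vec.toList (Vec.concat rows))
      matrix []           h = []
      matrix (row ∷ rows) h = subst (All Q) (sym (Vec.toList-++ row (Vec.concat rows))) (All.++⁺ (All-toList row (h zero)) (matrix rows (h ∘ suc)))

    binary≤ : ∀ b → length (binary b) ≤ ℕᵇ.toℕ b
    binary≤ ℕᵇ.zero  = z≤n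
    binary≤ 2[1+ b ] = ≤-trans (s≤s (binary≤ b)) (m≤m+n (suc (ℕᵇ.toℕ b)) _)
    binary≤ 1+[2 b ] = s≤s (≤-trans (binary≤ b) (m≤m+n (ℕᵇ.toℕ b) _))

    length-template : length template ≤ v + suc (suc v * suc v + (suc v + (suc v + k)))
    length-template = begin
      length template ≡⟨ length-++ (replicate v (const true)) ⟩
      length (replicate v (const true)) + suc (length (matrix ++ (s′ ++ (X′ ++ k′)))) ≡⟨ cong₂ (λ a b → a + suc b) (length-replicate v) (trans (length-++ matrix) (cong₂ _+_ (vec-length (Vec.concat (Vec.tabulate λ u → Vec.tabulate (adjacentSource u)))) (trans (length-++ s′) (cong₂ _+_ (vec-length (Vec.map const ⁅ s ⁆)) (trans (length-++ X′) (cong₂ _+_ (vec-length (Vec.map const X)) refl)))))) ⟩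
      v + suc (suc v * suc v + (suc v + (suc v + length k′))) ≤⟨ +-monoʳ-≤ v (s≤s (+-monoʳ-≤ (suc v * suc v) (+-monoʳ-≤ (suc v) (+-monoʳ-≤ (suc v) k≤)))) ⟩
      v + suc (suc v * suc v + (suc v + (suc v + k))) ∎
      where
      open ≤-Reasoning
      vec-length : ∀ {A : Set} {n} (xs : Vec A n) → length (Vec.toList xs) ≡ n
      vec-length []       = refl
      vec-length (x ∷ xs) = cong suc (vec-length xs)
      matrix = Vec.toList (Vec.concat (Vec.tabulate λ u → Vec.tabulate (adjacentSource u)))
      s′ = Vec.toList (Vec.map const ⁅ s ⁆)
      X′ = Vec.toList (Vec.map const X)
      k′ = map const (binary (ℕᵇ.fromℕ k))
      k≤ : length k′ ≤ k
      k≤ = ≤-trans (≤-reflexive (length-map const (binary (ℕᵇ.fromℕ k)))) (≤-trans (binary≤ (ℕᵇ.fromℕ k)) (≤-reflexive (toℕ-fromℕ k)))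

  ^-distribʳ-* : ∀ e m n → (m * n) ^ e ≡ m ^ e * n ^ e
  ^-distribʳ-* zero    m n = refl
  ^-distribʳ-* (suc e) m n rewrite ^-distribʳ-* e m n = lemma m n (m ^ e) (n ^ e)
    where
    lemma : ∀ m n p q → m * n * (p * q) ≡ m * p * (n * q)
    lemma = solve-∀

  -- The number 1 + t of inputs has to exceed the bound h (∣X∣) on the size of the kernel, and ∣X∣ depends on the number I of
  -- variables for the index of an input. So an index is a tuple of d digits in base b, in unary, where d
  -- exceeds the degree of h (∣X∣) as a polynomial in b.
  module Size (h : Polynomial) (D : ℕ) where

    e d : ℕ
    e = length h
    d = suc (e + e)

    Q A b I N′ N u coreSize t : ℕ → ℕ
    Q M        = suc M + d
    A M        = coefficientSum h * (suc D * (Q M * Q M)) ^ e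
    b M        = suc (A M)
    I M        = d * b M
    N′ M       = M + I M
    N M        = suc (N′ M)
    u M        = N M * D
    coreSize M = suc (N′ M * suc (N M) + u M)
    t M        = eval h (coreSize M)

    core≤ : ∀ M → coreSize M ≤ suc D * (N M * N M)
    core≤ M = ≤-trans (s≤s (+-monoʳ-≤ (N′ M * suc (N M)) (*-monoʳ-≤ (N M) (m≤m*n D (N M))))) (≤-reflexive (lemma (N′ M) D))
      where
      lemma : ∀ k D → suc (k * suc (suc k) + suc k * (D * suc k)) ≡ suc D * (suc k * suc k)
      lemma = solve-∀

    N≤ : ∀ M → N M ≤ b M * Q M
    N≤ M = ≤-trans (+-mono-≤ (m≤m*n (suc M) (b M)) (≤-refl {d * b M})) (≤-reflexive (trans (sym (*-distribʳ-+ (b M) (suc M) d)) (*-comm (Q M) (b M))))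

    -- As `N ≤ b * Q` and the core is at most `suc D * N * N`, the bound `h` of the core is at most
    -- `A * b ^ (2 * e)`, where `A` does not involve `b`. With `b = 1 + A` one further factor `b`
    -- absorbs both `A` and the added 1, hence `d = 2 * e + 1`.
    room : ∀ M → suc (t M) ≤ b M ^ d
    room M = begin
      suc (t M)                                                      ≤⟨ s≤s (eval≤monomial h {coreSize M} (s≤s z≤n)) ⟩
      suc (coefficientSum h * coreSize M ^ e)                        ≤⟨ s≤s (*-monoʳ-≤ (coefficientSum h) (^-monoˡ-≤ e (≤-trans (core≤ M) (*-monoʳ-≤ (suc D) (*-mono-≤ (N≤ M) (N≤ M)))))) ⟩
      suc (coefficientSum h * (suc D * (B * q * (B * q))) ^ e)       ≡⟨ cong (λ z → suc (coefficientSum h * z ^ e)) (lemma (suc D) B q) ⟩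
      suc (coefficientSum h * (suc D * (q * q) * (B * B)) ^ e)       ≡⟨ cong (λ z → suc (coefficientSum h * z)) (trans (^-distribʳ-* e (suc D * (q * q)) (B * B)) (cong ((suc D * (q * q)) ^ e *_) (^-distribʳ-* e B B))) ⟩
      suc (coefficientSum h * ((suc D * (q * q)) ^ e * (B ^ e * B ^ e))) ≡⟨ cong suc (sym (*-assoc (coefficientSum h) _ _)) ⟩
      suc (A M * (B ^ e * B ^ e))                                    ≤⟨ +-monoˡ-≤ (A M * (B ^ e * B ^ e)) (*-mono-≤ (1≤^ e (s≤s (z≤n {A M}))) (1≤^ e (s≤s (z≤n {A M})))) ⟩
      B * (B ^ e * B ^ e)                                            ≡⟨ cong (B *_) (sym (^-distribˡ-+-* B e e)) ⟩
      B ^ d                                                          ∎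
      where
      open ≤-Reasoning
      B = b M
      q = Q M
      lemma : ∀ D B q → D * (B * q * (B * q)) ≡ D * (q * q) * (B * B)
      lemma = solve-∀

    digits : ∀ M → Fin (suc (t M)) → Fin d → Fin (b M)
    digits M i = finToFun (inject≤ i (room M))

    code : ∀ M → Fin (suc (t M)) → Fin (I M) → Bool
    code M i k = let c , r = remQuot {d} (b M) k in isYes (digits M i c Fin.≟ r)

    funToFin-cong : ∀ {m n} {f g : Fin m → Fin n} → (∀ i → f i ≡ g i) → funToFin f ≡ funToFin g
    funToFin-cong {zero}  h = refl
    funToFin-cong {suc m} h = cong₂ combine (h zero) (funToFin-cong (h ∘ suc))

    code-injective : ∀ M i j → (∀ k → code M i k ≡ code M j k) → i ≡ j
    code-injective M i j same = inject≤-injective (room M) (room M) i j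
      (trans (sym (funToFin-finToFin {d} {b M} (inject≤ i (room M)))) (trans (funToFin-cong digits≡) (funToFin-finToFin {d} {b M} (inject≤ j (room M)))))
      where
      code-combine : ∀ i c r → code M i (combine c r) ≡ isYes (digits M i c Fin.≟ r)
      code-combine i c r = cong (λ (c , r) → isYes (digits M i c Fin.≟ r)) (remQuot-combine {d} {b M} c r)
      digits≡ : ∀ c → digits M i c ≡ digits M j c
      digits≡ c = sym (toWitness {a? = digits M j c Fin.≟ digits M i c} (subst T (trans (sym (code-combine i c (digits M i c))) (trans (same (combine c (digits M i c))) (code-combine j c (digits M i c)))) (fromWitness {a? = digits M i c Fin.≟ digits M i c} refl)))

    module Bounds {M : ℕ → ℕ} (pM : PolyBounded M) where
      pQ : PolyBounded (Q ∘ M)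
      pQ = pb-+ (pb-suc pM) (pb-const d)
      pA : PolyBounded (A ∘ M)
      pA = pb-* (pb-const (coefficientSum h)) (pb-^ (pb-* (pb-const (suc D)) (pb-* pQ pQ)) e)
      pI : PolyBounded (I ∘ M)
      pI = pb-* (pb-const d) (pb-suc pA)
      pN′ : PolyBounded (N′ ∘ M)
      pN′ = pb-+ pM pI
      pN : PolyBounded (N ∘ M)
      pN = pb-suc pN′
      pu : PolyBounded (u ∘ M)
      pu = pb-* pN (pb-const D)
      pcore : PolyBounded (coreSize ∘ M)
      pcore = pb-suc (pb-+ (pb-* pN′ (pb-suc pN)) pu)
      pt : PolyBounded (t ∘ M)
      pt = pb-eval h pcore

-- Composing the inputs of a language in NP into one instance

module OrCompositions where
  open PolynomialBounds
  open FirefighterReduction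
  open AssignmentReduction
  open Tableaux
  open Templates
  open import Data.Fin.Base using (Fin; zero; suc; toℕ; fromℕ<)
  open import Data.Fin.Properties as Fin using (toℕ<n; toℕ-fromℕ<)
  open import Data.Fin.Subset using (∣_∣)
  open import Data.List.Base as List using (List; []; _∷_; length; map; applyDownFrom)
  open import Data.List.Properties using (length-applyDownFrom; ∷-injectiveˡ)
  open import Data.List.Relation.Unary.All as All using (All; []; _∷_)
  open import Data.Maybe.Base as Maybe using (Maybe; just; nothing)
  open import Data.Nat.Base hiding (_⊔_; ∣_-_∣)
  open import Data.Nat.Properties
  open import Data.Vec.Base using ([]; _∷_)

  open ParameterizedProblem SavingKVertices

  -- An address costs as many moves of the head, so this bounds the length of the program and
  -- thereby of the advice.
  Within : ℕ → Source → Set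
  Within W (const _)     = ⊤
  Within W (literal a _) = a < W

  -- The bit of word i at distance a from the end of the word is y (i * n + a).
  record OrComposition (h : Polynomial) (L : Language) : Set where
    field
      t           : ℕ → ℕ
      sources     : ℕ → List Source
      instanceOf  : ℕ → (ℕ → Bool) → FirefighterInstance
      encodes     : ∀ n y → encode (instanceOf n y) ≡ true ∷ map (bitOf y) (sources n)
      correct     : ∀ n y → Yes (instanceOf n y) ⇔ (∃[ i ] i < suc (t n) × L (applyDownFrom (λ a → y (i * n + a)) n))
      small       : ∀ n y → eval h (parameter (instanceOf n y)) ≤ t n
      within      : ∀ n → All (Within (suc (t n) * n)) (sources n)
      t-bounded   : PolyBounded t
      sources-bounded : PolyBounded (λ n → length (sources n))

  -- The formula of `length-template` with upper bounds for the number of vertices and the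
  -- threshold. As a closed expression in `M`, `c` and `n` it can be bounded by a polynomial without
  -- unfolding the composition.
  lengthBound : Polynomial → ℕ → ℕ → ℕ → ℕ → ℕ → ℕ
  lengthBound h D a M c n = V̄ + suc (V̄ * V̄ + (V̄ + (V̄ + k̄)))
    module LengthBound where
    open Size h D
    E R̄ V̄ k̄ : ℕ
    E = c * D ^ suc a + suc (t M) * n
    R̄ = 2 + 2 * E
    V̄ = coreSize M + (u M * (u M * R̄) + 2 * E)
    k̄ = N M + (R̄ * (N M * N M) + 2 * (c + n))

  pb-lengthBound : ∀ h D a {M c} → PolyBounded M → PolyBounded c → PolyBounded (λ n → lengthBound h D a (M n) (c n) n)
  pb-lengthBound h D a pM pc = pb-+ pV (pb-suc (pb-+ (pb-* pV pV) (pb-+ pV (pb-+ pV pk))))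
    where
    open Size.Bounds h D pM
    pE = pb-+ (pb-* pc (pb-const (D ^ suc a))) (pb-* (pb-suc pt) pb-id)
    pR = pb-+ (pb-const 2) (pb-* (pb-const 2) pE)
    pV = pb-+ pcore (pb-+ (pb-* pu (pb-* pu pR)) (pb-* (pb-const 2) pE))
    pk = pb-+ pN (pb-+ (pb-* pR (pb-* pN pN)) (pb-* (pb-const 2) (pb-+ pc pb-id)))

  module FromConstraints
    (h : Polynomial) (M D a : ℕ) (D≥2 : 2 ≤ D)
    (constraints : List (Constraint (suc M) D (suc a)))
    (n : ℕ) (yv : Fin n → Fin (suc M))
    (value : Bool → Fin D) (value-distinct : value true ≢ value false) where

    private module S = Size h D

    address : Fin (suc (S.t M)) → Fin n → ℕ
    address i j = toℕ i * n + toℕ j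

    W : ℕ
    W = suc (S.t M) * n

    address<W : ∀ i j → address i j < W
    address<W i j = begin-strict
      toℕ i * n + toℕ j    <⟨ +-monoʳ-< (toℕ i * n) (toℕ<n j) ⟩
      toℕ i * n + n        ≡⟨ +-comm (toℕ i * n) n ⟩
      suc (toℕ i) * n      ≤⟨ *-monoˡ-≤ n (toℕ<n i) ⟩
      suc (S.t M) * n      ∎
      where open ≤-Reasoning

    open Composition M (S.I M) D a D≥2 constraints n (S.t M) yv value value-distinct (S.code M) (S.code-injective M) address
    open Reduction N′ u edges using (V; core; m; width; adjacency; adjacencySource; X; ∣X∣; decode; Vertex)

    v : ℕ
    v = N′ * width + u + m

    instanceOf : (ℕ → Bool) → FirefighterInstance
    instanceOf y = record { n = V ; G = G ; connected = connected ; s = s ; X = X ; stars = stars ; k = N + goal }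
      where open Scores y

    tmpl : List Source
    tmpl = template {v} adjacencySource zero X (N + goal)

    encodes : ∀ y → encode (instanceOf y) ≡ true ∷ map (bitOf y) tmpl
    encodes y = sym (map-template {v} adjacencySource zero X (N + goal) y)

    -- The parameter is the size of the core, and `t` was defined as the value of `h` there.
    small : ∀ y → eval h (parameter (instanceOf y)) ≤ S.t M
    small y = ≤-reflexive (cong (eval h) ∣X∣)

    within : All (Within W) tmpl
    within = template-All {v} adjacencySource zero X (N + goal) (λ _ → tt) (adjacencySource-All {Within W} (λ _ → tt) (λ i j _ → address<W i j))

    length-tmpl : ∀ {c} → C ≤ c → length tmpl ≤ lengthBound h D a M c n
    length-tmpl {c} C≤c = ≤-trans (length-template {v} adjacencySource zero X (N + goal))
      (+-mono-≤ (≤-trans (n≤1+n v) V≤) (s≤s (+-mono-≤ (*-mono-≤ V≤ V≤) (+-mono-≤ V≤ (+-mono-≤ V≤ k≤)))))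
      where
      open LengthBound h D a M c n
      others≤ : length cubeEdges + length selectEdges ≤ E
      others≤ = +-mono-≤ (≤-trans length-cubeEdges (*-monoˡ-≤ (D ^ suc a) C≤c)) length-selectEdges
      R≤ : R ≤ R̄
      R≤ = +-monoʳ-≤ 2 (*-monoʳ-≤ 2 others≤)
      V≤ : suc v ≤ V̄
      V≤ = +-monoʳ-≤ core (≤-trans length-edges (+-mono-≤ (*-monoʳ-≤ u (*-monoʳ-≤ u R≤)) (*-monoʳ-≤ 2 others≤)))
      k≤ : N + goal ≤ k̄
      k≤ = +-monoʳ-≤ N (+-mono-≤ (*-monoˡ-≤ (N * N) R≤) (*-monoʳ-≤ 2 (+-monoˡ-≤ n C≤c)))

    module Correctness (L : (ℕ → Bool) → Set)
      (assignment⇔ : ∀ f → L f ⇔ (∃[ α ] All (Satisfies α) constraints × (∀ j → α (yv j) ≡ value (f (toℕ j))))) where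

      correct : ∀ y → Yes (instanceOf y) ⇔ (∃[ i ] i < suc (S.t M) × L (λ a → y (i * n + a)))
      correct y = mk⇔ to from
        where
        open Scores y
        to : Yes (instanceOf y) → ∃[ i ] i < suc (S.t M) × L (λ a → y (i * n + a))
        to saved = let α , sat , i , bits = can-save⇒solution saved in toℕ i , toℕ<n i , Equivalence.from (assignment⇔ (λ a → y (toℕ i * n + a))) (α , sat , bits)
        from : ∃[ i ] i < suc (S.t M) × L (λ a → y (i * n + a)) → Yes (instanceOf y)
        from (i , i< , l) = let α , sat , bits = Equivalence.to (assignment⇔ (λ a → y (i * n + a))) l in
          solution⇒can-save (α , sat , fromℕ< i< , λ j → trans (bits j) (cong (λ i → value (y (i * n + toℕ j))) (sym (toℕ-fromℕ< i<))))

  length-pair : ∀ x w → length (pair (x , w)) ≡ suc (2 * length x + length w)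
  length-pair []      w = refl
  length-pair (b ∷ x) w = trans (cong (λ k → 2 + k) (length-pair x w)) (lemma (length x) (length w))
    where
    lemma : ∀ a b → 3 + (2 * a + b) ≡ 1 + (2 * (1 + a) + b)
    lemma = solve-∀

  orComposition : ∀ h {L} → NP L → OrComposition h L
  orComposition h {L} (V , (machine , q , runs) , p , spec) = record
    { t                = t
    ; sources          = λ n → At.tmpl n
    ; instanceOf       = λ n → At.instanceOf n
    ; encodes          = λ n → At.encodes n
    ; correct          = λ n → At.Correctness.correct n (λ f → L (applyDownFrom f n)) (assignment⇔ n)
    ; small            = λ n → At.small n
    ; within           = λ n → At.within n
    ; t-bounded        = Size.Bounds.pt h D pM
    ; sources-bounded  = pb-≤ (λ n → At.length-tmpl n (CL.length-constraints n)) (pb-lengthBound h D arity pM pc)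
    }
    where
    open TuringMachine machine using (auxSymbols; states; workTapes)

    P K : ℕ → ℕ
    P n = eval p n
    -- The time bound at the length of `pair (x , w)` for the longest admissible `w`.
    K n = eval q (suc (2 * n + P n))

    module CL (n : ℕ) = CookLevin machine (K n) (P n) n

    D arity : ℕ
    D     = 3 + (auxSymbols + states)
    arity = 4 + suc workTapes

    M : ℕ → ℕ
    -- `N₀` is a product of successors, so `suc (M n)` computes to it.
    M n = pred (CL.N₀ n)

    module At (n : ℕ) = FromConstraints h (M n) D arity (s≤s (s≤s z≤n)) (CL.constraints n) n (CL.inputVar n) (CL.codeSymbol n ∘ bit) (λ ())

    t : ℕ → ℕ
    t n = Size.t h D (M n)

    pP : PolyBounded P
    pP = p , λ n → ≤-refl

    pK : PolyBounded K
    pK = pb-eval q (pb-suc (pb-+ (pb-* (pb-const 2) pb-id) pP))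

    pw : PolyBounded (λ n → CL.w n)
    pw = pb-suc (pb-+ pK (pb-+ pK (pb-* (pb-const 2) pb-id)))

    pwidth : PolyBounded (λ n → CL.width n)
    pwidth = pb-+ (pb-const 2) pw

    pM : PolyBounded M
    pM = pb-≤ (λ n → pred[n]≤n) (pb-* (pb-suc pK) (pb-suc (pb-* (pb-const (suc workTapes)) pwidth)))

    pc : PolyBounded (λ n → 2 + (K n + (suc workTapes * CL.width n + K n * (suc workTapes * CL.w n))))
    pc = pb-+ (pb-const 2) (pb-+ pK (pb-+ (pb-* (pb-const (suc workTapes)) pwidth) (pb-* pK (pb-* (pb-const (suc workTapes)) pw))))

    open Steps machine

    -- The verifier may halt earlier on shorter witnesses; its halting configuration then persists
    -- up to the common time `K n`.
    accepted⇔ : ∀ n f → L (applyDownFrom f n) ⇔ CL.Correct.Accepted n f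
    accepted⇔ n f = mk⇔ to from
      where
      x = applyDownFrom f n
      bounded : ∀ w → length w ≤ P n → eval q (length (pair (x , w))) ≤ K n
      bounded w w≤ = evalMono q (≤-trans (≤-reflexive (trans (length-pair x w) (cong (λ l → suc (2 * l + length w)) (length-applyDownFrom f n)))) (s≤s (+-monoʳ-≤ (2 * n) w≤)))
      final : ∀ w → length w ≤ P n → ∃[ c ] output c ≡ V (x , w) ∷ [] × steps (initial (pair (x , w))) (K n) ≡ c × step c ≡ nothing
      final w w≤ = ran (run (eval q (length (pair (x , w)))) (initial (pair (x , w)))) refl (runs (x , w))
        where
        ran : ∀ r → run (eval q (length (pair (x , w)))) (initial (pair (x , w))) ≡ r → Maybe.map output r ≡ just (V (x , w) ∷ []) →
              ∃[ c ] output c ≡ V (x , w) ∷ [] × steps (initial (pair (x , w))) (K n) ≡ c × step c ≡ nothing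
        ran (just c) r out = let s , h = run-longer (bounded w w≤) r in c , just-injective out , s , h
      to : L x → CL.Correct.Accepted n f
      to l with Equivalence.to (spec x) l
      ... | w , w≤ , t with final w (subst (λ l → length w ≤ eval p l) (length-applyDownFrom f n) w≤)
      ...   | c , out , s , h = w , subst (λ l → length w ≤ eval p l) (length-applyDownFrom f n) w≤ , trans (cong step s) h , trans (cong output s) (trans out (cong (_∷ []) (is-true t)))
        where
        is-true : ∀ {b} → T b → b ≡ true
        is-true {true} _ = refl
      from : CL.Correct.Accepted n f → L x
      from (w , w≤ , _ , acc) with final w w≤
      ... | c , out , s , _ = Equivalence.from (spec x) (w , subst (λ l → length w ≤ eval p l) (sym (length-applyDownFrom f n)) w≤
          , subst T (sym (∷-injectiveˡ (trans (sym out) (trans (cong output (sym s)) acc)))) _)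

    assignment⇔ : ∀ n f → L (applyDownFrom f n) ⇔ CL.Correct.Assignment n f
    assignment⇔ n f = mk⇔
      (Equivalence.to (CL.Correct.accepted⇔assignment n f) ∘ Equivalence.to (accepted⇔ n f))
      (Equivalence.from (accepted⇔ n f) ∘ Equivalence.from (CL.Correct.accepted⇔assignment n f))

-- From a kernel to advice for the complement

module Distillation where
  open PolynomialBounds
  open Sums
  open FirefighterReduction using (const; literal; bitOf)
  open Interpreters
  open Covers
  open Encodings using (encode-Yes)
  open OrCompositions
  open import Data.Bool.ListAction using (any; all)
  open import Data.Bool.Properties using (T-∧)
  import Data.Bool.Properties as Bool
  open import Data.Fin.Base using (Fin; zero; suc; toℕ)
  open import Data.Fin.Properties using (toℕ<n)
  open import Data.List.Base as List using (List; []; _∷_; [_]; length; _++_; map; concat; concatMap; replicate; reverse; _ʳ++_; applyUpTo; applyDownFrom; filter)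
  open import Data.List.Properties using (length-++; length-map; length-replicate; length-applyUpTo; length-reverse; reverse-involutive; reverse-applyUpTo; length-filter; ≡-dec)
  open import Data.List.Membership.Propositional using (_∈_; find; lose)
  open import Data.List.Membership.Propositional.Properties using (∈-filter⁺; ∈-filter⁻)
  open import Data.List.Relation.Unary.All as All using (All; []; _∷_)
  import Data.List.Relation.Unary.All.Properties as All
  open import Data.List.Relation.Unary.Any as Any using (Any; here; there)
  import Data.List.Relation.Unary.Any.Properties as Any
  open import Data.Maybe.Base as Maybe using (Maybe; just)
  open import Data.Nat.Base using (ℕ; zero; suc; _+_; _*_; _≤_; _<_; z≤n; s≤s; z<s)
  open import Data.Nat.Properties
  import Data.Vec.Base as Vec
  open import Relation.Unary using (_⊆_)

  open ParameterizedProblem SavingKVertices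

  applyUpTo-nthBit : ∀ r → applyUpTo (nthBit r) (length r) ≡ r
  applyUpTo-nthBit []      = refl
  applyUpTo-nthBit (b ∷ r) = cong (b ∷_) (applyUpTo-nthBit r)

  applyUpTo-cong : ∀ {A : Set} {f g : ℕ → A} n → (∀ a → a < n → f a ≡ g a) → applyUpTo f n ≡ applyUpTo g n
  applyUpTo-cong zero    h = refl
  applyUpTo-cong (suc n) h = cong₂ _∷_ (h 0 z<s) (applyUpTo-cong n (λ a a<n → h (suc a) (s≤s a<n)))

  applyDownFrom-bits : ∀ {n} r (f : ℕ → Bool) → length r ≡ n → (∀ a → a < n → f a ≡ nthBit r a) → applyDownFrom f n ≡ reverse r
  applyDownFrom-bits r f refl h = trans (sym (reverse-applyUpTo f (length r))) (cong reverse (trans (applyUpTo-cong (length r) h) (applyUpTo-nthBit r)))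

  nthBit-++ˡ : ∀ r s a → a < length r → nthBit (r ++ s) a ≡ nthBit r a
  nthBit-++ˡ (b ∷ r) s zero    _         = refl
  nthBit-++ˡ (b ∷ r) s (suc a) (s≤s a<r) = nthBit-++ˡ r s a a<r

  nthBit-++ʳ : ∀ r s a → nthBit (r ++ s) (length r + a) ≡ nthBit s a
  nthBit-++ʳ []      s a = refl
  nthBit-++ʳ (b ∷ r) s a = nthBit-++ʳ r s a

  Block : ℕ → List Word → ℕ → Word → Set
  Block n ys i r = ∀ a → a < n → nthBit (concat ys) (i * n + a) ≡ nthBit r a

  block-here : ∀ {n} r ys → length r ≡ n → Block n (r ∷ ys) 0 r
  block-here r ys refl a a<n = nthBit-++ˡ r (concat ys) a a<n

  block-there : ∀ {n} r ys i q → length r ≡ n → Block n ys i q → Block n (r ∷ ys) (suc i) q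
  block-there {n} r ys i q refl block a a<n =
    trans (cong (nthBit (r ++ concat ys)) (+-assoc n (i * n) a)) (trans (nthBit-++ʳ r (concat ys) (i * n + a)) (block a a<n))

  block-at : ∀ {n} ys i → All (λ r → length r ≡ n) ys → i < length ys → ∃[ r ] r ∈ ys × Block n ys i r
  block-at (r ∷ ys) zero    (l ∷ _)  _         = r , here refl , block-here r ys l
  block-at (r ∷ ys) (suc i) (l ∷ ls) (s≤s i<) = let q , q∈ , block = block-at ys i ls i< in q , there q∈ , block-there r ys i q l block

  block-of : ∀ {n} ys {r} → All (λ r → length r ≡ n) ys → r ∈ ys → ∃[ i ] i < length ys × Block n ys i r
  block-of (r ∷ ys) (l ∷ _)  (here refl) = 0 , z<s , block-here r ys l
  block-of (q ∷ ys) {r} (l ∷ ls) (there i)   = let j , j< , block = block-of ys ls i in suc j , s≤s j< , block-there q ys j r l block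

  length-concat : ∀ {n} (ys : List Word) → All (λ r → length r ≡ n) ys → length (concat ys) ≡ length ys * n
  length-concat []       []         = refl
  length-concat (r ∷ ys) (refl ∷ ls) = trans (length-++ r) (cong (λ k → length r + k) (length-concat ys ls))

  length-concatMap-All : ∀ {A B : Set} (g : A → List B) {xs c} → All (λ x → length (g x) ≤ c) xs → length (concatMap g xs) ≤ length xs * c
  length-concatMap-All g []                = z≤n
  length-concatMap-All g {x ∷ xs} (p ∷ ps) = ≤-trans (≤-reflexive (length-++ (g x))) (+-mono-≤ p (length-concatMap-All g ps))

  length-opBits : ∀ o → length (opBits o) ≤ 19
  length-opBits o = ≤-trans (≤-reflexive (trans (length-++ (replicate (toℕ (opcode o)) false)) (trans (cong (_+ 1) (length-replicate (toℕ (opcode o)))) (+-comm (toℕ (opcode o)) 1)))) (toℕ<n (opcode o))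

  length-programBits : ∀ os → length (programBits os) ≤ length os * 19
  length-programBits os = length-concatMap-≤ opBits os length-opBits

  sameBit⇒≡ : ∀ {a b} → T (sameBit a b) → b ≡ a
  sameBit⇒≡ {true}  {true}  _ = refl
  sameBit⇒≡ {false} {false} _ = refl

  ≡⇒sameBit : ∀ {a b} → b ≡ a → T (sameBit a b)
  ≡⇒sameBit {true}  refl = _
  ≡⇒sameBit {false} refl = _

  length-pair≥ : ∀ x w → length x ≤ length (pair (x , w))
  length-pair≥ x w = ≤-trans (≤-trans (m≤m+n (length x) _) (≤-trans (m≤m+n (2 * length x) (length w)) (n≤1+n _))) (≤-reflexive (sym (length-pair x w)))

  -- Exhaustive search over witnesses. It lets the rejected words be filtered out and the final
  -- double negation be removed constructively.
  decide : ∀ {L} → NP L → ∀ x → Dec (L x)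
  decide (V , _ , p , spec) x with boundedWitness? (eval p (length x)) (λ w → V (x , w))
  ... | yes found = yes (Equivalence.from (spec x) found)
  ... | no none   = no (none ∘ Equivalence.to (spec x))

  -- The advice for length n selects outputs of the kernel on no-instances so that every word of length n outside L occurs
  -- in a tuple whose instance has a selected output; the witness is such a tuple.
  module Advice
    (kernel : FirefighterInstance → FirefighterInstance)
    (K : TuringMachine) (pK : Polynomial)
    (runs : ∀ I → Execution.OutputsWithin K (eval pK (length (encode I))) (encode I) (encode (kernel I)))
    (kernel⇔ : ∀ I → Yes I ⇔ Yes (kernel I))
    (h : Polynomial) (small-kernel : ∀ I → length (encode (kernel I)) ≤ eval h (parameter I))
    {L : Language} (L? : ∀ x → Dec (L x)) (composition : OrComposition h L) where

    open OrComposition composition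
    open Interpreter K
    open Machine finiteControl

    outputOn : ℕ → (ℕ → Bool) → Word
    outputOn n y = encode (kernel (instanceOf n y))

    output-short : ∀ n y → length (outputOn n y) ≤ t n
    output-short n y = ≤-trans (small-kernel (instanceOf n y)) (small n y)

    module ForLength (n : ℕ) where

      m : ℕ
      m = t n

      f : List Word → Word
      f ys = outputOn n (nthBit (concat ys))

      -- Words are reversed because the machine reads its input in reverse.
      Rejected : Word → Set
      Rejected r = length r ≡ n × ¬ L (reverse r)

      rejected? : ∀ r → Dec (Rejected r)
      rejected? r = (length r ≟ n) ×-dec ¬? (L? (reverse r))

      candidates : List Word
      candidates = filter rejected? (wordsUpTo n)

      ∈candidates⇒rejected : ∀ {r} → r ∈ candidates → Rejected r
      ∈candidates⇒rejected r∈ = proj₂ (∈-filter⁻ rejected? {xs = wordsUpTo n} r∈)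

      -- Kernels have at most `m` bits, so there are fewer than `2 ^ suc m` values and tuples of
      -- `suc m` words suffice.
      open Covering (≡-dec Bool._≟_) (≡-dec Bool._≟_) (suc m) f candidates (wordsUpTo m) (length-wordsUpTo m)
        (λ ys _ → ∈-wordsUpTo m (f ys) (output-short n (nthBit (concat ys))))

      -- There are fewer than `2 ^ suc n` candidates, so at most `suc n` kernels are selected.
      open Cover (cover (suc n) candidates id (≤-trans (s≤s (length-filter rejected? (wordsUpTo n))) (length-wordsUpTo n))) public

      tuple-rejected : ∀ {ys} → ys ∈ tuples (suc m) candidates → length ys ≡ suc m × All Rejected ys
      tuple-rejected ys∈ = let l , all = ∈-tuples⁻ (suc m) candidates ys∈ in l , All.map ∈candidates⇒rejected all

      tuple-no : ∀ {ys} → ys ∈ tuples (suc m) candidates → ¬ Yes (instanceOf n (nthBit (concat ys)))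
      tuple-no {ys} ys∈ yes′ with tuple-rejected ys∈ | Equivalence.to (correct n (nthBit (concat ys))) yes′
      ... | l , rejected | i , i< , Lx with block-at ys i (All.map proj₁ rejected) (subst (i <_) (sym l) i<)
      ...   | r , r∈ , block = proj₂ (All.lookup rejected r∈) (subst L (applyDownFrom-bits r _ (proj₁ (All.lookup rejected r∈)) block) Lx)

      selection-no : ∀ {z} → z ∈ selection → ∃[ I ] ¬ Yes (kernel I) × encode (kernel I) ≡ z
      selection-no z∈ with sound z∈
      ... | _ , _ , covers with find covers
      ...   | ys , ys∈ , _ , eq = instanceOf n (nthBit (concat ys)) , tuple-no ys∈ ∘ Equivalence.from (kernel⇔ _) , eq

      selection-short : ∀ {z} → z ∈ selection → length z ≤ m
      selection-short z∈ with sound z∈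
      ... | _ , _ , covers with find covers
      ...   | ys , _ , _ , refl = output-short n (nthBit (concat ys))

      rows : List (List (ℕ × ℕ))
      rows = applyUpTo (λ i → applyUpTo (λ a → a , i * n + a) n) (suc m)

      -- Instances for all `y` have encodings of one length, so a single number of steps, known when
      -- the program is written, is enough for the kernel.
      time : ℕ
      time = eval pK (suc (length (sources n)))

      prog : List Op
      prog = program rows (sources n) time selection

      advice : Word
      advice = reverse (programBits prog)

      kernel-output : ∀ y → outputOf (Vec.head (proj₂ (KS.steps (KS.initial (true ∷ map (bitOf y) (sources n))) time))) ≡ outputOn n y
      kernel-output y = go (Execution.run K (eval pK (length (encode I))) (KS.initial (encode I))) refl (runs I)
        where
        I = instanceOf n y
        u = true ∷ map (bitOf y) (sources n)
        output-head : ∀ c → Execution.output K c ≡ outputOf (Vec.head (proj₂ c))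
        output-head (_ , t Vec.∷ _) = refl
        time≡ : eval pK (length (encode I)) ≡ time
        time≡ = cong (eval pK) (trans (cong length (encodes n y)) (cong suc (length-map (bitOf y) (sources n))))
        go : ∀ r → Execution.run K (eval pK (length (encode I))) (KS.initial (encode I)) ≡ r → Maybe.map (Execution.output K) r ≡ just (encode (kernel I)) →
             outputOf (Vec.head (proj₂ (KS.steps (KS.initial u) time))) ≡ outputOn n y
        go (just c) r out = trans (cong (outputOf ∘ Vec.head ∘ proj₂) (trans (cong₂ (λ u t → KS.steps (KS.initial u) t) (sym (encodes n y)) (sym time≡)) (proj₁ (KS.run⇒steps (eval pK (length (encode I))) r))))
          (trans (sym (output-head c)) (just-injective out))

    read-input : ∀ x a w xs → readWord (pair (pair (x , a) , w)) (R₀ , [] , xs , []) ≡ readWord (pair (a , w)) (R₄ , [] , x ʳ++ xs , [])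
    read-input []      a w xs = refl
    read-input (b ∷ x) a w xs = read-input x a w (b ∷ xs)

    read-program : ∀ a w ps xs → readWord (pair (a , w)) (R₄ , ps , xs , []) ≡ readWord w (R₆ , a ʳ++ ps , xs , [])
    read-program []      w ps xs = refl
    read-program (b ∷ a) w ps xs = read-program a w (b ∷ ps) xs

    read-witness : ∀ w ps xs ws → readWord w (R₆ , ps , xs , ws) ≡ (R₆ , ps , xs , w ʳ++ ws)
    read-witness []      ps xs ws = refl
    read-witness (b ∷ w) ps xs ws = read-witness w ps xs (b ∷ ws)

    verdict-of : ∀ x os w → verdict (pair (pair (x , reverse (programBits os)) , w)) ≡ accepted (execs os (initialState (reverse x) (reverse w)))
    verdict-of x os w = trans (cong (λ s → verdict′ s) (trans (read-input x a w []) (trans (read-program a w [] (reverse x)) (read-witness w (reverse a) (reverse x) []))))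
      (trans (cong (λ ps → accepted (proj₂ (execBits ps (zero , initialState (reverse x) (reverse w))))) (reverse-involutive (programBits os)))
        (cong (accepted ∘ proj₂) (execBits-program os (initialState (reverse x) (reverse w)))))
      where
      a = reverse (programBits os)
      verdict′ : Fin 7 × Words → Bool
      verdict′ (_ , ps , xs , ws) = accepted (proj₂ (execBits ps (zero , initialState xs ws)))

    module Verdict (n : ℕ) (x : Word) (∣x∣ : length x ≡ n) where
      open ForLength n

      ∣x∣ʳ : length (reverse x) ≡ n
      ∣x∣ʳ = trans (length-reverse x) ∣x∣

      verdict≡ : ∀ w → let y = nthBit (reverse w) in
        verdict (pair (pair (x , advice) , w)) ≡
        any (all (agrees (nthBit (reverse x)) y)) rows ∧ any (λ z → matches true z (Vec.head (proj₂ (KS.steps (KS.initial (true ∷ map (bitOf y) (sources n))) time)))) selection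
      verdict≡ w = trans (verdict-of x prog w) (execs-program rows (sources n) time selection (reverse x) (reverse w))

      -- The witness need not be a tuple of rejected words. If `x` is one of its blocks and lies in
      -- `L`, the composed instance and its kernel are yes-instances, but the word of this kernel
      -- was selected as that of a no-instance.
      verdict-sound : ∀ w → T (verdict (pair (pair (x , advice) , w))) → ¬ L x
      verdict-sound w v Lx = proj₁ (proj₂ no-kernel) (encode-Yes (kernel I) (kernel (proj₁ no-kernel)) same-encoding yes-kernel)
        where
        y = nthBit (reverse w)
        I = instanceOf n y
        parts = Equivalence.to (T-∧ {any (all (agrees (nthBit (reverse x)) y)) rows}) (subst T (verdict≡ w) v)
        row = Any.applyUpTo⁻ (λ i → applyUpTo (λ a → a , i * n + a) n) (Any.any⁻ (all (agrees (nthBit (reverse x)) y)) rows (proj₁ parts))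
        i = proj₁ row
        bits : ∀ a → a < n → y (i * n + a) ≡ nthBit (reverse x) a
        bits a a<n = sameBit⇒≡ (All.applyUpTo⁻ (λ a → a , i * n + a) n
          (All.all⁺ (agrees (nthBit (reverse x)) y) (applyUpTo (λ a → a , i * n + a) n) (proj₂ (proj₂ row))) a<n)
        yes-kernel : Yes (kernel I)
        yes-kernel = Equivalence.to (kernel⇔ I) (Equivalence.from (correct n y) (i , proj₁ (proj₂ row) ,
          subst L (sym (trans (applyDownFrom-bits (reverse x) (λ a → y (i * n + a)) ∣x∣ʳ bits) (reverse-involutive x))) Lx))
        matched = find (Any.any⁻ _ selection (proj₂ parts))
        no-kernel = selection-no (proj₁ (proj₂ matched))
        same-encoding : encode (kernel I) ≡ encode (kernel (proj₁ no-kernel))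
        same-encoding = trans (sym (kernel-output y)) (trans (proj₂ (matches⁻ true (proj₁ matched) _ (proj₂ (proj₂ matched)))) (sym (proj₂ (proj₂ no-kernel))))

      -- The covering provides a tuple of rejected words through `x` whose kernel is selected; its
      -- concatenation, reversed for the reader, is the witness.
      verdict-complete : ¬ L x → ∃[ w ] length w ≤ suc m * n × T (verdict (pair (pair (x , advice) , w)))
      verdict-complete ¬Lx = w , ≤-reflexive (trans (length-reverse (concat ys)) (trans (length-concat ys (All.map proj₁ (proj₂ ys-rejected))) (cong (_* n) (proj₁ ys-rejected))))
          , subst T (sym (verdict≡ w)) (Equivalence.from T-∧ (input-found , output-found))
        where
        r∈ : reverse x ∈ candidates
        r∈ = ∈-filter⁺ rejected? (∈-wordsUpTo n (reverse x) (≤-reflexive ∣x∣ʳ)) (∣x∣ʳ , ¬Lx ∘ subst L (reverse-involutive x))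
        selected = complete r∈
        covering = find (proj₂ (proj₂ selected))
        ys = proj₁ covering
        ys-rejected = tuple-rejected (proj₁ (proj₂ covering))
        w = reverse (concat ys)
        y = nthBit (reverse w)
        reversed : reverse w ≡ concat ys
        reversed = reverse-involutive (concat ys)
        located = block-of ys (All.map proj₁ (proj₂ ys-rejected)) (proj₁ (proj₂ (proj₂ covering)))
        input-found : T (any (all (agrees (nthBit (reverse x)) y)) rows)
        input-found = Any.any⁺ (all (agrees (nthBit (reverse x)) y)) (Any.applyUpTo⁺ (λ i → applyUpTo (λ a → a , i * n + a) n)
          (All.all⁻ (agrees (nthBit (reverse x)) y) (All.applyUpTo⁺₁ (λ a → a , proj₁ located * n + a) n
            (λ {a} a<n → ≡⇒sameBit (trans (cong (λ u → nthBit u (proj₁ located * n + a)) reversed) (proj₂ (proj₂ located) a a<n)))))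
          (subst (proj₁ located <_) (proj₁ ys-rejected) (proj₁ (proj₂ located))))
        output-found : T (any (λ z → matches true z (Vec.head (proj₂ (KS.steps (KS.initial (true ∷ map (bitOf y) (sources n))) time)))) selection)
        output-found = Any.any⁺ _ (lose (proj₁ (proj₂ selected)) (matches⁺ true (proj₁ selected) _ tt
          (trans (kernel-output y) (trans (cong (λ u → outputOn n (nthBit u)) reversed) (proj₂ (proj₂ (proj₂ covering)))))))

    -- One summand for each segment of `program`: input tests, emissions, `emitFirst`, steps of the
    -- kernel and output tests. The factor 19 bounds the code of an operation.
    adviceBound : ℕ → ℕ
    adviceBound n = (suc (t n) * (n * (n + W + 1 + (W + n)) + 2) + (length (sources n) * (W + 1 + W + 1) + (1 + (eval pK (suc (length (sources n))) + suc n * (t n * 2 + 1 + (t n + 1) + 1))))) * 19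
      where
      W : ℕ
      W = suc (t n) * n

    pb-adviceBound : PolyBounded adviceBound
    pb-adviceBound = pb-* (pb-+ (pb-* pt (pb-+ (pb-* pb-id (pb-+ (pb-+ (pb-+ pb-id pW) (pb-const 1)) (pb-+ pW pb-id))) (pb-const 2)))
      (pb-+ (pb-* sources-bounded (pb-+ (pb-+ (pb-+ pW (pb-const 1)) pW) (pb-const 1)))
        (pb-+ (pb-const 1) (pb-+ (pb-eval pK (pb-suc sources-bounded))
          (pb-* (pb-suc pb-id) (pb-+ (pb-+ (pb-+ (pb-* t-bounded (pb-const 2)) (pb-const 1)) (pb-+ t-bounded (pb-const 1))) (pb-const 1))))))) (pb-const 19)
      where
      pt : PolyBounded (λ n → suc (t n))
      pt = pb-suc t-bounded
      pW : PolyBounded (λ n → suc (t n) * n)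
      pW = pb-* pt pb-id

    length-comparison : ∀ a c → length (comparison (a , c)) ≡ suc a + suc c + 1 + (suc c + suc a)
    length-comparison a c = trans (length-++ (replicate (suc a) leftX ++ replicate (suc c) leftW))
      (trans (cong₂ _+_ (trans (length-++ (replicate (suc a) leftX)) (cong₂ _+_ (length-replicate (suc a)) (length-replicate (suc c))))
        (cong suc (trans (length-++ (replicate (suc c) rightW)) (cong₂ _+_ (length-replicate (suc c)) (length-replicate (suc a))))))
      (sym (+-assoc (suc a + suc c) 1 (suc c + suc a))))

    length-inputTest : ∀ ps {c} → All (λ q → length (comparison q) ≤ c) ps → length (inputTest ps) ≤ length ps * c + 2
    length-inputTest ps {c} all = ≤-trans (s≤s (≤-trans (≤-reflexive (length-++ (concatMap comparison ps))) (+-monoˡ-≤ 1 (length-concatMap-All comparison all))))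
      (≤-reflexive (sym (+-suc (length ps * c) 1)))

    length-emission : ∀ {W} o → Within W o → length (emission o) ≤ W + 1 + W + 1
    length-emission {W} (const b)     _   = m≤n+m 1 (W + 1 + W)
    length-emission {W} (literal a b) a<W = ≤-trans (≤-reflexive (trans (length-++ (replicate (suc a) leftW)) (cong₂ (λ i j → i + suc j) (length-replicate (suc a)) (length-replicate (suc a)))))
      (≤-trans (+-mono-≤ a<W (s≤s a<W)) (≤-trans (≤-reflexive (lemma W)) (m≤m+n (W + 1 + W) 1)))
      where
      lemma : ∀ W → W + (1 + W) ≡ W + 1 + W
      lemma = solve-∀

    length-outputTest : ∀ z → length (outputTest z) ≡ length z * 2 + 1 + (length z + 1) + 1
    length-outputTest z = trans (cong suc (trans (length-++ (checks z)) (cong₂ _+_ (trans (length-++ (concatMap (λ b → check b ∷ rightK ∷ []) z)) (cong (_+ 1) (body z))) (trans (cong suc (length-replicate (length z))) (+-comm 1 (length z)))))) (+-comm 1 _)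
      where
      body : ∀ z → length (concatMap (λ b → check b ∷ rightK ∷ []) z) ≡ length z * 2
      body []      = refl
      body (b ∷ z) = cong (λ k → 2 + k) (body z)

    advice-short : ∀ n → length (ForLength.advice n) ≤ adviceBound n
    advice-short n = ≤-trans (≤-reflexive (length-reverse (programBits prog))) (≤-trans (length-programBits prog) (*-monoˡ-≤ 19 (begin
      length prog
        ≡⟨ trans (length-++ (concatMap inputTest rows)) (cong (λ k → length (concatMap inputTest rows) + k) (trans (length-++ (concatMap emission (reverse (sources n)))) (cong (λ k → length (concatMap emission (reverse (sources n))) + suc k) (trans (length-++ (replicate time stepK)) (cong (_+ length (concatMap outputTest selection)) (length-replicate time)))))) ⟩
      length (concatMap inputTest rows) + (length (concatMap emission (reverse (sources n))) + (1 + (time + length (concatMap outputTest selection))))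
        ≤⟨ +-mono-≤ inputs (+-mono-≤ emissions (+-monoʳ-≤ 1 (+-monoʳ-≤ time outputs))) ⟩
      suc m * (n * (n + W + 1 + (W + n)) + 2) + (length (sources n) * (W + 1 + W + 1) + (1 + (time + suc n * (m * 2 + 1 + (m + 1) + 1)))) ∎)))
      where
      open ≤-Reasoning
      open ForLength n
      W = suc m * n
      address< : ∀ {i a} → i < suc m → a < n → i * n + a < W
      address< {i} {a} i< a<n = ≤-trans (≤-trans (+-monoʳ-< (i * n) a<n) (≤-reflexive (+-comm (i * n) n))) (*-monoˡ-≤ n i<)
      inputs : length (concatMap inputTest rows) ≤ suc m * (n * (n + W + 1 + (W + n)) + 2)
      inputs = ≤-trans (length-concatMap-All inputTest (All.applyUpTo⁺₁ (λ i → applyUpTo (λ a → a , i * n + a) n) (suc m) (λ {i} i< →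
          ≤-trans (length-inputTest (applyUpTo (λ a → a , i * n + a) n) {n + W + 1 + (W + n)} (All.applyUpTo⁺₁ (λ a → a , i * n + a) n (λ {a} a<n →
            ≤-trans (≤-reflexive (length-comparison a (i * n + a))) (+-mono-≤ (+-monoˡ-≤ 1 (+-mono-≤ a<n (address< i< a<n))) (+-mono-≤ (address< i< a<n) a<n)))))
          (≤-reflexive (cong (λ l → l * (n + W + 1 + (W + n)) + 2) (length-applyUpTo (λ a → a , i * n + a) n))))))
        (≤-reflexive (cong (_* (n * (n + W + 1 + (W + n)) + 2)) (length-applyUpTo (λ i → applyUpTo (λ a → a , i * n + a) n) (suc m))))
      emissions : length (concatMap emission (reverse (sources n))) ≤ length (sources n) * (W + 1 + W + 1)
      emissions = ≤-trans (length-concatMap-All emission (All.tabulate (λ {o} o∈ → length-emission o (All.lookup (within n) (Any.reverse⁻ o∈)))))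
        (≤-reflexive (cong (_* (W + 1 + W + 1)) (length-reverse (sources n))))
      outputs : length (concatMap outputTest selection) ≤ suc n * (m * 2 + 1 + (m + 1) + 1)
      outputs = ≤-trans (length-concatMap-All outputTest (All.tabulate (λ {z} z∈ → ≤-trans (≤-reflexive (length-outputTest z))
          (+-monoˡ-≤ 1 (+-mono-≤ (+-monoˡ-≤ 1 (*-monoˡ-≤ 2 (selection-short z∈))) (+-monoˡ-≤ 1 (selection-short z∈)))))))
        (*-monoˡ-≤ (m * 2 + 1 + (m + 1) + 1) size)

    witness-bounded : PolyBounded (λ n → suc (t n) * n)
    witness-bounded = pb-* (pb-suc t-bounded) pb-id

    Refuted : Word → Set
    Refuted z = ∃[ w ] length w ≤ eval (proj₁ witness-bounded) (length z) × T (verdict (pair (z , w)))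

    refuted? : ∀ z → Dec (Refuted z)
    refuted? z = boundedWitness? (eval (proj₁ witness-bounded) (length z)) (λ w → verdict (pair (z , w)))

    refuted⇔ : ∀ x → Refuted (pair (x , ForLength.advice (length x))) ⇔ (¬ L x)
    refuted⇔ x = mk⇔ (λ (w , _ , v) → verdict-sound w v) (λ ¬Lx → let w , w≤ , v = verdict-complete ¬Lx in
        w , ≤-trans w≤ (≤-trans (proj₂ witness-bounded (length x)) (evalMono (proj₁ witness-bounded) (length-pair≥ x (ForLength.advice (length x))))) , v)
      where open Verdict (length x) x refl

    coNP/poly : (coNP /poly) L
    coNP/poly = ¬_ ∘ Refuted
      , ( (λ zw → verdict (pair zw))
        , (machine , 2 ∷ 2 ∷ [] , λ zw → machine-outputs (pair zw))
        , proj₁ witness-bounded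
        -- Here `coNP` asks for an NP description of the doubly negated `Refuted`; deciding it by
        -- search removes the negations.
        , λ z → mk⇔ (λ ¬¬r → case refuted? z of λ { (yes r) → r ; (no ¬r) → contradiction ¬r ¬¬r }) (λ r ¬r → ¬r r))
      , (λ n → ForLength.advice n)
      , (proj₁ pb-adviceBound , λ n → ≤-trans (advice-short n) (proj₂ pb-adviceBound n))
      , λ x → mk⇔ (λ Lx r → Equivalence.to (refuted⇔ x) r Lx)
          -- Only the failure of a refutation is given, so membership in `L` has to come from a
          -- decision.
          (λ ¬r → case L? x of λ { (yes Lx) → Lx ; (no ¬Lx) → contradiction (Equivalence.from (refuted⇔ x) ¬Lx) ¬r })

open Distillation using (decide; module Advice)
open OrCompositions using (orComposition)
open import Relation.Unary using (_⊆_)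

theorem7 : HasPolynomialKernel SavingKVertices → NP ⊆ (coNP /poly)
theorem7 (kernel , (K , pK , runs) , kernel⇔ , (h , small-kernel) , _) np =
  Advice.coNP/poly kernel K pK runs kernel⇔ h small-kernel (decide np) (orComposition h np)
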